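{- Let $q$ be a power of an odd prime with $q\equiv 7 \pmod 8$ and $q>7$. Then the differential uniformity of $F_{2,\frac13}(x)=x^2\big(1+\frac{1}{3}\eta(x)\big)$ over $\mathbb{F}_q$ equals $3$.
   Context: $\eta$ denotes the quadratic character of $\mathbb{F}_q$: $\eta(0)=0$, $\eta(x)=1$ if $x$ is a nonzero square, $\eta(x)=-1$ if $x$ is a non-square. (Note $q\equiv 7\pmod 8$ forces the characteristic to differ from $3$, so $\frac13\in\mathbb{F}_q$.) For $f:\mathbb{F}_q\to\mathbb{F}_q$ and $a,b\in\mathbb{F}_q$, $\delta_f(a,b)=\#\{x\in\mathbb{F}_q: f(x+a)-f(x)=b\}$, and the differential uniformity of $f$ is $\delta_f=\max_{a\in\mathbb{F}_q^*,\,b\in\mathbb{F}_q}\delta_f(a,b)$. -}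

module Defs where

open import Level using (0ℓ)
open import Data.Nat using (ℕ; _⊔_)
open import Data.Fin using (Fin)
open import Data.List using (List; length; filter; map; foldr; allFin; concatMap)
open import Data.Product using (∃; _,_)
open import Relation.Nullary using (¬_; Dec; yes; no)
open import Relation.Nullary.Decidable using (map′)
open import Relation.Binary using (DecidableEquality)
open import Relation.Binary.PropositionalEquality using (_≡_)
open import Function.Bundles using (_↔_; Inverse)
open import Algebra.Structures using (IsCommutativeRing)
import Data.Fin.Properties as FinP

record FiniteField (q : ℕ) : Set₁ where
  infixl 6 _+_ _-_
  infixl 7 _*_
  field
    Carrier : Set
    _+_ _*_ : Carrier → Carrier → Carrier
    -_ : Carrier → Carrier
    0# 1# : Carrier
    isCommutativeRing : IsCommutativeRing _≡_ _+_ _*_ -_ 0# 1#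
    1≢0 : ¬ (1# ≡ 0#)
    _⁻¹ : Carrier → Carrier
    ⁻¹-inverse : ∀ x → ¬ (x ≡ 0#) → x * (x ⁻¹) ≡ 1#
    _≟_ : DecidableEquality Carrier
    enum : Carrier ↔ Fin q

  _-_ : Carrier → Carrier → Carrier
  x - y = x + (- y)

  elem : Fin q → Carrier
  elem = Inverse.from enum

  elements : List Carrier
  elements = map elem (allFin q)

  IsSquare : Carrier → Set
  IsSquare x = ∃ λ y → y * y ≡ x

  isSquare? : ∀ x → Dec (IsSquare x)
  isSquare? x = map′ (λ { (i , e) → elem i , e })
                     (λ { (y , e) → Inverse.to enum y , Data.Product.Σ.proj₂ (squareFrom y e) })
                     (FinP.any? (λ i → (elem i * elem i) ≟ x))
    where
    open import Relation.Binary.PropositionalEquality using (subst; cong)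
    squareFrom : ∀ y → y * y ≡ x → ∃ λ (_ : Carrier) → elem (Inverse.to enum y) * elem (Inverse.to enum y) ≡ x
    squareFrom y e = y , subst (λ z → z * z ≡ x) (Data.Product.Σ.proj₂ (Inverse.inverse enum) {y} _≡_.refl |> λ p → Relation.Binary.PropositionalEquality.sym p) e
      where
      _|>_ : ∀ {A B : Set} → A → (A → B) → B
      a |> f = f a

  η : Carrier → Carrier
  η x with x ≟ 0#
  ... | yes _ = 0#
  ... | no _ with isSquare? x
  ...   | yes _ = 1#
  ...   | no _ = - 1#

  3# : Carrier
  3# = 1# + 1# + 1#

  δ : (Carrier → Carrier) → Carrier → Carrier → ℕ
  δ f a b = length (filter (λ x → (f (x + a) - f x) ≟ b) elements)

  nonzeroElements : List Carrier
  nonzeroElements = filter (λ a → Relation.Nullary.Decidable.¬? (a ≟ 0#)) elements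

  diffUniformity : (Carrier → Carrier) → ℕ
  diffUniformity f =
    foldr _⊔_ 0 (concatMap (λ a → map (λ b → δ f a b) elements) nonzeroElements)

  F213 : Carrier → Carrier
  F213 x = (x * x) * (1# + (3# ⁻¹) * η x)

{-# OPTIONS --safe #-}

-- Let χ be the quadratic character; q ≡ 7 (mod 8) gives χ(-1) = -1 and χ(2) = 1. Up to the factor 2/3 the function is
-- G(x) = 2x² on squares and x² on non-squares, and scaling reduces the equation to G(x+1) - G(x) = c. According to the
-- characters of x and x+1 a solution is a root of one of two linear or two quadratic polynomials, and the interplay of
-- the four cases leaves at most three solutions.
--
-- Three solutions occur as soon as some x satisfies χ(x) = χ(x+3) = χ(x²+4x+1) = -1 and χ(x+1) = 1. The number of such
-- x is a character sum; a Möbius symmetry kills its genus 2 part, and 16 times the number is q + 1 - h₁ + h₂ - h₃ with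
-- three sums of the form h(D,λ) = Σ χ((x-λ)(x²-D)). Instead of the Hasse bound one uses Σ_λ h(D,λ)² < q² for a fixed D:
-- by 2-isogenies (and by moving 2-torsion points when 3 is a square) h₁² and h₂² occur for two values of ±λ each, so that
-- 4h₁² + 4h₂² + 2h₃² < q² and h₁ - h₂ + h₃ < q + 1.
--
-- In characteristic 7 these values of λ collide. There one looks, for s outside 𝔽₇, at the signs χ(s-i) with i ∈ 𝔽₇: the
-- absence of x forces s to look close to a point of the projective line over 𝔽₇, which makes Σ χ(s³-1) at most
-- -(q+1)/2, against the bound 6q²/(q-1) for its square coming from the family Σ χ(s³-c).
module Submission where

open import Defs
open import Level using (0ℓ)
open import Algebra.Bundles using (CommutativeRing; RawRing)
import Algebra.Properties.CommutativeMonoid.Sum as MonoidSum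
import Algebra.Properties.Ring as RingProperties
import Algebra.Solver.Ring as RingSolver
open import Algebra.Solver.Ring.AlmostCommutativeRing using (AlmostCommutativeRing; fromCommutativeRing; _-Raw-AlmostCommutative⟶_)
open import Data.Bool using (Bool; true; false; not)
import Data.Bool.Properties as Boolₚ
open import Data.Empty using (⊥)
open import Data.Fin using (Fin; zero; suc; toℕ)
open import Data.Fin.Permutation using (permutation)
import Data.Fin.Properties as Finₚ
open import Data.Integer as ℤ using (ℤ; -[1+_]; 0ℤ; 1ℤ; -1ℤ) renaming (+_ to pos)
import Data.Integer.Properties as ℤₚ
open import Data.Integer.Tactic.RingSolver using (solve-∀)
open import Data.List using (List; []; _∷_; length; map; foldr; concatMap; _++_; upTo; cartesianProduct)
open import Data.List.Membership.Propositional using (_∈_; find; lose)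
open import Data.List.Membership.Propositional.Properties using (∈-∃++; ∈-++⁺ˡ; ∈-++⁺ʳ; ∈-++⁻; ∈-map⁺; ∈-map⁻; ∈-filter⁺; ∈-filter⁻; ∈-allFin; ∈-concatMap⁺; ∈-concatMap⁻; ∈-upTo⁻)
open import Data.List.Properties using (length-map; length-++)
open import Data.List.Relation.Unary.All as All using (All; []; _∷_)
open import Data.List.Relation.Unary.All.Properties using (¬Any⇒All¬)
open import Data.List.Relation.Unary.AllPairs using (AllPairs; []; _∷_)
open import Data.List.Relation.Unary.Any using (Any; here; there; any?; satisfied)
open import Data.List.Relation.Unary.Unique.Propositional using (Unique)
import Data.List.Relation.Unary.Unique.Propositional.Properties as Uniqueₚ
import Data.Maybe as Maybe
open import Data.Nat as ℕ using (ℕ; zero; suc; _<_; _^_; _%_)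
open import Data.Nat.Coprimality as Coprimality using (Coprime; prime⇒coprime; coprime-Bézout)
import Data.Nat.DivMod as ℕ-DivMod
open import Data.Nat.GCD using (module Bézout)
open import Data.Nat.Primality using (Prime; prime?; prime⇒nonZero)
import Data.Nat.Properties as ℕₚ
open import Data.Product using (Σ; ∃; _×_; _,_; proj₁; proj₂)
open import Data.Sum using (_⊎_; inj₁; inj₂; [_,_]′)
open import Data.Vec as Vec using (Vec; []; _∷_)
open import Function using (_∘_)
open import Function.Bundles using (Inverse)
open import Relation.Binary.Definitions using (tri<; tri≈; tri>)
open import Relation.Binary.PropositionalEquality
open import Relation.Nullary using (¬_; Dec; yes; no; contradiction)
open import Relation.Nullary.Decidable as Dec using (dec⇒maybe; ¬?; _×-dec_; _⊎-dec_; map′; from-yes)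
open import Algebra.Properties.CommutativeMonoid.Sum ℤₚ.+-0-commutativeMonoid using (sum; sum-cong-≗; ∑-distrib-+; ∑-comm; sum-permute)
open import Algebra.Properties.Semiring.Sum ℤₚ.+-*-semiring using (*-distribˡ-sum)
open import Algebra.Properties.AbelianGroup ℤₚ.+-0-abelianGroup using () renaming (∙-cancelˡ to +ᶻ-cancelˡ; ∙-cancelʳ to +ᶻ-cancelʳ)

-- The weights 4, 4, 2 come from Cauchy-Schwarz: since 1/4 + 1/4 + 1/2 = 1, the square of h₁ - h₂ +
-- h₃ is at most 4h₁² + 4h₂² + 2h₃². Parseval gives Σ h(D,λ)² ≤ q² - 1 over all λ, and h(D,-λ) =
-- -h(D,λ) makes each λ ≠ 0 count twice. With h₁², h₂², h₃² occurring for one class ±λ each, this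
-- would bound only 2h₁² + 2h₂² + 2h₃², which does not contradict h₁ - h₂ + h₃ = q + 1. Hence the
-- search for a second λ for h₁ and for h₂, and its dependence on whether 3 is a square. The five λ
-- must be nonzero with distinct squares. The differences of these squares involve only a few
-- primes. Powers of an odd ℓ are congruent to 1 or ℓ mod 8, so q ≡ 7 (mod 8) forces p ≡ 7 (mod 8).
-- This excludes all of these primes except 7, which needs its own argument, and 23, which enters
-- through a single difference containing √3 and is avoided by the choice of the root.

-- Integers in the field and the ring solver

module FieldAlgebra {q : ℕ} (F : FiniteField q) where
  open FiniteField F

  commutativeRing : CommutativeRing 0ℓ 0ℓ
  commutativeRing = record { isCommutativeRing = isCommutativeRing }

  open CommutativeRing commutativeRing public
    using (+-assoc; +-comm; +-identityˡ; +-identityʳ; -‿inverseˡ; -‿inverseʳ; *-assoc; *-comm; *-identityˡ; *-identityʳ; distribˡ; distribʳ; zeroˡ; zeroʳ; ring)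
  open RingProperties ring
    using (-‿involutive; -0#≈0#; -‿distribˡ-*; -‿distribʳ-*; -‿+-comm)

  private
    fromℕ : ℕ → Carrier
    fromℕ zero = 0#
    fromℕ (suc n) = 1# + fromℕ n

    fromℤ : ℤ → Carrier
    fromℤ (pos n) = fromℕ n
    fromℤ (-[1+ n ]) = - fromℕ (suc n)

    fromℕ-+ : ∀ m n → fromℕ (m ℕ.+ n) ≡ fromℕ m + fromℕ n
    fromℕ-+ zero n = sym (+-identityˡ _)
    fromℕ-+ (suc m) n = trans (cong (1# +_) (fromℕ-+ m n)) (sym (+-assoc _ _ _))

    fromℕ-* : ∀ m n → fromℕ (m ℕ.* n) ≡ fromℕ m * fromℕ n
    fromℕ-* zero n = sym (zeroˡ _)
    fromℕ-* (suc m) n = begin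
      fromℕ (n ℕ.+ m ℕ.* n)   ≡⟨ fromℕ-+ n (m ℕ.* n) ⟩
      fromℕ n + fromℕ (m ℕ.* n)          ≡⟨ cong₂ _+_ (sym (*-identityˡ _)) (fromℕ-* m n) ⟩
      1# * fromℕ n + fromℕ m * fromℕ n   ≡⟨ sym (distribʳ _ _ _) ⟩
      (1# + fromℕ m) * fromℕ n           ∎
      where open ≡-Reasoning

    cancel-1 : ∀ a b → (1# + a) - (1# + b) ≡ a - b
    cancel-1 a b = begin
      (1# + a) - (1# + b)          ≡⟨ cong₂ _+_ (+-comm 1# a) (sym (-‿+-comm 1# b)) ⟩
      (a + 1#) + (- 1# + - b)      ≡⟨ +-assoc _ _ _ ⟩
      a + (1# + (- 1# + - b))      ≡⟨ cong (a +_) (sym (+-assoc _ _ _)) ⟩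
      a + ((1# + - 1#) + - b)      ≡⟨ cong (λ z → a + (z + - b)) (-‿inverseʳ 1#) ⟩
      a + (0# + - b)   ≡⟨ cong (a +_) (+-identityˡ _) ⟩
      a - b   ∎
      where open ≡-Reasoning

    fromℤ-⊖ : ∀ m n → fromℤ (m ℤ.⊖ n) ≡ fromℕ m - fromℕ n
    fromℤ-⊖ m zero = sym (trans (cong (fromℕ m +_) -0#≈0#) (+-identityʳ _))
    fromℤ-⊖ zero (suc n) = sym (+-identityˡ _)
    fromℤ-⊖ (suc m) (suc n) = begin
      fromℤ (suc m ℤ.⊖ suc n)   ≡⟨ cong fromℤ (ℤₚ.[1+m]⊖[1+n]≡m⊖n m n) ⟩
      fromℤ (m ℤ.⊖ n)   ≡⟨ fromℤ-⊖ m n ⟩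
      fromℕ m - fromℕ n   ≡⟨ sym (cancel-1 _ _) ⟩
      fromℕ (suc m) - fromℕ (suc n)       ∎
      where open ≡-Reasoning

    fromℤ-+ : ∀ i j → fromℤ (i ℤ.+ j) ≡ fromℤ i + fromℤ j
    fromℤ-+ (pos m) (pos n) = fromℕ-+ m n
    fromℤ-+ (pos m) -[1+ n ] = fromℤ-⊖ m (suc n)
    fromℤ-+ -[1+ m ] (pos n) = trans (fromℤ-⊖ n (suc m)) (+-comm _ _)
    fromℤ-+ -[1+ m ] -[1+ n ] = begin
      - fromℕ (suc (suc (m ℕ.+ n)))          ≡⟨ cong (λ z → - fromℕ z) (sym (ℕₚ.+-suc (suc m) n)) ⟩
      - fromℕ (suc m ℕ.+ suc n)   ≡⟨ cong -_ (fromℕ-+ (suc m) (suc n)) ⟩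
      - (fromℕ (suc m) + fromℕ (suc n))      ≡⟨ sym (-‿+-comm _ _) ⟩
      - fromℕ (suc m) + - fromℕ (suc n)      ∎
      where open ≡-Reasoning

    fromℤ-neg : ∀ i → fromℤ (ℤ.- i) ≡ - fromℤ i
    fromℤ-neg (pos zero) = sym -0#≈0#
    fromℤ-neg (pos (suc n)) = refl
    fromℤ-neg -[1+ n ] = sym (-‿involutive _)

    fromℤ-*-pos : ∀ m j → fromℤ ( pos m ℤ.* j) ≡ fromℕ m * fromℤ j
    fromℤ-*-pos zero j = trans (cong fromℤ (ℤₚ.*-zeroˡ j)) (sym (zeroˡ _))
    fromℤ-*-pos (suc m) j = begin
      fromℤ (pos (suc m) ℤ.* j)   ≡⟨ cong fromℤ (ℤₚ.suc-* (pos m) j) ⟩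
      fromℤ (j ℤ.+ pos m ℤ.* j)   ≡⟨ fromℤ-+ j ( pos m ℤ.* j) ⟩
      fromℤ j + fromℤ ( pos m ℤ.* j)        ≡⟨ cong₂ _+_ (sym (*-identityˡ _)) (fromℤ-*-pos m j) ⟩
      1# * fromℤ j + fromℕ m * fromℤ j   ≡⟨ sym (distribʳ _ _ _) ⟩
      fromℕ (suc m) * fromℤ j   ∎
      where open ≡-Reasoning

    fromℤ-* : ∀ i j → fromℤ (i ℤ.* j) ≡ fromℤ i * fromℤ j
    fromℤ-* (pos m) j = fromℤ-*-pos m j
    fromℤ-* -[1+ m ] j = begin
      fromℤ (-[1+ m ] ℤ.* j)   ≡⟨ cong fromℤ (sym (ℤₚ.neg-distribˡ-* (pos (suc m)) j)) ⟩
      fromℤ (ℤ.- (pos (suc m) ℤ.* j))        ≡⟨ fromℤ-neg (pos (suc m) ℤ.* j) ⟩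
      - fromℤ (pos (suc m) ℤ.* j)   ≡⟨ cong -_ (fromℤ-*-pos (suc m) j) ⟩
      - (fromℕ (suc m) * fromℤ j)        ≡⟨ -‿distribˡ-* _ _ ⟩
      - fromℕ (suc m) * fromℤ j          ∎
      where open ≡-Reasoning

    abstract
      opaqueℤ : ℤ → Carrier
      opaqueℤ = fromℤ

      opaqueℤ-≡ : ∀ i → opaqueℤ i ≡ fromℤ i
      opaqueℤ-≡ i = refl

  -- Numerals other than 0 and ±1 are kept abstract so that the ring solver never unfolds them to unary sums.
  ι : ℤ → Carrier
  ι (pos 0) = 0#
  ι (pos 1) = 1#
  ι (pos (suc (suc n))) = opaqueℤ (pos (suc (suc n)))
  ι -[1+ 0 ] = - 1#
  ι -[1+ suc n ] = opaqueℤ -[1+ suc n ]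

  private
    ι-≡ : ∀ i → ι i ≡ fromℤ i
    ι-≡ (pos 0) = refl
    ι-≡ (pos 1) = sym (+-identityʳ 1#)
    ι-≡ (pos (suc (suc n))) = opaqueℤ-≡ _
    ι-≡ -[1+ 0 ] = cong -_ (sym (+-identityʳ 1#))
    ι-≡ -[1+ suc n ] = opaqueℤ-≡ _

  ι-+ : ∀ i j → ι (i ℤ.+ j) ≡ ι i + ι j
  ι-+ i j = trans (ι-≡ (i ℤ.+ j)) (trans (fromℤ-+ i j) (cong₂ _+_ (sym (ι-≡ i)) (sym (ι-≡ j))))

  ι-* : ∀ i j → ι (i ℤ.* j) ≡ ι i * ι j
  ι-* i j = trans (ι-≡ (i ℤ.* j)) (trans (fromℤ-* i j) (cong₂ _*_ (sym (ι-≡ i)) (sym (ι-≡ j))))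

  ι-neg : ∀ i → ι (ℤ.- i) ≡ - ι i
  ι-neg i = trans (ι-≡ (ℤ.- i)) (trans (fromℤ-neg i) (cong -_ (sym (ι-≡ i))))

  ♯_ : ℕ → Carrier
  ♯ n = ι (pos n)

  private
    ℤ-raw : RawRing 0ℓ 0ℓ
    ℤ-raw = record { Carrier = ℤ ; _≈_ = _≡_ ; _+_ = ℤ._+_ ; _*_ = ℤ._*_ ; -_ = ℤ.-_ ; 0# = 0ℤ ; 1# = 1ℤ }

    almost : AlmostCommutativeRing 0ℓ 0ℓ
    almost = fromCommutativeRing commutativeRing

    ι-morphism : ℤ-raw -Raw-AlmostCommutative⟶ almost
    ι-morphism = record { ⟦_⟧ = ι ; +-homo = ι-+ ; *-homo = ι-* ; -‿homo = ι-neg ; 0-homo = refl ; 1-homo = refl }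

  -- Coefficients are integers, whose equality is decided by computation; identities between
  -- numerals such as 2 · 2 = 4 then hold by normalisation, whatever the characteristic.
  module Solver = RingSolver ℤ-raw almost ι-morphism
    (λ i j → Maybe.map (cong ι) (dec⇒maybe (i ℤ.≟ j)))

  open Solver public using (solve; _:=_; _:+_; _:*_; _:-_; :-_; con)

  κ : ∀ {n} → ℕ → Solver.Polynomial n
  κ m = con (pos m)

Invertible : ∀ {q} → FiniteField q → ℕ → Set
Invertible F n = FieldAlgebra.♯_ F n ≢ FiniteField.0# F

-- Indicators and finite sums of integers

ind : ∀ {P : Set} → Dec P → ℤ
ind (yes _) = 1ℤ
ind (no _) = 0ℤ

ind-yes : ∀ {P : Set} (d : Dec P) → P → ind d ≡ 1ℤ
ind-yes (yes _) p = refl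
ind-yes (no ¬p) p = contradiction p ¬p

ind-no : ∀ {P : Set} (d : Dec P) → ¬ P → ind d ≡ 0ℤ
ind-no (yes p) ¬p = contradiction p ¬p
ind-no (no _) ¬p = refl

ind-cong : ∀ {P Q : Set} (d : Dec P) (e : Dec Q) → (P → Q) → (Q → P) → ind d ≡ ind e
ind-cong (yes p) e f g = sym (ind-yes e (f p))
ind-cong (no ¬p) e f g = sym (ind-no e (¬p ∘ g))

sum-const : ∀ n c → sum {n} (λ _ → c) ≡ pos n ℤ.* c
sum-const zero c = sym (ℤₚ.*-zeroˡ c)
sum-const (suc n) c = trans (cong (λ z → c ℤ.+ z) (sum-const n c)) (sym (ℤₚ.suc-* (pos n) c))

sum-zero : ∀ {n} (t : Fin n → ℤ) → (∀ i → t i ≡ 0ℤ) → sum t ≡ 0ℤ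
sum-zero {n} t t≡0 = trans (sum-cong-≗ t≡0) (trans (sum-const n 0ℤ) (ℤₚ.*-zeroʳ (pos n)))

sum-only : ∀ {n} (t : Fin n → ℤ) j → (∀ i → i ≢ j → t i ≡ 0ℤ) → sum t ≡ t j
sum-only t zero h = trans (cong (λ z → t zero ℤ.+ z) (sum-zero (t ∘ suc) λ i → h (suc i) λ ())) (ℤₚ.+-identityʳ _)
sum-only t (suc j) h = trans (cong₂ ℤ._+_ (h zero λ ()) (sum-only (t ∘ suc) j λ i i≢j → h (suc i) λ { refl → i≢j refl })) (ℤₚ.+-identityˡ _)

sum-mono-≤ : ∀ {n} (s t : Fin n → ℤ) → (∀ i → s i ℤ.≤ t i) → sum s ℤ.≤ sum t
sum-mono-≤ {zero} s t s≤t = ℤₚ.≤-refl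
sum-mono-≤ {suc n} s t s≤t = ℤₚ.+-mono-≤ (s≤t zero) (sum-mono-≤ (s ∘ suc) (t ∘ suc) (s≤t ∘ suc))

-- Sums over the field: reindexing, fibres, parity

module FieldSums {q : ℕ} (F : FiniteField q) where
  open FiniteField F
  open FieldAlgebra F

  index : Carrier → Fin q
  index = Inverse.to enum

  elem-index : ∀ x → elem (index x) ≡ x
  elem-index x = Inverse.strictlyInverseʳ enum x

  index-elem : ∀ i → index (elem i) ≡ i
  index-elem i = Inverse.strictlyInverseˡ enum i

  abstract
    ∑ : (Carrier → ℤ) → ℤ
    ∑ f = sum (λ i → f (elem i))

    ∑-cong : ∀ {f g} → (∀ x → f x ≡ g x) → ∑ f ≡ ∑ g
    ∑-cong f≡g = sum-cong-≗ (f≡g ∘ elem)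

    ∑-+ : ∀ f g → ∑ (λ x → f x ℤ.+ g x) ≡ ∑ f ℤ.+ ∑ g
    ∑-+ f g = ∑-distrib-+ (f ∘ elem) (g ∘ elem)

    ∑-*ˡ : ∀ c f → ∑ (λ x → c ℤ.* f x) ≡ c ℤ.* ∑ f
    ∑-*ˡ c f = sym (*-distribˡ-sum c (f ∘ elem))

    ∑-const : ∀ c → ∑ (λ _ → c) ≡ pos q ℤ.* c
    ∑-const c = sum-const q c

    ∑-swap : ∀ (f : Carrier → Carrier → ℤ) → ∑ (λ x → ∑ (f x)) ≡ ∑ (λ y → ∑ (λ x → f x y))
    ∑-swap f = ∑-comm (λ i j → f (elem i) (elem j))

    ∑-mono-≤ : ∀ {f g} → (∀ x → f x ℤ.≤ g x) → ∑ f ℤ.≤ ∑ g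
    ∑-mono-≤ f≤g = sum-mono-≤ _ _ (f≤g ∘ elem)

    ∑-only : ∀ f a → (∀ x → x ≢ a → f x ≡ 0ℤ) → ∑ f ≡ f a
    ∑-only f a h = trans (sum-only (f ∘ elem) (index a) λ i i≢ → h (elem i) λ e → i≢ (trans (sym (index-elem i)) (cong index e))) (cong f (elem-index a))

    ∑-reindex : ∀ f (π π⁻ : Carrier → Carrier) → (∀ x → π (π⁻ x) ≡ x) → (∀ x → π⁻ (π x) ≡ x) → ∑ f ≡ ∑ (f ∘ π)
    ∑-reindex f π π⁻ ππ⁻ π⁻π = trans
      (sum-permute (f ∘ elem) (permutation (index ∘ π ∘ elem) (index ∘ π⁻ ∘ elem) (conj π π⁻ ππ⁻) (conj π⁻ π π⁻π)))
      (sum-cong-≗ λ i → cong f (elem-index (π (elem i))))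
      where
      conj : ∀ (φ ψ : Carrier → Carrier) → (∀ x → φ (ψ x) ≡ x) → ∀ i → index (φ (elem (index (ψ (elem i))))) ≡ i
      conj φ ψ φψ i = trans (cong (index ∘ φ) (elem-index _)) (trans (cong index (φψ _)) (index-elem i))

  ∑-neg : ∀ f → ∑ (λ x → ℤ.- f x) ≡ ℤ.- ∑ f
  ∑-neg f = trans (∑-cong (λ x → sym (ℤₚ.-1*i≡-i (f x)))) (trans (∑-*ˡ -1ℤ f) (ℤₚ.-1*i≡-i _))

  ∑-*ʳ : ∀ c f → ∑ (λ x → f x ℤ.* c) ≡ ∑ f ℤ.* c
  ∑-*ʳ c f = trans (∑-cong λ x → ℤₚ.*-comm (f x) c) (trans (∑-*ˡ c f) (ℤₚ.*-comm c _))

  ∑-1 : ∑ (λ _ → 1ℤ) ≡ pos q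
  ∑-1 = trans (∑-const 1ℤ) (ℤₚ.*-identityʳ _)

  ∑-zero : ∀ {f} → (∀ x → f x ≡ 0ℤ) → ∑ f ≡ 0ℤ
  ∑-zero f≡0 = trans (∑-cong f≡0) (trans (∑-const 0ℤ) (ℤₚ.*-zeroʳ (pos q)))

  -- Substitutions like x ↦ k/x respect a formula off one point only. The two exceptional values
  -- stand on opposite sides, so nothing has to be subtracted.
  ∑-except : ∀ f g a → (∀ x → x ≢ a → f x ≡ g x) → ∑ f ℤ.+ g a ≡ ∑ g ℤ.+ f a
  ∑-except f g a h = begin
    ∑ f ℤ.+ g a   ≡⟨ cong (λ z → z ℤ.+ g a) (∑-cong λ x → lem (f x) (g x)) ⟩
    ∑ (λ x → g x ℤ.+ (f x ℤ.- g x)) ℤ.+ g a      ≡⟨ cong (λ z → z ℤ.+ g a) (∑-+ g (λ x → f x ℤ.- g x)) ⟩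
    ∑ g ℤ.+ ∑ (λ x → f x ℤ.- g x) ℤ.+ g a        ≡⟨ cong (λ z → ∑ g ℤ.+ z ℤ.+ g a) (∑-only _ a λ x x≢a → trans (cong (λ z → z ℤ.- g x) (h x x≢a)) (ℤₚ.+-inverseʳ (g x))) ⟩
    ∑ g ℤ.+ (f a ℤ.- g a) ℤ.+ g a   ≡⟨ lem₂ (∑ g) (f a) (g a) ⟩
    ∑ g ℤ.+ f a   ∎
    where
    open ≡-Reasoning
    lem : ∀ a b → a ≡ b ℤ.+ (a ℤ.- b)
    lem = solve-∀
    lem₂ : ∀ a b c → a ℤ.+ (b ℤ.- c) ℤ.+ c ≡ a ℤ.+ b
    lem₂ = solve-∀

  -- Compare f with the function that equals f a at a and 0 elsewhere: it dominates f, so 0 = ∑ f ≤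
  -- f a.
  ∑-nonpos-vanish : ∀ f → (∀ x → f x ℤ.≤ 0ℤ) → ∑ f ≡ 0ℤ → ∀ x → f x ≡ 0ℤ
  ∑-nonpos-vanish f f≤0 ∑f≡0 a = ℤₚ.≤-antisym (f≤0 a) (ℤₚ.≤-trans (ℤₚ.≤-reflexive (sym ∑f≡0)) (ℤₚ.≤-trans (∑-mono-≤ bound) (ℤₚ.≤-reflexive (trans (∑-only g a off) on))))
    where
    g : Carrier → ℤ
    g x = ind (x ≟ a) ℤ.* f a
    off : ∀ x → x ≢ a → g x ≡ 0ℤ
    off x x≢a = trans (cong (λ z → z ℤ.* f a) (ind-no (x ≟ a) x≢a)) (ℤₚ.*-zeroˡ (f a))
    on : g a ≡ f a
    on = trans (cong (λ z → z ℤ.* f a) (ind-yes (a ≟ a) refl)) (ℤₚ.*-identityˡ _)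
    bound : ∀ x → f x ℤ.≤ g x
    bound x with x ≟ a
    ... | yes refl = ℤₚ.≤-reflexive (sym (ℤₚ.*-identityˡ _))
    ... | no _ = ℤₚ.≤-trans (f≤0 x) (ℤₚ.≤-reflexive (sym (ℤₚ.*-zeroˡ (f a))))

  -- Sorts the arguments x by the value c = φ(x). It is applied to squaring, with multiplicity 1 +
  -- χ(c), and to cubing.
  ∑-fibre : ∀ (φ : Carrier → Carrier) (g : Carrier → ℤ) → ∑ (g ∘ φ) ≡ ∑ (λ c → ∑ (λ x → ind (φ x ≟ c)) ℤ.* g c)
  ∑-fibre φ g = begin
    ∑ (g ∘ φ)   ≡⟨ ∑-cong (λ x → sym (pick x)) ⟩
    ∑ (λ x → ∑ (λ c → ind (φ x ≟ c) ℤ.* g c))          ≡⟨ ∑-swap _ ⟩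
    ∑ (λ c → ∑ (λ x → ind (φ x ≟ c) ℤ.* g c))          ≡⟨ ∑-cong (λ c → ∑-*ʳ (g c) _) ⟩
    ∑ (λ c → ∑ (λ x → ind (φ x ≟ c)) ℤ.* g c)          ∎
    where
    open ≡-Reasoning
    pick : ∀ x → ∑ (λ c → ind (φ x ≟ c) ℤ.* g c) ≡ g (φ x)
    pick x = trans
      (∑-only _ (φ x) λ c c≢ → trans (cong (λ z → z ℤ.* g c) (ind-no (φ x ≟ c) (c≢ ∘ sym))) (ℤₚ.*-zeroˡ (g c)))
      (trans (cong (λ z → z ℤ.* g (φ x)) (ind-yes (φ x ≟ φ x) refl)) (ℤₚ.*-identityˡ _))

  -- Each orbit of two elements is represented by the member that comes first in the enumeration,
  -- and fixed points have weight 0. All parity arguments that use q mod 8 rest on this.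
  ∑-involution-even : ∀ (π : Carrier → Carrier) (w : Carrier → ℤ) → (∀ x → π (π x) ≡ x) → (∀ x → w (π x) ≡ w x) →
    (∀ x → π x ≡ x → w x ≡ 0ℤ) → ∃ λ k → ∑ w ≡ pos 2 ℤ.* k
  ∑-involution-even π w ππ wπ fix = ∑ lt , (begin
    ∑ w   ≡⟨ ∑-cong split ⟩
    ∑ (λ x → lt x ℤ.+ lt (π x))       ≡⟨ ∑-+ lt (lt ∘ π) ⟩
    ∑ lt ℤ.+ ∑ (lt ∘ π)   ≡⟨ cong (λ z → ∑ lt ℤ.+ z) (sym (∑-reindex lt π π ππ ππ)) ⟩
    ∑ lt ℤ.+ ∑ lt   ≡⟨ dbl (∑ lt) ⟩
    pos 2 ℤ.* ∑ lt   ∎)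
    where
    open ≡-Reasoning
    dbl : ∀ a → a ℤ.+ a ≡ pos 2 ℤ.* a
    dbl = solve-∀
    rank : Carrier → ℕ
    rank = toℕ ∘ index
    rank-injective : ∀ x y → rank x ≡ rank y → x ≡ y
    rank-injective x y e = trans (sym (elem-index x)) (trans (cong elem (Finₚ.toℕ-injective e)) (elem-index y))
    lt : Carrier → ℤ
    lt x = ind (rank x ℕ.<? rank (π x)) ℤ.* w x
    lt-yes : ∀ x → rank x ℕ.< rank (π x) → lt x ≡ w x
    lt-yes x p = trans (cong (λ z → z ℤ.* w x) (ind-yes (_ ℕ.<? _) p)) (ℤₚ.*-identityˡ _)
    lt-no : ∀ x → ¬ (rank x ℕ.< rank (π x)) → lt x ≡ 0ℤ
    lt-no x p = trans (cong (λ z → z ℤ.* w x) (ind-no (_ ℕ.<? _) p)) (ℤₚ.*-zeroˡ (w x))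
    πx< : ∀ x → rank (π x) ℕ.< rank x → rank (π x) ℕ.< rank (π (π x))
    πx< x p = subst (λ z → rank (π x) ℕ.< rank z) (sym (ππ x)) p
    πx≮ : ∀ x → ¬ (rank (π x) ℕ.< rank x) → ¬ (rank (π x) ℕ.< rank (π (π x)))
    πx≮ x p r = p (subst (λ z → rank (π x) ℕ.< rank z) (ππ x) r)
    split : ∀ x → w x ≡ lt x ℤ.+ lt (π x)
    split x with ℕₚ.<-cmp (rank x) (rank (π x))
    ... | tri< a _ c = sym (trans (cong₂ ℤ._+_ (lt-yes x a) (lt-no (π x) (πx≮ x c))) (ℤₚ.+-identityʳ _))
    ... | tri≈ a b c = trans (fix x (sym (rank-injective _ _ b))) (sym (cong₂ ℤ._+_ (lt-no x a) (lt-no (π x) (πx≮ x c))))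
    ... | tri> a _ c = sym (trans (cong₂ ℤ._+_ (lt-no x a) (trans (lt-yes (π x) (πx< x c)) (wπ x))) (ℤₚ.+-identityˡ _))

2z≢1 : ∀ z → pos 2 ℤ.* z ≢ 1ℤ
2z≢1 (pos zero) ()
2z≢1 (pos (suc n)) e with trans (cong suc (sym (ℕₚ.+-suc n (n ℕ.+ 0)))) (ℤₚ.+-injective (trans (ℤₚ.pos-* 2 (suc n)) e))
... | ()
2z≢1 (-[1+ n ]) ()

-- The quadratic character with values in ℤ

module QuadraticCharacter {q : ℕ} (F : FiniteField q) where
  open FiniteField F
  open FieldAlgebra F
  open FieldSums F

  infix 4 _≢0
  _≢0 : Carrier → Set
  x ≢0 = x ≢ 0#

  x-y≡0⇒x≡y : ∀ x y → x - y ≡ 0# → x ≡ y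
  x-y≡0⇒x≡y x y e = trans (solve 2 (λ x y → x := (x :- y) :+ y) refl x y) (trans (cong (λ z → z + y) e) (+-identityˡ y))

  -- l ≡ m follows from p ≡ r whenever l - m is a multiple of p - r; the multiplier k is found by hand and the identity by the ring solver.
  via : ∀ {p r} k l m → p ≡ r → l - m ≡ k * (p - r) → l ≡ m
  via {p} k l m refl e = x-y≡0⇒x≡y l m (trans e (trans (cong (λ z → k * z) (-‿inverseʳ p)) (zeroʳ k)))

  x*y≡0⇒y≡0 : ∀ x y → x ≢0 → x * y ≡ 0# → y ≡ 0#
  x*y≡0⇒y≡0 x y x≢0 e = begin
    y   ≡⟨ sym (*-identityˡ y) ⟩
    1# * y   ≡⟨ cong (λ z → z * y) (sym (⁻¹-inverse x x≢0)) ⟩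
    x * x ⁻¹ * y       ≡⟨ solve 3 (λ x i y → x :* i :* y := i :* (x :* y)) refl x (x ⁻¹) y ⟩
    x ⁻¹ * (x * y)     ≡⟨ cong (λ z → x ⁻¹ * z) e ⟩
    x ⁻¹ * 0#          ≡⟨ zeroʳ _ ⟩
    0#   ∎
    where open ≡-Reasoning

  *-≢0 : ∀ {x y} → x ≢0 → y ≢0 → x * y ≢0
  *-≢0 {x} {y} x≢0 y≢0 e = y≢0 (x*y≡0⇒y≡0 x y x≢0 e)

  *-cancelˡ : ∀ x y z → x ≢0 → x * y ≡ x * z → y ≡ z
  *-cancelˡ x y z x≢0 e = x-y≡0⇒x≡y y z (x*y≡0⇒y≡0 x (y - z) x≢0
    (trans (solve 3 (λ x y z → x :* (y :- z) := x :* y :- x :* z) refl x y z) (trans (cong (λ w → w - x * z) e) (-‿inverseʳ _))))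

  neg-≢0 : ∀ {x} → x ≢0 → - x ≢0
  neg-≢0 {x} x≢0 e = x≢0 (trans (solve 1 (λ x → x := :- (:- x)) refl x) (trans (cong -_ e) (solve 0 (:- κ 0 := κ 0) refl)))

  inv-≢0 : ∀ {x} → x ≢0 → x ⁻¹ ≢0
  inv-≢0 {x} x≢0 e = 1≢0 (trans (sym (⁻¹-inverse x x≢0)) (trans (cong (λ z → x * z) e) (zeroʳ x)))

  square-roots : ∀ x y → x * x ≡ y * y → x ≡ y ⊎ x ≡ - y
  square-roots x y e with (x - y) ≟ 0#
  ... | yes x-y≡0 = inj₁ (x-y≡0⇒x≡y x y x-y≡0)
  ... | no x-y≢0 = inj₂ (x-y≡0⇒x≡y x (- y) (x*y≡0⇒y≡0 (x - y) (x - - y) x-y≢0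
    (trans (solve 2 (λ x y → (x :- y) :* (x :- :- y) := x :* x :- y :* y) refl x y) (trans (cong (λ z → z - y * y) e) (-‿inverseʳ _)))))

  x*x≡0⇒x≡0 : ∀ x → x * x ≡ 0# → x ≡ 0#
  x*x≡0⇒x≡0 x e with x ≟ 0#
  ... | yes p = p
  ... | no p = x*y≡0⇒y≡0 x x p e

  abstract
    -- The values of `η` lie in the field; character sums need integer values, for which estimates
    -- make sense.
    χ : Carrier → ℤ
    χ x with x ≟ 0#
    ... | yes _ = 0ℤ
    ... | no _ with isSquare? x
    ...   | yes _ = 1ℤ
    ...   | no _ = -1ℤ

    η≡ι∘χ : ∀ x → η x ≡ ι (χ x)
    η≡ι∘χ x with x ≟ 0#
    ... | yes _ = refl
    ... | no _ with isSquare? x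
    ...   | yes _ = refl
    ...   | no _ = refl

  data Class (x : Carrier) : Set where
    isZero : x ≡ 0# → χ x ≡ 0ℤ → Class x
    isSq   : ∀ y → y ≢0 → y * y ≡ x → x ≢0 → χ x ≡ 1ℤ → Class x
    isNon  : x ≢0 → ¬ IsSquare x → χ x ≡ -1ℤ → Class x

  abstract
    classify : ∀ x → Class x
    classify x with x ≟ 0# in e₀
    ... | yes x≡0 = isZero x≡0 χx
      where
      χx : χ x ≡ 0ℤ
      χx rewrite e₀ = refl
    ... | no x≢0 with isSquare? x in e₁
    ...   | yes (y , yy≡x) = isSq y (λ y≡0 → x≢0 (trans (sym yy≡x) (trans (cong (λ z → z * y) y≡0) (zeroˡ y)))) yy≡x x≢0 χx
      where
      χx : χ x ≡ 1ℤ
      χx rewrite e₀ | e₁ = refl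
    ...   | no ¬sq = isNon x≢0 ¬sq χx
      where
      χx : χ x ≡ -1ℤ
      χx rewrite e₀ | e₁ = refl

  χ-0 : χ 0# ≡ 0ℤ
  χ-0 with classify 0#
  ... | isZero _ e = e
  ... | isSq _ _ _ n _ = contradiction refl n
  ... | isNon n _ _ = contradiction refl n

  χ-zero : ∀ {x} → x ≡ 0# → χ x ≡ 0ℤ
  χ-zero refl = χ-0

  χ-square : ∀ y → y ≢0 → χ (y * y) ≡ 1ℤ
  χ-square y y≢0 with classify (y * y)
  ... | isZero e _ = contradiction e (*-≢0 y≢0 y≢0)
  ... | isSq _ _ _ _ e = e
  ... | isNon _ ¬sq _ = contradiction (y , refl) ¬sq

  χ-non : ∀ {x} → x ≢0 → ¬ IsSquare x → χ x ≡ -1ℤ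
  χ-non {x} x≢0 ¬sq with classify x
  ... | isZero e _ = contradiction e x≢0
  ... | isSq y _ e _ _ = contradiction (y , e) ¬sq
  ... | isNon _ _ e = e

  χ≡1⇒square : ∀ {x} → χ x ≡ 1ℤ → ∃ λ y → y ≢0 × y * y ≡ x
  χ≡1⇒square {x} e with classify x
  ... | isZero _ e′ = contradiction (trans (sym e) e′) λ ()
  ... | isSq y y≢0 yy≡x _ _ = y , y≢0 , yy≡x
  ... | isNon _ _ e′ = contradiction (trans (sym e) e′) λ ()

  χ≡-1⇒nonsquare : ∀ {x} → χ x ≡ -1ℤ → ¬ IsSquare x
  χ≡-1⇒nonsquare {x} e with classify x
  ... | isZero _ e′ = contradiction (trans (sym e) e′) λ ()
  ... | isSq y y≢0 yy≡x _ e′ = contradiction (trans (sym e) e′) λ ()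
  ... | isNon _ ¬sq _ = ¬sq

  χ≢0⇒≢0 : ∀ {x} → χ x ≢ 0ℤ → x ≢0
  χ≢0⇒≢0 χx≢0 x≡0 = χx≢0 (χ-zero x≡0)

  χ² : ∀ {x} → x ≢0 → χ x ℤ.* χ x ≡ 1ℤ
  χ² {x} x≢0 with classify x
  ... | isZero e _ = contradiction e x≢0
  ... | isSq _ _ _ _ e = cong₂ ℤ._*_ e e
  ... | isNon _ _ e = cong₂ ℤ._*_ e e

  square-≢0⇒ : ∀ {x} → IsSquare x → x ≢0 → χ x ≡ 1ℤ
  square-≢0⇒ {x} sq x≢0 with classify x
  ... | isZero e _ = contradiction e x≢0
  ... | isSq _ _ _ _ e = e
  ... | isNon _ ¬sq _ = contradiction sq ¬sq

  -- The value 0 at 0 makes x ↦ k/x a permutation of the whole field, which reindexing requires.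
  inversion : Carrier → Carrier → Carrier
  inversion k x with x ≟ 0#
  ... | yes _ = 0#
  ... | no _ = k * x ⁻¹

  inversion-0 : ∀ k → inversion k 0# ≡ 0#
  inversion-0 k with 0# ≟ 0#
  ... | yes _ = refl
  ... | no n = contradiction refl n

  inversion-≢0 : ∀ k x → x ≢0 → x * inversion k x ≡ k
  inversion-≢0 k x x≢0 with x ≟ 0#
  ... | yes e = contradiction e x≢0
  ... | no _ = trans (solve 3 (λ x k i → x :* (k :* i) := k :* (x :* i)) refl x k (x ⁻¹)) (trans (cong (λ z → k * z) (⁻¹-inverse x x≢0)) (*-identityʳ k))

  inversion-involutive : ∀ k → k ≢0 → ∀ x → inversion k (inversion k x) ≡ x
  inversion-involutive k k≢0 x = go (x ≟ 0#)
    where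
    go : Dec (x ≡ 0#) → inversion k (inversion k x) ≡ x
    go (yes refl) = trans (cong (inversion k) (inversion-0 k)) (inversion-0 k)
    go (no x≢0) = *-cancelˡ y _ _ y≢0 (trans (inversion-≢0 k y y≢0) (trans (sym (inversion-≢0 k x x≢0)) (*-comm _ _)))
      where
      y : Carrier
      y = inversion k x
      y≢0 : y ≢0
      y≢0 e = k≢0 (trans (sym (inversion-≢0 k x x≢0)) (trans (cong (λ z → x * z) e) (zeroʳ x)))

  -- `g′` is the formula that g becomes under y = k/x. It is meaningful at x = 0 too, where it need
  -- not agree with g; the two values at 0 correct for this.
  ∑-inversion : ∀ k → k ≢0 → ∀ g g′ → (∀ x y → x ≢0 → x * y ≡ k → g y ≡ g′ x) → ∑ g ℤ.+ g′ 0# ≡ ∑ g′ ℤ.+ g 0#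
  ∑-inversion k k≢0 g g′ h = begin
    ∑ g ℤ.+ g′ 0#   ≡⟨ cong (λ z → z ℤ.+ g′ 0#) (∑-reindex g (inversion k) (inversion k) (inversion-involutive k k≢0) (inversion-involutive k k≢0)) ⟩
    ∑ (g ∘ inversion k) ℤ.+ g′ 0#     ≡⟨ ∑-except (g ∘ inversion k) g′ 0# (λ x x≢0 → h x (inversion k x) x≢0 (inversion-≢0 k x x≢0)) ⟩
    ∑ g′ ℤ.+ g (inversion k 0#)       ≡⟨ cong (λ z → ∑ g′ ℤ.+ g z) (inversion-0 k) ⟩
    ∑ g′ ℤ.+ g 0#   ∎
    where open ≡-Reasoning

  ∑-shift : ∀ a f → ∑ f ≡ ∑ (λ x → f (x + a))
  ∑-shift a f = ∑-reindex f (λ x → x + a) (λ x → x - a)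
    (λ x → solve 2 (λ x a → x :- a :+ a := x) refl x a) (λ x → solve 2 (λ x a → x :+ a :- a := x) refl x a)

  ∑-negate : ∀ f → ∑ f ≡ ∑ (λ x → f (- x))
  ∑-negate f = ∑-reindex f -_ -_ neg² neg²
    where
    neg² : ∀ x → - - x ≡ x
    neg² = solve 1 (λ x → :- (:- x) := x) refl

  ∑-scale : ∀ u → u ≢0 → ∀ f → ∑ f ≡ ∑ (λ x → f (u * x))
  ∑-scale u u≢0 f = ∑-reindex f (λ x → u * x) (λ x → u ⁻¹ * x)
    (λ x → trans (solve 3 (λ u i x → u :* (i :* x) := u :* i :* x) refl u (u ⁻¹) x) (cancel x))
    (λ x → trans (solve 3 (λ u i x → i :* (u :* x) := u :* i :* x) refl u (u ⁻¹) x) (cancel x))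
    where
    cancel : ∀ x → u * u ⁻¹ * x ≡ x
    cancel x = trans (cong (λ z → z * x) (⁻¹-inverse u u≢0)) (*-identityˡ x)

-- Consequences of q ≡ 7 (mod 8) and the sums of χ over linear and quadratic polynomials

module Mod8 {q : ℕ} (F : FiniteField q) (q≡7 : q ℕ.% 8 ≡ 7) where
  open FiniteField F
  open FieldAlgebra F
  open FieldSums F
  open QuadraticCharacter F

  private
    M : ℤ
    M = pos (q ℕ./ 8)

    q≡7+8M : pos q ≡ pos 7 ℤ.+ pos 8 ℤ.* M
    q≡7+8M = begin
      pos q   ≡⟨ cong pos (ℕ-DivMod.m≡m%n+[m/n]*n q 8) ⟩
      pos (q ℕ.% 8 ℕ.+ q ℕ./ 8 ℕ.* 8)          ≡⟨ cong (λ z → pos (z ℕ.+ q ℕ./ 8 ℕ.* 8)) q≡7 ⟩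
      pos (7 ℕ.+ q ℕ./ 8 ℕ.* 8)   ≡⟨ ℤₚ.pos-+ 7 (q ℕ./ 8 ℕ.* 8) ⟩
      pos 7 ℤ.+ pos (q ℕ./ 8 ℕ.* 8)   ≡⟨ cong (λ z → pos 7 ℤ.+ z) (trans (ℤₚ.pos-* (q ℕ./ 8) 8) (ℤₚ.*-comm M (pos 8))) ⟩
      pos 7 ℤ.+ pos 8 ℤ.* M   ∎
      where open ≡-Reasoning

  -- If 2 = 0, then x ↦ x + 1 is an involution without fixed points and q is even.
  2≢0 : ♯ 2 ≢0
  2≢0 2≡0 with ∑-involution-even (λ x → x + 1#) (λ _ → 1ℤ)
      (λ x → trans (solve 1 (λ x → x :+ κ 1 :+ κ 1 := x :+ κ 2) refl x) (trans (cong (λ z → x + z) 2≡0) (+-identityʳ x)))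
      (λ _ → refl)
      (λ x e → contradiction (trans (solve 1 (λ x → κ 1 := x :+ κ 1 :- x) refl x) (trans (cong (λ z → z - x) e) (-‿inverseʳ x))) 1≢0)
  ... | k , e = 2z≢1 (k ℤ.- pos 4 ℤ.* M ℤ.- pos 3) (begin
    pos 2 ℤ.* (k ℤ.- pos 4 ℤ.* M ℤ.- pos 3)   ≡⟨ lem k M ⟩
    pos 2 ℤ.* k ℤ.- (pos 7 ℤ.+ pos 8 ℤ.* M) ℤ.+ 1ℤ   ≡⟨ cong (λ z → z ℤ.- (pos 7 ℤ.+ pos 8 ℤ.* M) ℤ.+ 1ℤ) (trans (sym e) (trans ∑-1 q≡7+8M)) ⟩
    (pos 7 ℤ.+ pos 8 ℤ.* M) ℤ.- (pos 7 ℤ.+ pos 8 ℤ.* M) ℤ.+ 1ℤ  ≡⟨ lem₂ (pos 7 ℤ.+ pos 8 ℤ.* M) ⟩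
    1ℤ   ∎)
    where
    open ≡-Reasoning
    lem : ∀ k m → pos 2 ℤ.* (k ℤ.- pos 4 ℤ.* m ℤ.- pos 3) ≡ pos 2 ℤ.* k ℤ.- (pos 7 ℤ.+ pos 8 ℤ.* m) ℤ.+ 1ℤ
    lem = solve-∀
    lem₂ : ∀ a → a ℤ.- a ℤ.+ 1ℤ ≡ 1ℤ
    lem₂ = solve-∀

  x≡-x⇒x≡0 : ∀ x → x ≡ - x → x ≡ 0#
  x≡-x⇒x≡0 x e = x*y≡0⇒y≡0 (♯ 2) x 2≢0 (trans (solve 1 (λ x → κ 2 :* x := x :- :- x) refl x) (trans (cong (λ z → z - - x) e) (-‿inverseʳ (- x))))

  count-square-roots : ∀ c → ∑ (λ x → ind ((x * x) ≟ c)) ≡ 1ℤ ℤ.+ χ c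
  count-square-roots c with classify c
  ... | isZero refl e = trans (trans
      (∑-only _ 0# λ x x≢0 → ind-no ((x * x) ≟ 0#) λ xx≡0 → x≢0 (x*x≡0⇒x≡0 x xx≡0))
      (ind-yes ((0# * 0#) ≟ 0#) (zeroˡ 0#))) (sym (cong (λ z → 1ℤ ℤ.+ z) e))
  ... | isNon _ ¬sq e = trans (∑-zero λ x → ind-no ((x * x) ≟ c) λ xx≡c → ¬sq (x , xx≡c)) (sym (cong (λ z → 1ℤ ℤ.+ z) e))
  ... | isSq y y≢0 refl _ e = begin
    ∑ (λ x → ind ((x * x) ≟ (y * y)))   ≡⟨ ∑-cong two ⟩
    ∑ (λ x → ind (x ≟ y) ℤ.+ ind (x ≟ (- y)))   ≡⟨ ∑-+ _ _ ⟩
    ∑ (λ x → ind (x ≟ y)) ℤ.+ ∑ (λ x → ind (x ≟ (- y)))          ≡⟨ cong₂ ℤ._+_ (one y) (one (- y)) ⟩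
    1ℤ ℤ.+ 1ℤ   ≡⟨ sym (cong (λ z → 1ℤ ℤ.+ z) e) ⟩
    1ℤ ℤ.+ χ (y * y)   ∎
    where
    open ≡-Reasoning
    one : ∀ a → ∑ (λ x → ind (x ≟ a)) ≡ 1ℤ
    one a = trans (∑-only _ a λ x x≢a → ind-no (x ≟ a) x≢a) (ind-yes (a ≟ a) refl)
    two : ∀ x → ind ((x * x) ≟ (y * y)) ≡ ind (x ≟ y) ℤ.+ ind (x ≟ (- y))
    two x with x ≟ y | x ≟ (- y)
    ... | yes refl | yes x≡-x = contradiction (x≡-x⇒x≡0 x x≡-x) y≢0
    ... | yes refl | no _ = ind-yes ((x * x) ≟ (x * x)) refl
    ... | no _ | yes refl = ind-yes ((- y * - y) ≟ (y * y)) (solve 1 (λ y → :- y :* :- y := y :* y) refl y)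
    ... | no x≢y | no x≢-y = ind-no ((x * x) ≟ (y * y)) λ e → case (square-roots x y e)
      where
      case : x ≡ y ⊎ x ≡ - y → ⊥
      case (inj₁ p) = x≢y p
      case (inj₂ p) = x≢-y p

  -- Sorting all x by their squares c gives q = ∑ (1 + χ c).
  ∑χ : ∑ χ ≡ 0ℤ
  ∑χ = +ᶻ-cancelˡ (pos q) (∑ χ) 0ℤ (begin
    pos q ℤ.+ ∑ χ   ≡⟨ cong (λ z → z ℤ.+ ∑ χ) (sym ∑-1) ⟩
    ∑ (λ _ → 1ℤ) ℤ.+ ∑ χ   ≡⟨ sym (∑-+ _ χ) ⟩
    ∑ (λ c → 1ℤ ℤ.+ χ c)   ≡⟨ ∑-cong (λ c → trans (sym (count-square-roots c)) (sym (ℤₚ.*-identityʳ _))) ⟩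
    ∑ (λ c → ∑ (λ x → ind ((x * x) ≟ c)) ℤ.* 1ℤ)          ≡⟨ sym (∑-fibre (λ x → x * x) (λ _ → 1ℤ)) ⟩
    ∑ (λ _ → 1ℤ)   ≡⟨ ∑-1 ⟩
    pos q   ≡⟨ sym (ℤₚ.+-identityʳ _) ⟩
    pos q ℤ.+ 0ℤ   ∎)
    where open ≡-Reasoning

  χ²-sum : ∑ (λ x → χ x ℤ.* χ x) ℤ.+ 1ℤ ≡ pos q
  χ²-sum = trans (∑-except (λ x → χ x ℤ.* χ x) (λ _ → 1ℤ) 0# (λ x → χ²)) (trans (cong₂ ℤ._+_ ∑-1 (cong (λ z → z ℤ.* z) χ-0)) (ℤₚ.+-identityʳ _))

  isSq₁ : Carrier → ℤ
  isSq₁ x = ind (χ x ℤ.≟ 1ℤ)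

  2isSq₁ : ∀ x → pos 2 ℤ.* isSq₁ x ≡ χ x ℤ.* χ x ℤ.+ χ x
  2isSq₁ x with classify x
  ... | isZero _ e rewrite e = refl
  ... | isSq _ _ _ _ e rewrite e = refl
  ... | isNon _ _ e rewrite e = refl

  square-*⇒square : ∀ x y → x ≢0 → IsSquare x → IsSquare (x * y) → IsSquare y
  square-*⇒square x y x≢0 (a , aa≡x) (b , bb≡xy) = b * a ⁻¹ , *-cancelˡ x _ _ x≢0 (begin
    x * (b * a ⁻¹ * (b * a ⁻¹))   ≡⟨ cong (λ z → z * (b * a ⁻¹ * (b * a ⁻¹))) (sym aa≡x) ⟩
    a * a * (b * a ⁻¹ * (b * a ⁻¹))          ≡⟨ solve 3 (λ a b i → a :* a :* (b :* i :* (b :* i)) := (a :* i) :* (a :* i) :* (b :* b)) refl a b (a ⁻¹) ⟩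
    (a * a ⁻¹) * (a * a ⁻¹) * (b * b)        ≡⟨ cong (λ z → z * z * (b * b)) (⁻¹-inverse a a≢0) ⟩
    1# * 1# * (b * b)   ≡⟨ solve 1 (λ b → κ 1 :* κ 1 :* b := b) refl (b * b) ⟩
    b * b   ≡⟨ bb≡xy ⟩
    x * y   ∎)
    where
    open ≡-Reasoning
    a≢0 : a ≢0
    a≢0 a≡0 = x≢0 (trans (sym aa≡x) (trans (cong (λ z → z * a) a≡0) (zeroˡ a)))

  square-* : ∀ x y → IsSquare x → IsSquare y → IsSquare (x * y)
  square-* x y (a , refl) (b , refl) = a * b , solve 2 (λ a b → a :* b :* (a :* b) := a :* a :* (b :* b)) refl a b

  -- If -1 were a square, negation would pair off the nonzero squares, whose number (q - 1)/2 = 3 +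
  -- 4`M` is odd.
  -1-nonsquare : ¬ IsSquare (- 1#)
  -1-nonsquare -1sq with ∑-involution-even -_ isSq₁ (solve 1 (λ x → :- (:- x) := x) refl) inv fix
    where
    to : ∀ x → χ x ≡ 1ℤ → χ (- x) ≡ 1ℤ
    to x e with χ≡1⇒square e
    ... | y , y≢0 , refl = square-≢0⇒ (subst IsSquare (solve 1 (λ a → :- κ 1 :* a := :- a) refl (y * y)) (square-* (- 1#) (y * y) -1sq (y , refl))) (neg-≢0 (*-≢0 y≢0 y≢0))
    inv : ∀ x → isSq₁ (- x) ≡ isSq₁ x
    inv x = ind-cong _ _ (λ e → subst (λ z → χ z ≡ 1ℤ) (solve 1 (λ x → :- (:- x) := x) refl x) (to (- x) e)) (to x)
    fix : ∀ x → - x ≡ x → isSq₁ x ≡ 0ℤ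
    fix x e = ind-no _ λ e₁ → contradiction (trans (sym e₁) (χ-zero (x≡-x⇒x≡0 x (sym e)))) λ ()
  ... | k , e = 2z≢1 (k ℤ.- pos 2 ℤ.* M ℤ.- 1ℤ) (ℤₚ.*-cancelˡ-≡ (pos 2) _ _ (begin
    pos 2 ℤ.* (pos 2 ℤ.* (k ℤ.- pos 2 ℤ.* M ℤ.- 1ℤ))   ≡⟨ lem k M ⟩
    pos 2 ℤ.* (pos 2 ℤ.* k) ℤ.- (pos 7 ℤ.+ pos 8 ℤ.* M) ℤ.+ pos 3 ≡⟨ cong₂ (λ y z → pos 2 ℤ.* y ℤ.- z ℤ.+ pos 3) (sym e) (sym q≡7+8M) ⟩
    pos 2 ℤ.* ∑ isSq₁ ℤ.- pos q ℤ.+ pos 3   ≡⟨ cong₂ (λ y z → y ℤ.- z ℤ.+ pos 3) 2∑ (sym χ²-sum) ⟩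
    S ℤ.- (S ℤ.+ 1ℤ) ℤ.+ pos 3   ≡⟨ lem₂ S ⟩
    pos 2 ℤ.* 1ℤ   ∎))
    where
    open ≡-Reasoning
    S : ℤ
    S = ∑ (λ x → χ x ℤ.* χ x)
    2∑ : pos 2 ℤ.* ∑ isSq₁ ≡ S
    2∑ = trans (sym (∑-*ˡ (pos 2) isSq₁)) (trans (∑-cong 2isSq₁) (trans (∑-+ _ χ) (trans (cong (λ z → S ℤ.+ z) ∑χ) (ℤₚ.+-identityʳ S))))
    lem : ∀ k m → pos 2 ℤ.* (pos 2 ℤ.* (k ℤ.- pos 2 ℤ.* m ℤ.- 1ℤ)) ≡ pos 2 ℤ.* (pos 2 ℤ.* k) ℤ.- (pos 7 ℤ.+ pos 8 ℤ.* m) ℤ.+ pos 3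
    lem = solve-∀
    lem₂ : ∀ s → s ℤ.- (s ℤ.+ 1ℤ) ℤ.+ pos 3 ≡ pos 2 ℤ.* 1ℤ
    lem₂ = solve-∀

  -- Negation sends squares to non-squares, so χ(x) + χ(-x) ≤ 0; as these sum to 0, they all vanish.
  χ-neg : ∀ x → χ (- x) ≡ ℤ.- χ x
  χ-neg x = trans (lem (χ x) (χ (- x))) (trans (cong (λ z → z ℤ.- χ x) (vanish x)) (ℤₚ.+-identityˡ _))
    where
    lem : ∀ a b → b ≡ (a ℤ.+ b) ℤ.- a
    lem = solve-∀
    nonpos : ∀ x → χ x ℤ.+ χ (- x) ℤ.≤ 0ℤ
    nonpos x with classify x | classify (- x)
    ... | isZero _ e | isZero _ e′ rewrite e | e′ = ℤₚ.≤-refl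
    ... | isZero e _ | isSq _ _ _ n _ = contradiction (trans (cong -_ e) (solve 0 (:- κ 0 := κ 0) refl)) n
    ... | isZero e _ | isNon n _ _ = contradiction (trans (cong -_ e) (solve 0 (:- κ 0 := κ 0) refl)) n
    ... | isSq _ _ _ n _ | isZero e _ = contradiction e (neg-≢0 n)
    ... | isNon n _ _ | isZero e _ = contradiction e (neg-≢0 n)
    ... | isSq y _ e n _ | isSq y′ _ e′ _ _ = contradiction (square-*⇒square x (- 1#) n (y , e) (y′ , trans e′ (solve 1 (λ x → :- x := x :* :- κ 1) refl x))) -1-nonsquare
    ... | isSq _ _ _ _ e | isNon _ _ e′ rewrite e | e′ = ℤₚ.≤-refl
    ... | isNon _ _ e | isSq _ _ _ _ e′ rewrite e | e′ = ℤₚ.≤-refl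
    ... | isNon _ _ e | isNon _ _ e′ rewrite e | e′ = ℤ.-≤+
    vanish : ∀ x → χ x ℤ.+ χ (- x) ≡ 0ℤ
    vanish = ∑-nonpos-vanish _ nonpos (trans (∑-+ χ _) (cong₂ ℤ._+_ ∑χ (trans (sym (∑-negate χ)) ∑χ)))

  neg-nonsquare : ∀ x → x ≢0 → ¬ IsSquare x → IsSquare (- x)
  neg-nonsquare x x≢0 ¬sq with χ≡1⇒square {x = - x} (trans (χ-neg x) (cong ℤ.-_ (χ-non x≢0 ¬sq)))
  ... | y , _ , e = y , e

  -- The essential case is that of two non-squares: there -x and -y are squares, and xy = (-x)(-y).
  χ-* : ∀ x y → χ (x * y) ≡ χ x ℤ.* χ y
  χ-* x y with classify x | classify y
  ... | isZero refl e | _ rewrite e = trans (χ-zero (zeroˡ y)) (sym (ℤₚ.*-zeroˡ (χ y)))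
  ... | isSq _ _ _ _ _ | isZero refl e rewrite e = trans (χ-zero (zeroʳ x)) (sym (ℤₚ.*-zeroʳ (χ x)))
  ... | isNon _ _ _ | isZero refl e rewrite e = trans (χ-zero (zeroʳ x)) (sym (ℤₚ.*-zeroʳ (χ x)))
  ... | isSq a _ aa n e | isSq b _ bb n′ e′ rewrite e | e′ = square-≢0⇒ (square-* x y (a , aa) (b , bb)) (*-≢0 n n′)
  ... | isSq a _ aa n e | isNon n′ ¬sq e′ rewrite e | e′ = χ-non (*-≢0 n n′) (¬sq ∘ square-*⇒square x y n (a , aa))
  ... | isNon n ¬sq e | isSq b _ bb n′ e′ rewrite e | e′ = χ-non (*-≢0 n n′) (¬sq ∘ square-*⇒square y x n′ (b , bb) ∘ subst IsSquare (*-comm x y))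
  ... | isNon n ¬sq e | isNon n′ ¬sq′ e′ rewrite e | e′ = square-≢0⇒ (subst IsSquare (solve 2 (λ x y → :- x :* :- y := x :* y) refl x y)
      (square-* (- x) (- y) (neg-nonsquare x n ¬sq) (neg-nonsquare y n′ ¬sq′))) (*-≢0 n n′)

  χ-square-* : ∀ y x → y ≢0 → χ (y * y * x) ≡ χ x
  χ-square-* y x y≢0 = trans (χ-* (y * y) x) (trans (cong (λ z → z ℤ.* χ x) (χ-square y y≢0)) (ℤₚ.*-identityˡ _))

  χ-1 : χ 1# ≡ 1ℤ
  χ-1 = trans (cong χ (sym (*-identityˡ 1#))) (χ-square 1# 1≢0)

  χ-neg1 : χ (- 1#) ≡ -1ℤ
  χ-neg1 = trans (χ-neg 1#) (cong ℤ.-_ χ-1)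

  ∑χ-shift : ∀ a → ∑ (λ x → χ (x - a)) ≡ 0ℤ
  ∑χ-shift a = trans (sym (∑-shift (- a) χ)) ∑χ

  -- With y = D/x one has y(y - D) = y²(1 - x), so the sum is that of χ(1 - x) over x ≠ 0, which is
  -- 0 - χ(1).
  ∑χ[x[x-D]] : ∀ D → D ≢0 → ∑ (λ x → χ (x * (x - D))) ≡ -1ℤ
  ∑χ[x[x-D]] D D≢0 = +ᶻ-cancelʳ 1ℤ _ _ (begin
    ∑ (λ x → χ (x * (x - D))) ℤ.+ 1ℤ   ≡⟨ cong (λ z → ∑ (λ x → χ (x * (x - D))) ℤ.+ z) (sym g′0) ⟩
    ∑ (λ x → χ (x * (x - D))) ℤ.+ χ (1# - 0#)   ≡⟨ ∑-inversion D D≢0 _ (λ x → χ (1# - x)) step ⟩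
    ∑ (λ x → χ (1# - x)) ℤ.+ χ (0# * (0# - D))  ≡⟨ cong₂ ℤ._+_ ∑g′ (χ-zero (zeroˡ _)) ⟩
    0ℤ   ∎)
    where
    open ≡-Reasoning
    g′0 : χ (1# - 0#) ≡ 1ℤ
    g′0 = trans (cong χ (solve 0 (κ 1 :- κ 0 := κ 1) refl)) χ-1
    ∑g′ : ∑ (λ x → χ (1# - x)) ≡ 0ℤ
    ∑g′ = trans (∑-negate _) (trans (∑-cong λ x → cong χ (solve 1 (λ x → κ 1 :- :- x := x :- :- κ 1) refl x)) (∑χ-shift (- 1#)))
    step : ∀ x y → x ≢0 → x * y ≡ D → χ (y * (y - D)) ≡ χ (1# - x)
    step x y x≢0 refl = trans (cong χ (solve 2 (λ x y → y :* (y :- x :* y) := y :* y :* (κ 1 :- x)) refl x y)) (χ-square-* y (1# - x) y≢0)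
      where
      y≢0 : y ≢0
      y≢0 y≡0 = D≢0 (trans (cong (λ z → x * z) y≡0) (zeroʳ x))

  -- Substitute c = x², with multiplicity 1 + χ(c): the two resulting sums are 0 and -1.
  ∑χ[x²-D] : ∀ D → D ≢0 → ∑ (λ x → χ (x * x - D)) ≡ -1ℤ
  ∑χ[x²-D] D D≢0 = begin
    ∑ (λ x → χ (x * x - D))   ≡⟨ ∑-fibre (λ x → x * x) (λ c → χ (c - D)) ⟩
    ∑ (λ c → ∑ (λ x → ind ((x * x) ≟ c)) ℤ.* χ (c - D))   ≡⟨ ∑-cong (λ c → trans (cong (λ z → z ℤ.* χ (c - D)) (count-square-roots c)) (trans (lem (χ c) (χ (c - D))) (cong (λ z → χ (c - D) ℤ.+ z) (sym (χ-* c (c - D)))))) ⟩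
    ∑ (λ c → χ (c - D) ℤ.+ χ (c * (c - D)))   ≡⟨ ∑-+ _ _ ⟩
    ∑ (λ c → χ (c - D)) ℤ.+ ∑ (λ c → χ (c * (c - D)))   ≡⟨ cong₂ ℤ._+_ (∑χ-shift D) (∑χ[x[x-D]] D D≢0) ⟩
    -1ℤ   ∎
    where
    open ≡-Reasoning
    lem : ∀ a b → (1ℤ ℤ.+ a) ℤ.* b ≡ b ℤ.+ a ℤ.* b
    lem = solve-∀

  ∑χ[x-a][x-b] : ∀ a b → a ≢ b → ∑ (λ x → χ (x - a) ℤ.* χ (x - b)) ≡ -1ℤ
  ∑χ[x-a][x-b] a b a≢b = begin
    ∑ (λ x → χ (x - a) ℤ.* χ (x - b))          ≡⟨ ∑-shift a _ ⟩
    ∑ (λ x → χ (x + a - a) ℤ.* χ (x + a - b))  ≡⟨ ∑-cong (λ x → trans (sym (χ-* _ _)) (cong χ (solve 3 (λ x a b → (x :+ a :- a) :* (x :+ a :- b) := x :* (x :- (b :- a))) refl x a b))) ⟩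
    ∑ (λ x → χ (x * (x - (b - a))))   ≡⟨ ∑χ[x[x-D]] (b - a) (λ e → a≢b (sym (x-y≡0⇒x≡y b a e))) ⟩
    -1ℤ   ∎
    where open ≡-Reasoning

  ∑χ[x-a]² : ∀ a → ∑ (λ x → χ (x - a) ℤ.* χ (x - a)) ℤ.+ 1ℤ ≡ pos q
  ∑χ[x-a]² a = trans (cong (λ z → z ℤ.+ 1ℤ) (sym (∑-shift (- a) (λ x → χ x ℤ.* χ x)))) χ²-sum

  private
    consecutive : Carrier → ℤ
    consecutive x = isSq₁ x ℤ.* isSq₁ (x + 1#)

    -- (1 + χ x)(1 + χ (x+1)) is four times the indicator, except for the value 2 at x = 0.
    4consecutive : ∀ x → x ≢0 → (1ℤ ℤ.+ χ x) ℤ.* (1ℤ ℤ.+ χ (x + 1#)) ≡ pos 4 ℤ.* consecutive x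
    4consecutive x x≢0 with classify x | classify (x + 1#)
    ... | isZero e _ | _ = contradiction e x≢0
    ... | isSq y _ yy _ _ | isZero e _ = contradiction (y , trans yy (x-y≡0⇒x≡y x (- 1#) (trans (solve 1 (λ x → x :- :- κ 1 := x :+ κ 1) refl x) e))) -1-nonsquare
    ... | isSq _ _ _ _ e | isSq _ _ _ _ e′ rewrite e | e′ = refl
    ... | isSq _ _ _ _ e | isNon _ _ e′ rewrite e | e′ = refl
    ... | isNon _ _ e | isZero _ _ rewrite e = refl
    ... | isNon _ _ e | isSq _ _ _ _ _ rewrite e = refl
    ... | isNon _ _ e | isNon _ _ _ rewrite e = refl

    4∑consecutive : pos 4 ℤ.* ∑ consecutive ℤ.+ pos 3 ≡ pos q
    4∑consecutive = begin
      pos 4 ℤ.* ∑ consecutive ℤ.+ pos 3   ≡⟨ cong (λ z → z ℤ.+ pos 3) (sym (∑-*ˡ (pos 4) consecutive)) ⟩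
      S₄ ℤ.+ pos 3   ≡⟨ lem S₄ ⟩
      S₄ ℤ.+ pos 2 ℤ.+ 1ℤ   ≡⟨ cong (λ z → S₄ ℤ.+ z ℤ.+ 1ℤ) (sym at0) ⟩
      S₄ ℤ.+ w 0# ℤ.+ 1ℤ   ≡⟨ cong (λ z → z ℤ.+ 1ℤ) (∑-except (λ x → pos 4 ℤ.* consecutive x) w 0# (λ x n → sym (4consecutive x n))) ⟩
      ∑ w ℤ.+ pos 4 ℤ.* consecutive 0# ℤ.+ 1ℤ   ≡⟨ cong₂ (λ y z → y ℤ.+ pos 4 ℤ.* z ℤ.+ 1ℤ) ∑w c0 ⟩
      pos q ℤ.- 1ℤ ℤ.+ 0ℤ ℤ.+ 1ℤ   ≡⟨ lem₂ (pos q) ⟩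
      pos q   ∎
      where
      open ≡-Reasoning
      S₄ : ℤ
      S₄ = ∑ (λ x → pos 4 ℤ.* consecutive x)
      w : Carrier → ℤ
      w x = (1ℤ ℤ.+ χ x) ℤ.* (1ℤ ℤ.+ χ (x + 1#))
      lem : ∀ s → s ℤ.+ pos 3 ≡ s ℤ.+ pos 2 ℤ.+ 1ℤ
      lem = solve-∀
      lem₂ : ∀ s → s ℤ.- 1ℤ ℤ.+ 0ℤ ℤ.+ 1ℤ ≡ s
      lem₂ = solve-∀
      at0 : w 0# ≡ pos 2
      at0 = cong₂ (λ y z → (1ℤ ℤ.+ y) ℤ.* (1ℤ ℤ.+ z)) χ-0 (trans (cong χ (+-identityˡ 1#)) χ-1)
      c0 : consecutive 0# ≡ 0ℤ
      c0 = trans (cong (λ z → z ℤ.* isSq₁ (0# + 1#)) (ind-no (χ 0# ℤ.≟ 1ℤ) λ e → contradiction (trans (sym χ-0) e) λ ())) (ℤₚ.*-zeroˡ (isSq₁ (0# + 1#)))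
      expand : ∀ a b → (1ℤ ℤ.+ a) ℤ.* (1ℤ ℤ.+ b) ≡ 1ℤ ℤ.+ (a ℤ.+ (b ℤ.+ a ℤ.* b))
      expand = solve-∀
      as : ∀ x → w x ≡ 1ℤ ℤ.+ (χ (x - 0#) ℤ.+ (χ (x - - 1#) ℤ.+ χ (x - 0#) ℤ.* χ (x - - 1#)))
      as x = trans (cong₂ (λ y z → (1ℤ ℤ.+ χ y) ℤ.* (1ℤ ℤ.+ χ z)) (solve 1 (λ x → x := x :- κ 0) refl x) (solve 1 (λ x → x :+ κ 1 := x :- :- κ 1) refl x)) (expand (χ (x - 0#)) (χ (x - - 1#)))
      ∑w : ∑ w ≡ pos q ℤ.- 1ℤ
      ∑w = trans (∑-cong as) (trans (∑-+ _ _) (cong₂ ℤ._+_ ∑-1 (trans (∑-+ _ _) (cong₂ ℤ._+_ (∑χ-shift 0#) (trans (∑-+ _ _) (cong₂ ℤ._+_ (∑χ-shift (- 1#)) (∑χ[x-a][x-b] 0# (- 1#) λ e → neg-≢0 1≢0 (sym e))))))))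

  -- The number (q-3)/4 of pairs of consecutive squares is odd, and x ↦ 1/x permutes these pairs; its only possible fixed point is x = 1.
  χ-2 : χ (♯ 2) ≡ 1ℤ
  χ-2 with classify (♯ 2)
  ... | isZero e _ = contradiction e 2≢0
  ... | isSq _ _ _ _ e = e
  ... | isNon _ _ χ2≡-1 = contradiction (∑-involution-even (inversion 1#) consecutive (inversion-involutive 1# 1≢0) inv fix) odd
    where
    to : ∀ x → χ x ≡ 1ℤ → χ (inversion 1# x) ≡ 1ℤ × χ (inversion 1# x + 1#) ≡ χ (x + 1#)
    to x χx = χi , (begin
      χ (i + 1#)   ≡⟨ sym (trans (cong (λ z → z ℤ.* χ (i + 1#)) χx) (ℤₚ.*-identityˡ _)) ⟩
      χ x ℤ.* χ (i + 1#)          ≡⟨ sym (χ-* x (i + 1#)) ⟩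
      χ (x * (i + 1#))   ≡⟨ cong χ (trans (solve 2 (λ x i → x :* (i :+ κ 1) := x :* i :+ x) refl x i) (trans (cong (λ z → z + x) xi≡1) (+-comm 1# x))) ⟩
      χ (x + 1#)   ∎)
      where
      open ≡-Reasoning
      i : Carrier
      i = inversion 1# x
      xi≡1 : x * i ≡ 1#
      xi≡1 = inversion-≢0 1# x (χ≢0⇒≢0 λ e → contradiction (trans (sym χx) e) λ ())
      χi : χ i ≡ 1ℤ
      χi = trans (sym (trans (cong (λ z → z ℤ.* χ i) χx) (ℤₚ.*-identityˡ _))) (trans (sym (χ-* x i)) (trans (cong χ xi≡1) χ-1))
    ii : ∀ x → inversion 1# (inversion 1# x) ≡ x
    ii = inversion-involutive 1# 1≢0
    inv : ∀ x → consecutive (inversion 1# x) ≡ consecutive x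
    inv x with χ x ℤ.≟ 1ℤ
    ... | yes χx = cong₂ ℤ._*_ (ind-yes (χ (inversion 1# x) ℤ.≟ 1ℤ) (proj₁ (to x χx))) (cong (λ z → ind (z ℤ.≟ 1ℤ)) (proj₂ (to x χx)))
    ... | no χx≢1 = cong (λ z → z ℤ.* isSq₁ (inversion 1# x + 1#)) (ind-no (χ (inversion 1# x) ℤ.≟ 1ℤ) λ e → χx≢1 (trans (cong χ (sym (ii x))) (proj₁ (to _ e))))
    fix : ∀ x → inversion 1# x ≡ x → consecutive x ≡ 0ℤ
    fix x e = go (x ≟ 0#)
      where
      go : Dec (x ≡ 0#) → consecutive x ≡ 0ℤ
      go (yes refl) = cong (λ z → z ℤ.* isSq₁ (0# + 1#)) (ind-no (χ 0# ℤ.≟ 1ℤ) λ e → contradiction (trans (sym χ-0) e) λ ())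
      go (no x≢0) with square-roots x 1# (trans (cong (λ z → x * z) (sym e)) (trans (inversion-≢0 1# x x≢0) (sym (*-identityˡ 1#))))
      ... | inj₁ refl = trans (cong (λ z → isSq₁ 1# ℤ.* z) (ind-no (χ (1# + 1#) ℤ.≟ 1ℤ) λ e → contradiction (trans (sym χ2≡-1) (trans (cong χ (solve 0 (κ 2 := κ 1 :+ κ 1) refl)) e)) λ ())) (ℤₚ.*-zeroʳ (isSq₁ 1#))
      ... | inj₂ refl = cong (λ z → z ℤ.* isSq₁ (- 1# + 1#)) (ind-no (χ (- 1#) ℤ.≟ 1ℤ) λ e → contradiction (trans (sym χ-neg1) e) λ ())
    odd : ¬ (∃ λ k → ∑ consecutive ≡ pos 2 ℤ.* k)
    odd (k , e) = 2z≢1 (k ℤ.- M) (ℤₚ.*-cancelˡ-≡ (pos 4) _ _ (begin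
      pos 4 ℤ.* (pos 2 ℤ.* (k ℤ.- M))   ≡⟨ lem k M ⟩
      pos 4 ℤ.* (pos 2 ℤ.* k) ℤ.+ pos 3 ℤ.- (pos 7 ℤ.+ pos 8 ℤ.* M) ℤ.+ pos 4 ≡⟨ cong₂ (λ y z → pos 4 ℤ.* y ℤ.+ pos 3 ℤ.- z ℤ.+ pos 4) (sym e) (sym q≡7+8M) ⟩
      pos 4 ℤ.* ∑ consecutive ℤ.+ pos 3 ℤ.- pos q ℤ.+ pos 4   ≡⟨ cong (λ z → z ℤ.- pos q ℤ.+ pos 4) 4∑consecutive ⟩
      pos q ℤ.- pos q ℤ.+ pos 4   ≡⟨ lem₂ (pos q) ⟩
      pos 4 ℤ.* 1ℤ   ∎))
      where
      open ≡-Reasoning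
      lem : ∀ k m → pos 4 ℤ.* (pos 2 ℤ.* (k ℤ.- m)) ≡ pos 4 ℤ.* (pos 2 ℤ.* k) ℤ.+ pos 3 ℤ.- (pos 7 ℤ.+ pos 8 ℤ.* m) ℤ.+ pos 4
      lem = solve-∀
      lem₂ : ∀ a → a ℤ.- a ℤ.+ pos 4 ≡ pos 4 ℤ.* 1ℤ
      lem₂ = solve-∀

-- Lengths of lists without repetition, and maxima

unique-⊆⇒length≤ : ∀ {A : Set} {xs ys : List A} → Unique xs → (∀ {x} → x ∈ xs → x ∈ ys) → length xs ℕ.≤ length ys
unique-⊆⇒length≤ {xs = []} _ _ = ℕ.z≤n
unique-⊆⇒length≤ {xs = x ∷ xs} (x∉xs ∷ u) sub with ∈-∃++ (sub (here refl))
... | as , bs , refl = ℕₚ.≤-trans (ℕ.s≤s (unique-⊆⇒length≤ u sub′)) (ℕₚ.≤-reflexive (sym len))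
  where
  sub′ : ∀ {y} → y ∈ xs → y ∈ as ++ bs
  sub′ y∈xs with ∈-++⁻ as (sub (there y∈xs))
  ... | inj₁ y∈as = ∈-++⁺ˡ y∈as
  ... | inj₂ (here refl) = contradiction refl (All.lookup x∉xs y∈xs)
  ... | inj₂ (there y∈bs) = ∈-++⁺ʳ as y∈bs
  len : length (as ++ x ∷ bs) ≡ suc (length (as ++ bs))
  len = trans (length-++ as) (trans (ℕₚ.+-suc (length as) (length bs)) (cong suc (sym (length-++ as))))

maximum-≤ : ∀ m (ns : List ℕ) → (∀ {n} → n ∈ ns → n ℕ.≤ m) → foldr ℕ._⊔_ 0 ns ℕ.≤ m
maximum-≤ m [] h = ℕ.z≤n
maximum-≤ m (n ∷ ns) h = ℕₚ.⊔-lub (h (here refl)) (maximum-≤ m ns (h ∘ there))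

∈⇒≤maximum : ∀ {n} {ns : List ℕ} → n ∈ ns → n ℕ.≤ foldr ℕ._⊔_ 0 ns
∈⇒≤maximum {ns = n ∷ ns} (here refl) = ℕₚ.m≤m⊔n n _
∈⇒≤maximum {ns = n ∷ ns} (there p) = ℕₚ.≤-trans (∈⇒≤maximum p) (ℕₚ.m≤n⊔m n _)

-- The upper bound 3, and a condition for three solutions

module Differential {q : ℕ} (F : FiniteField q) (q≡7 : q ℕ.% 8 ≡ 7) (3≢0 : Invertible F 3) where
  open FiniteField F
  open FieldAlgebra F
  open FieldSums F
  open QuadraticCharacter F
  open Mod8 F q≡7

  Non : Carrier → Set
  Non x = χ x ≡ -1ℤ

  non? : ∀ x → Dec (Non x)
  non? x = χ x ℤ.≟ -1ℤ

  ¬Non-0 : ¬ Non 0#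
  ¬Non-0 e = contradiction (trans (sym χ-0) e) λ ()

  ¬Non-square : ∀ y → ¬ Non (y * y)
  ¬Non-square y e = χ≡-1⇒nonsquare e (y , refl)

  -- 0 falls into the second branch, but both formulas give 0 there.
  G : Carrier → Carrier
  G x with non? x
  ... | yes _ = x * x
  ... | no _ = ♯ 2 * (x * x)

  G-non : ∀ {x} → Non x → G x ≡ x * x
  G-non {x} n with non? x
  ... | yes _ = refl
  ... | no ¬n = contradiction n ¬n

  G-sq : ∀ {x} → ¬ Non x → G x ≡ ♯ 2 * (x * x)
  G-sq {x} ¬n with non? x
  ... | yes n = contradiction n ¬n
  ... | no _ = refl

  2/3 : Carrier
  2/3 = ♯ 2 * 3# ⁻¹

  3#≢0 : 3# ≢0
  3#≢0 e = 3≢0 (trans (solve 0 (κ 3 := κ 1 :+ κ 1 :+ κ 1) refl) e)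

  3*3⁻¹ : ♯ 3 * 3# ⁻¹ ≡ 1#
  3*3⁻¹ = trans (cong (λ z → z * 3# ⁻¹) (solve 0 (κ 3 := κ 1 :+ κ 1 :+ κ 1) refl)) (⁻¹-inverse 3# 3#≢0)

  2/3≢0 : 2/3 ≢0
  2/3≢0 = *-≢0 2≢0 (inv-≢0 3#≢0)

  F213≡2/3*G : ∀ x → F213 x ≡ 2/3 * G x
  F213≡2/3*G x = trans (cong (λ z → x * x * (1# + 3# ⁻¹ * z)) (η≡ι∘χ x)) (go (classify x))
    where
    i : Carrier
    i = 3# ⁻¹
    go : Class x → x * x * (1# + i * ι (χ x)) ≡ 2/3 * G x
    go (isZero refl e) = trans (trans (cong (λ z → z * (1# + i * ι (χ 0#))) (zeroˡ 0#)) (zeroˡ _))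
      (sym (trans (cong (λ z → 2/3 * z) (trans (G-sq ¬Non-0) (solve 0 (κ 2 :* (κ 0 :* κ 0) := κ 0) refl))) (zeroʳ _)))
    go (isSq _ _ _ _ e) = trans (cong (λ z → x * x * (1# + i * ι z)) e) (trans
      (via (- (x * x)) _ (♯ 2 * i * (♯ 2 * (x * x))) 3*3⁻¹ (solve 2 (λ x i → x :* x :* (κ 1 :+ i :* κ 1) :- κ 2 :* i :* (κ 2 :* (x :* x)) := :- (x :* x) :* (κ 3 :* i :- κ 1)) refl x i))
      (cong (λ z → 2/3 * z) (sym (G-sq λ n → contradiction (trans (sym n) e) λ ()))))
    go (isNon _ _ e) = trans (cong (λ z → x * x * (1# + i * ι z)) e) (trans
      (via (- (x * x)) _ (♯ 2 * i * (x * x)) 3*3⁻¹ (solve 2 (λ x i → x :* x :* (κ 1 :+ i :* :- κ 1) :- κ 2 :* i :* (x :* x) := :- (x :* x) :* (κ 3 :* i :- κ 1)) refl x i))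
      (cong (λ z → 2/3 * z) (sym (G-non e))))

  Solution : Carrier → Carrier → Set
  Solution c x = G (x + 1#) - G x ≡ c

  χ-scale : ∀ a y → χ a ≡ 1ℤ → χ (a * y) ≡ χ y
  χ-scale a y e = trans (χ-* a y) (trans (cong (λ z → z ℤ.* χ y) e) (ℤₚ.*-identityˡ _))

  G-scale : ∀ a y → χ a ≡ 1ℤ → G (a * y) ≡ a * a * G y
  G-scale a y e with non? y
  ... | yes n = trans (G-non (trans (χ-scale a y e) n)) (solve 2 (λ a y → a :* y :* (a :* y) := a :* a :* (y :* y)) refl a y)
  ... | no ¬n = trans (G-sq (λ n → ¬n (trans (sym (χ-scale a y e)) n))) (solve 2 (λ a y → κ 2 :* (a :* y :* (a :* y)) := a :* a :* (κ 2 :* (y :* y))) refl a y)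

  /-unique : ∀ u x y → u ≢0 → u * x ≡ y → x ≡ y * u ⁻¹
  /-unique u x y u≢0 refl = sym (trans (solve 3 (λ u x i → u :* x :* i := u :* i :* x) refl u x (u ⁻¹)) (trans (cong (λ z → z * x) (⁻¹-inverse u u≢0)) (*-identityˡ x)))

  4≢0 : ♯ 4 ≢0
  4≢0 e = *-≢0 2≢0 2≢0 (trans (solve 0 (κ 2 :* κ 2 := κ 4) refl) e)

  χ-4* : ∀ x → χ (♯ 4 * x) ≡ χ x
  χ-4* x = trans (cong (λ z → χ (z * x)) (solve 0 (κ 4 := κ 2 :* κ 2) refl)) (χ-square-* (♯ 2) x 2≢0)

  -- The four branches of `G` at the pair x, x + 1: (square, square), (non, non), (non, square),
  -- (square, non), where 0 counts as a square. A and B are linear in x, C and D quadratic.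
  data Kind (c x : Carrier) : Set where
    kA : ¬ Non x → ¬ Non (x + 1#) → ♯ 4 * x ≡ c - ♯ 2 → Kind c x
    kB : ♯ 2 * x ≡ c - 1# → Kind c x
    kC : Non x → (x + ♯ 2) * (x + ♯ 2) ≡ c + ♯ 2 → Kind c x
    kD : Non (x + 1#) → (x - 1#) * (x - 1#) ≡ ♯ 2 - c → Kind c x

  kind : ∀ c x → Solution c x → Kind c x
  kind c x sol = go (non? x) (non? (x + 1#))
    where
    go : Dec (Non x) → Dec (Non (x + 1#)) → Kind c x
    go (no n) (no n′) = kA n n′ (via 1# _ _ (trans (sym (cong₂ _-_ (G-sq n′) (G-sq n))) sol)
      (solve 2 (λ x c → κ 4 :* x :- (c :- κ 2) := κ 1 :* ((κ 2 :* ((x :+ κ 1) :* (x :+ κ 1)) :- κ 2 :* (x :* x)) :- c)) refl x c))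
    go (yes n) (yes n′) = kB (via 1# _ _ (trans (sym (cong₂ _-_ (G-non n′) (G-non n))) sol)
      (solve 2 (λ x c → κ 2 :* x :- (c :- κ 1) := κ 1 :* (((x :+ κ 1) :* (x :+ κ 1) :- x :* x) :- c)) refl x c))
    go (yes n) (no n′) = kC n (via 1# _ _ (trans (sym (cong₂ _-_ (G-sq n′) (G-non n))) sol)
      (solve 2 (λ x c → (x :+ κ 2) :* (x :+ κ 2) :- (c :+ κ 2) := κ 1 :* ((κ 2 :* ((x :+ κ 1) :* (x :+ κ 1)) :- x :* x) :- c)) refl x c))
    go (no n) (yes n′) = kD n′ (via (- 1#) _ _ (trans (sym (cong₂ _-_ (G-non n′) (G-sq n))) sol)
      (solve 2 (λ x c → (x :- κ 1) :* (x :- κ 1) :- (κ 2 :- c) := :- κ 1 :* (((x :+ κ 1) :* (x :+ κ 1) :- κ 2 :* (x :* x)) :- c)) refl x c))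

  Covered : Carrier → List Carrier → Set
  Covered c es = ∀ x → Solution c x → x ∈ es

  C-roots : ∀ {c x} s → s * s ≡ c + ♯ 2 → (x + ♯ 2) * (x + ♯ 2) ≡ c + ♯ 2 → x ≡ - ♯ 2 + s ⊎ x ≡ - ♯ 2 + - s
  C-roots {c} {x} s ss e with square-roots (x + ♯ 2) s (trans e (sym ss))
  ... | inj₁ p = inj₁ (via 1# _ _ p (solve 2 (λ x s → x :- (:- κ 2 :+ s) := κ 1 :* (x :+ κ 2 :- s)) refl x s))
  ... | inj₂ p = inj₂ (via 1# _ _ p (solve 2 (λ x s → x :- (:- κ 2 :+ :- s) := κ 1 :* (x :+ κ 2 :- :- s)) refl x s))

  D-roots : ∀ {c x} t → t * t ≡ ♯ 2 - c → (x - 1#) * (x - 1#) ≡ ♯ 2 - c → x ≡ 1# + t ⊎ x ≡ 1# + - t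
  D-roots {c} {x} t tt e with square-roots (x - 1#) t (trans e (sym tt))
  ... | inj₁ p = inj₁ (via 1# _ _ p (solve 2 (λ x t → x :- (κ 1 :+ t) := κ 1 :* (x :- κ 1 :- t)) refl x t))
  ... | inj₂ p = inj₂ (via 1# _ _ p (solve 2 (λ x t → x :- (κ 1 :+ :- t) := κ 1 :* (x :- κ 1 :- :- t)) refl x t))

  -- If 2 - s = u² and v = t/u then v² = 2 + s, so 2 (2 + t) = (u + v)².
  C-excludes-D : ∀ c s t → s * s ≡ c + ♯ 2 → t * t ≡ ♯ 2 - c → Non (- ♯ 2 + s) → ¬ Non (1# + t + 1#)
  C-excludes-D c s t ss tt nC nD with χ≡1⇒square {♯ 2 - s} (trans (cong χ (solve 1 (λ s → κ 2 :- s := :- (:- κ 2 :+ s)) refl s)) (trans (χ-neg _) (cong ℤ.-_ nC)))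
  ... | u , u≢0 , uu = contradiction (trans (sym χ[u+v]²) (trans (χ-* (♯ 2) (♯ 2 + t)) (cong₂ ℤ._*_ χ-2 nD′))) (¬Non-square (u + v))
    where
    v : Carrier
    v = t * u ⁻¹
    uv≡t : u * v ≡ t
    uv≡t = trans (solve 3 (λ u t i → u :* (t :* i) := t :* (u :* i)) refl u t (u ⁻¹)) (trans (cong (λ z → t * z) (⁻¹-inverse u u≢0)) (*-identityʳ t))
    vv : v * v ≡ ♯ 2 + s
    vv = *-cancelˡ (u * u) _ _ (*-≢0 u≢0 u≢0) (begin
      u * u * (v * v)   ≡⟨ solve 2 (λ u v → u :* u :* (v :* v) := u :* v :* (u :* v)) refl u v ⟩
      u * v * (u * v)   ≡⟨ cong (λ z → z * z) uv≡t ⟩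
      t * t   ≡⟨ tt ⟩
      ♯ 2 - c   ≡⟨ via 1# _ _ ss (solve 2 (λ c s → κ 2 :- c :- (κ 2 :- s) :* (κ 2 :+ s) := κ 1 :* (s :* s :- (c :+ κ 2))) refl c s) ⟩
      (♯ 2 - s) * (♯ 2 + s)   ≡⟨ cong (λ z → z * (♯ 2 + s)) (sym uu) ⟩
      u * u * (♯ 2 + s)   ∎)
      where open ≡-Reasoning
    nD′ : χ (♯ 2 + t) ≡ -1ℤ
    nD′ = trans (cong χ (solve 1 (λ t → κ 2 :+ t := κ 1 :+ t :+ κ 1) refl t)) nD
    χ[u+v]² : χ (♯ 2 * (♯ 2 + t)) ≡ χ ((u + v) * (u + v))
    χ[u+v]² = cong χ (begin
      ♯ 2 * (♯ 2 + t)   ≡⟨ solve 2 (λ s t → κ 2 :* (κ 2 :+ t) := (κ 2 :- s) :+ (κ 2 :+ s) :+ κ 2 :* t) refl s t ⟩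
      (♯ 2 - s) + (♯ 2 + s) + ♯ 2 * t   ≡⟨ cong₂ _+_ (cong₂ _+_ (sym uu) (sym vv)) (cong (λ z → ♯ 2 * z) (sym uv≡t)) ⟩
      u * u + v * v + ♯ 2 * (u * v)   ≡⟨ solve 2 (λ u v → u :* u :+ v :* v :+ κ 2 :* (u :* v) := (u :+ v) :* (u :+ v)) refl u v ⟩
      (u + v) * (u + v)   ∎)
      where open ≡-Reasoning

  neg-square : ∀ {s z} → s * s ≡ z → - s * - s ≡ z
  neg-square {s} e = trans (solve 1 (λ s → :- s :* :- s := s :* s) refl s) e

  -- A and B have one root each, so C and D have to be limited. If 2 - c is a non-square, D has no
  -- solution and C at most one. If 2 - c = t² ≠ 0, A has no solution, and C and D exclude each
  -- other. The case c = 2 is explicit.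
  covered : ∀ c → ∃ λ es → length es ≡ 3 × Covered c es
  covered c = go (isSquare? (♯ 2 - c)) (isSquare? (c + ♯ 2))
    where
    eA eB : Carrier
    eA = (c - ♯ 2) * (♯ 4) ⁻¹
    eB = (c - 1#) * (♯ 2) ⁻¹
    inA : ∀ {x} → ♯ 4 * x ≡ c - ♯ 2 → x ≡ eA
    inA {x} e = /-unique (♯ 4) x _ 4≢0 e
    inB : ∀ {x} → ♯ 2 * x ≡ c - 1# → x ≡ eB
    inB {x} e = /-unique (♯ 2) x _ 2≢0 e
    3-covered : ∀ e₁ e₂ e₃ → (∀ x → Kind c x → x ∈ e₁ ∷ e₂ ∷ e₃ ∷ []) → ∃ λ es → length es ≡ 3 × Covered c es
    3-covered e₁ e₂ e₃ h = _ , refl , λ x sol → h x (kind c x sol)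
    go : Dec (IsSquare (♯ 2 - c)) → Dec (IsSquare (c + ♯ 2)) → ∃ λ es → length es ≡ 3 × Covered c es
    -- A covering list may repeat entries; the second `eB` only brings its length to three.
    go (no ¬D) (no ¬C) = 3-covered eA eB eB λ where
      x (kA _ _ e) → here (inA e)
      x (kB e) → there (here (inB e))
      x (kC _ e) → contradiction (_ , e) ¬C
      x (kD _ e) → contradiction (_ , e) ¬D
    go (no ¬D) (yes (s , ss)) = case (non? (- ♯ 2 + s))
      where
      -- The product of the two roots -2 ± s of C is 4 - s² = 2 - c, here a non-square.
      both : Non (- ♯ 2 + s) → ¬ Non (- ♯ 2 + - s)
      both n n′ = contradiction (χ≡1⇒square {♯ 2 - c} (trans (cong χ (via 1# _ _ ss
        (solve 2 (λ c s → κ 2 :- c :- (:- κ 2 :+ s) :* (:- κ 2 :+ :- s) := κ 1 :* (s :* s :- (c :+ κ 2))) refl c s)))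
        (trans (χ-* _ _) (cong₂ ℤ._*_ n n′)))) λ { (y , _ , e) → ¬D (y , e) }
      case : Dec (Non (- ♯ 2 + s)) → ∃ λ es → length es ≡ 3 × Covered c es
      case (yes n) = 3-covered eA eB (- ♯ 2 + s) λ where
        x (kA _ _ e) → here (inA e)
        x (kB e) → there (here (inB e))
        x (kC n′ e) → there (there ([ here , (λ { refl → contradiction n′ (both n) }) ]′ (C-roots s ss e)))
        x (kD _ e) → contradiction (_ , e) ¬D
      case (no ¬n) = 3-covered eA eB (- ♯ 2 + - s) λ where
        x (kA _ _ e) → here (inA e)
        x (kB e) → there (here (inB e))
        x (kC n′ e) → there (there ([ (λ { refl → contradiction n′ ¬n }) , here ]′ (C-roots s ss e)))
        x (kD _ e) → contradiction (_ , e) ¬D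
    go (yes (t , tt)) dC with t ≟ 0#
    -- Here c = 2. The roots of C are 0 and -4, and 0 is not a non-square; the double root 1 of D
    -- fails because 1 + 1 = 2 is a square.
    ... | yes refl = 3-covered eA eB (- ♯ 4) λ where
        x (kA _ _ e) → here (inA e)
        x (kB e) → there (here (inB e))
        x (kC n e) → there (there ([ (λ { refl → contradiction (subst Non (solve 0 (:- κ 2 :+ κ 2 := κ 0) refl) n) ¬Non-0 }) , (λ { refl → here (solve 0 (:- κ 2 :+ :- κ 2 := :- κ 4) refl) }) ]′ (C-roots (♯ 2) 2²≡c+2 e)))
        x (kD n e) → contradiction (trans (sym χ-2) (subst (λ z → χ z ≡ -1ℤ) ([ (λ { refl → solve 0 (κ 1 :+ κ 0 :+ κ 1 := κ 2) refl }) , (λ { refl → solve 0 (κ 1 :+ :- κ 0 :+ κ 1 := κ 2) refl }) ]′ (D-roots 0# tt e)) n)) λ ()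
      where
      2²≡c+2 : ♯ 2 * ♯ 2 ≡ c + ♯ 2
      2²≡c+2 = via 1# _ _ (sym tt) (solve 1 (λ c → κ 2 :* κ 2 :- (c :+ κ 2) := κ 1 :* ((κ 2 :- c) :- κ 0 :* κ 0)) refl c)
    ... | no t≢0 = case dC
      where
      -- 4x = c - 2 = -t² makes x a non-square.
      ¬A : ∀ {x} → ¬ Non x → ♯ 4 * x ≢ c - ♯ 2
      ¬A {x} ¬n e = ¬n (trans (sym (χ-4* x)) (trans (cong χ (trans e (via 1# _ _ tt (solve 2 (λ c t → c :- κ 2 :- (:- (t :* t)) := κ 1 :* (t :* t :- (κ 2 :- c))) refl c t)))) (trans (χ-neg (t * t)) (cong ℤ.-_ (χ-square t t≢0)))))
      onlyD : (∀ {x} → Non x → (x + ♯ 2) * (x + ♯ 2) ≢ c + ♯ 2) → ∃ λ es → length es ≡ 3 × Covered c es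
      onlyD ¬C = 3-covered eB (1# + t) (1# + - t) λ where
        x (kA n _ e) → contradiction e (¬A n)
        x (kB e) → here (inB e)
        x (kC n e) → contradiction e (¬C n)
        x (kD _ e) → there ([ here , there ∘ here ]′ (D-roots t tt e))
      -- σ is the one of ±s for which the root -2 + σ of C is admissible; it rules out both roots 1
      -- ± t of D.
      onlyC : ∀ s σ → s * s ≡ c + ♯ 2 → σ * σ ≡ c + ♯ 2 → Non (- ♯ 2 + σ) → ∃ λ es → length es ≡ 3 × Covered c es
      onlyC s σ ss σσ n = 3-covered eB (- ♯ 2 + s) (- ♯ 2 + - s) λ where
        x (kA n _ e) → contradiction e (¬A n)
        x (kB e) → here (inB e)
        x (kC _ e) → there ([ here , there ∘ here ]′ (C-roots s ss e))
        x (kD n′ e) → [ (λ { refl → contradiction n′ (C-excludes-D c σ t σσ tt n) }) , (λ { refl → contradiction n′ (C-excludes-D c σ (- t) σσ (neg-square tt) n) }) ]′ (D-roots t tt e)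
      case : Dec (IsSquare (c + ♯ 2)) → ∃ λ es → length es ≡ 3 × Covered c es
      case (no ¬C) = onlyD λ _ e → ¬C (_ , e)
      case (yes (s , ss)) = case₂ (non? (- ♯ 2 + s)) (non? (- ♯ 2 + - s))
        where
        case₂ : Dec (Non (- ♯ 2 + s)) → Dec (Non (- ♯ 2 + - s)) → ∃ λ es → length es ≡ 3 × Covered c es
        case₂ (yes n) _ = onlyC s s ss ss n
        case₂ (no _) (yes n) = onlyC s (- s) ss (neg-square ss) n
        case₂ (no n) (no n′) = onlyD λ { m e → [ (λ { refl → n m }) , (λ { refl → n′ m }) ]′ (C-roots s ss e) }

  elements-complete : ∀ x → x ∈ elements
  elements-complete x = subst (_∈ elements) (elem-index x) (∈-map⁺ elem (∈-allFin (index x)))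

  elements-unique : Unique elements
  elements-unique = Uniqueₚ.map⁺ (λ {i} {j} e → trans (sym (index-elem i)) (trans (cong index e) (index-elem j))) (Uniqueₚ.allFin⁺ q)

  Equation : Carrier → Carrier → Carrier → Set
  Equation a b x = F213 (x + a) - F213 x ≡ b

  G-equation : ∀ {a b x} → Equation a b x → G (x + a) - G x ≡ b * 2/3 ⁻¹
  G-equation {a} {b} {x} e = /-unique 2/3 _ b 2/3≢0 (trans
    (solve 3 (λ k x y → k :* (x :- y) := k :* x :- k :* y) refl 2/3 (G (x + a)) (G x))
    (trans (sym (cong₂ _-_ (F213≡2/3*G (x + a)) (F213≡2/3*G x))) e))

  module _ (a : Carrier) (a≢0 : a ≢0) where
    private
      a⁻¹ : Carrier
      a⁻¹ = a ⁻¹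

      a*[a⁻¹*x] : ∀ x → a * (a⁻¹ * x) ≡ x
      a*[a⁻¹*x] x = trans (solve 3 (λ a i x → a :* (i :* x) := a :* i :* x) refl a a⁻¹ x) (trans (cong (λ z → z * x) (⁻¹-inverse a a≢0)) (*-identityˡ x))

    normalise : ∀ c x → χ a ≡ 1ℤ → G (x + a) - G x ≡ c → Solution (c * (a * a) ⁻¹) (a⁻¹ * x)
    normalise c x χa e = /-unique (a * a) _ c (*-≢0 a≢0 a≢0) (begin
      a * a * (G (y + 1#) - G y)   ≡⟨ solve 3 (λ k x y → k :* (x :- y) := k :* x :- k :* y) refl (a * a) (G (y + 1#)) (G y) ⟩
      a * a * G (y + 1#) - a * a * G y        ≡⟨ sym (cong₂ _-_ (G-scale a (y + 1#) χa) (G-scale a y χa)) ⟩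
      G (a * (y + 1#)) - G (a * y)   ≡⟨ cong₂ (λ u v → G u - G v) (trans (solve 2 (λ a y → a :* (y :+ κ 1) := a :* y :+ a) refl a y) (cong (λ z → z + a) (a*[a⁻¹*x] x))) (a*[a⁻¹*x] x) ⟩
      G (x + a) - G x   ≡⟨ e ⟩
      c   ∎)
      where
      open ≡-Reasoning
      y : Carrier
      y = a⁻¹ * x

    equation-bound-square : ∀ c → χ a ≡ 1ℤ → ∃ λ es → length es ≡ 3 × (∀ x → G (x + a) - G x ≡ c → x ∈ es)
    equation-bound-square c χa with covered (c * (a * a) ⁻¹)
    ... | es , len , cov = map (λ y → a * y) es , trans (length-map (λ y → a * y) es) len , λ x e → subst (_∈ map (λ y → a * y) es) (a*[a⁻¹*x] x) (∈-map⁺ (λ y → a * y) (cov (a⁻¹ * x) (normalise c x χa e)))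

  -- For a non-square a the substitution x ↦ x + a replaces (a, c) by (-a, -c).
  equation-bound : ∀ a → a ≢0 → ∀ c → ∃ λ es → length es ≡ 3 × (∀ x → G (x + a) - G x ≡ c → x ∈ es)
  equation-bound a a≢0 c with classify a
  ... | isZero e _ = contradiction e a≢0
  ... | isSq _ _ _ _ χa = equation-bound-square a a≢0 c χa
  ... | isNon _ _ χa with equation-bound-square (- a) (neg-≢0 a≢0) (- c) (trans (χ-neg a) (cong ℤ.-_ χa))
  ...   | es , len , cov = map (λ y → y - a) es , trans (length-map (λ y → y - a) es) len , λ x e → subst (_∈ map (λ y → y - a) es) (cancel x) (∈-map⁺ (λ y → y - a) (cov (x + a) (trans (cong (λ z → G z - G (x + a)) (cancel x)) (trans (solve 2 (λ u v → u :- v := :- (v :- u)) refl (G x) (G (x + a))) (cong -_ e)))))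
    where
    cancel : ∀ x → x + a - a ≡ x
    cancel x = solve 2 (λ x a → x :+ a :- a := x) refl x a

  δ≤3 : ∀ a → a ≢0 → ∀ b → δ F213 a b ℕ.≤ 3
  δ≤3 a a≢0 b with equation-bound a a≢0 (b * 2/3 ⁻¹)
  ... | es , len , cov = subst (δ F213 a b ℕ.≤_) len (unique-⊆⇒length≤ (Uniqueₚ.filter⁺ (λ x → (F213 (x + a) - F213 x) ≟ b) elements-unique)
    λ {x} x∈ → cov x (G-equation {a} {b} {x} (proj₂ (∈-filter⁻ (λ x → (F213 (x + a) - F213 x) ≟ b) {xs = elements} x∈))))

  -- For c = x² + 4x + 2 the first two signs make x a solution of kind C. Since 2b = x² + 4x + 1 and
  -- 2(b + 1) = (x + 1)(x + 3) for b = (c - 1)/2, the other two make b a solution of kind B.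
  Good : Carrier → Set
  Good x = Non x × χ (x + 1#) ≡ 1ℤ × Non (x + ♯ 3) × Non (x * x + ♯ 4 * x + 1#)

  good? : ∀ x → Dec (Good x)
  good? x = non? x ×-dec (χ (x + 1#) ℤ.≟ 1ℤ) ×-dec non? (x + ♯ 3) ×-dec non? (x * x + ♯ 4 * x + 1#)

  ¬Non-1 : ∀ {x} → χ x ≡ 1ℤ → ¬ Non x
  ¬Non-1 e n = contradiction (trans (sym e) n) λ ()

  solution-A : ∀ c x → ¬ Non x → ¬ Non (x + 1#) → ♯ 4 * x ≡ c - ♯ 2 → Solution c x
  solution-A c x n n′ e = trans (cong₂ _-_ (G-sq n′) (G-sq n)) (via 1# _ _ e
    (solve 2 (λ x c → (κ 2 :* ((x :+ κ 1) :* (x :+ κ 1)) :- κ 2 :* (x :* x)) :- c := κ 1 :* (κ 4 :* x :- (c :- κ 2))) refl x c))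

  solution-B : ∀ c x → Non x → Non (x + 1#) → ♯ 2 * x ≡ c - 1# → Solution c x
  solution-B c x n n′ e = trans (cong₂ _-_ (G-non n′) (G-non n)) (via 1# _ _ e
    (solve 2 (λ x c → ((x :+ κ 1) :* (x :+ κ 1) :- x :* x) :- c := κ 1 :* (κ 2 :* x :- (c :- κ 1))) refl x c))

  solution-C : ∀ c x → Non x → ¬ Non (x + 1#) → (x + ♯ 2) * (x + ♯ 2) ≡ c + ♯ 2 → Solution c x
  solution-C c x n n′ e = trans (cong₂ _-_ (G-sq n′) (G-non n)) (via 1# _ _ e
    (solve 2 (λ x c → (κ 2 :* ((x :+ κ 1) :* (x :+ κ 1)) :- x :* x) :- c := κ 1 :* ((x :+ κ 2) :* (x :+ κ 2) :- (c :+ κ 2))) refl x c))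

  -- The third solution depends on χ(x + 4). If it is 1, the second root -(x + 4) of C is
  -- admissible; if it is -1, then x(x + 4)/4 is a solution of kind A.
  good⇒three-solutions : ∀ x → Good x → ∃ λ c → ∃ λ es → length es ≡ 3 × Unique es × (∀ {y} → y ∈ es → Solution c y)
  good⇒three-solutions x (χx , χx+1 , χx+3 , χf) = go (classify (x + ♯ 4))
    where
    c : Carrier
    c = x * x + ♯ 4 * x + ♯ 2
    solC : Solution c x
    solC = solution-C c x χx (¬Non-1 χx+1) (solve 1 (λ x → (x :+ κ 2) :* (x :+ κ 2) := x :* x :+ κ 4 :* x :+ κ 2 :+ κ 2) refl x)
    b : Carrier
    b = (c - 1#) * (♯ 2) ⁻¹
    2b : ♯ 2 * b ≡ c - 1#
    2b = trans (solve 3 (λ u v i → u :* (v :* i) := v :* (u :* i)) refl (♯ 2) (c - 1#) ((♯ 2) ⁻¹)) (trans (cong (λ z → (c - 1#) * z) (⁻¹-inverse (♯ 2) 2≢0)) (*-identityʳ _))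
    χb : Non b
    χb = trans (sym (χ-scale (♯ 2) b χ-2)) (trans (cong χ (trans 2b (solve 1 (λ x → x :* x :+ κ 4 :* x :+ κ 2 :- κ 1 := x :* x :+ κ 4 :* x :+ κ 1) refl x))) χf)
    χb+1 : Non (b + 1#)
    χb+1 = trans (sym (χ-scale (♯ 2) (b + 1#) χ-2)) (trans (cong χ (via 1# _ ((x + 1#) * (x + ♯ 3)) 2b
      (solve 2 (λ x b → κ 2 :* (b :+ κ 1) :- (x :+ κ 1) :* (x :+ κ 3) := κ 1 :* (κ 2 :* b :- (x :* x :+ κ 4 :* x :+ κ 2 :- κ 1))) refl x b)))
      (trans (χ-* _ _) (cong₂ ℤ._*_ χx+1 χx+3)))
    solB : Solution c b
    solB = solution-B c b χb χb+1 2b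
    x≢b : x ≢ b
    x≢b e = contradiction (trans (sym χx+1) (trans (cong (λ z → χ (z + 1#)) e) χb+1)) λ ()
    three : ∀ d → Solution c d → x ≢ d → b ≢ d → ∃ λ c → ∃ λ es → length es ≡ 3 × Unique es × (∀ {y} → y ∈ es → Solution c y)
    three d solD x≢d b≢d = c , x ∷ b ∷ d ∷ [] , refl , ((x≢b ∷ x≢d ∷ []) ∷ (b≢d ∷ []) ∷ [] ∷ []) , λ where
      (here refl) → solC
      (there (here refl)) → solB
      (there (there (here refl))) → solD
    go : Class (x + ♯ 4) → ∃ λ c → ∃ λ es → length es ≡ 3 × Unique es × (∀ {y} → y ∈ es → Solution c y)
    -- x = -4 would give x² + 4x + 1 = 1, which is a square.
    go (isZero e _) = contradiction (trans (sym χ-1) (trans (cong χ (via (- x) 1# (x * x + ♯ 4 * x + 1#) e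
      (solve 1 (λ x → κ 1 :- (x :* x :+ κ 4 :* x :+ κ 1) := :- x :* (x :+ κ 4 :- κ 0)) refl x))) χf)) λ ()
    go (isSq _ _ _ _ e) = three d
        (solution-C c d χd (¬Non-1 χd+1) (solve 1 (λ x → (:- (x :+ κ 4) :+ κ 2) :* (:- (x :+ κ 4) :+ κ 2) := x :* x :+ κ 4 :* x :+ κ 2 :+ κ 2) refl x))
        x≢d (λ b≡d → contradiction (trans (sym χd+1) (trans (cong (λ z → χ (z + 1#)) (sym b≡d)) χb+1)) λ ())
      where
      d : Carrier
      d = - (x + ♯ 4)
      χd : Non d
      χd = trans (χ-neg _) (cong ℤ.-_ e)
      χd+1 : χ (d + 1#) ≡ 1ℤ
      χd+1 = trans (cong χ (solve 1 (λ x → :- (x :+ κ 4) :+ κ 1 := :- (x :+ κ 3)) refl x)) (trans (χ-neg _) (cong ℤ.-_ χx+3))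
      x≢d : x ≢ d
      x≢d x≡d = contradiction (trans (sym χx+1) (trans (cong χ (*-cancelˡ (♯ 2) (x + 1#) (- 1#) 2≢0
        (via 1# _ _ x≡d (solve 1 (λ x → κ 2 :* (x :+ κ 1) :- κ 2 :* :- κ 1 := κ 1 :* (x :- :- (x :+ κ 4))) refl x)))) χ-neg1)) λ ()
    go (isNon _ _ e) = three d (solution-A c d (¬Non-1 χd) ¬χd+1 4d)
        (λ x≡d → contradiction (trans (sym χd) (trans (cong χ (sym x≡d)) χx)) λ ())
        (λ b≡d → contradiction (trans (sym χd) (trans (cong χ (sym b≡d)) χb)) λ ())
      where
      d : Carrier
      d = (c - ♯ 2) * (♯ 4) ⁻¹
      4d : ♯ 4 * d ≡ c - ♯ 2
      4d = trans (solve 3 (λ u v i → u :* (v :* i) := v :* (u :* i)) refl (♯ 4) (c - ♯ 2) ((♯ 4) ⁻¹)) (trans (cong (λ z → (c - ♯ 2) * z) (⁻¹-inverse (♯ 4) 4≢0)) (*-identityʳ _))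
      χd : χ d ≡ 1ℤ
      χd = trans (sym (χ-4* d)) (trans (cong χ (trans 4d (solve 1 (λ x → x :* x :+ κ 4 :* x :+ κ 2 :- κ 2 := x :* (x :+ κ 4)) refl x))) (trans (χ-* _ _) (cong₂ ℤ._*_ χx e)))
      -- 4(d + 1) = (x + 2)².
      ¬χd+1 : ¬ Non (d + 1#)
      ¬χd+1 n = ¬Non-square (x + ♯ 2) (trans (cong χ (sym (via 1# _ _ 4d
        (solve 2 (λ x d → κ 4 :* (d :+ κ 1) :- (x :+ κ 2) :* (x :+ κ 2) := κ 1 :* (κ 4 :* d :- (x :* x :+ κ 4 :* x :+ κ 2 :- κ 2))) refl x d)))) (trans (χ-4* (d + 1#)) n))

  good⇒3≤δ : ∀ x → Good x → ∃ λ b → 3 ℕ.≤ δ F213 1# b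
  good⇒3≤δ x good with good⇒three-solutions x good
  ... | c , es , len , u , sol = 2/3 * c , subst (ℕ._≤ δ F213 1# (2/3 * c)) len (unique-⊆⇒length≤ u λ {y} y∈ →
    ∈-filter⁺ (λ x → (F213 (x + 1#) - F213 x) ≟ (2/3 * c)) (elements-complete y) (trans (cong₂ _-_ (F213≡2/3*G (y + 1#)) (F213≡2/3*G y))
      (trans (solve 3 (λ k x y → k :* x :- k :* y := k :* (x :- y)) refl 2/3 (G (y + 1#)) (G y)) (cong (λ z → 2/3 * z) (sol y∈)))))

  good⇒diffUniformity≡3 : ∀ x → Good x → diffUniformity F213 ≡ 3
  good⇒diffUniformity≡3 x good = ℕₚ.≤-antisym (maximum-≤ 3 _ upper) lower
    where
    upper : ∀ {n} → n ∈ concatMap (λ a → map (λ b → δ F213 a b) elements) nonzeroElements → n ℕ.≤ 3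
    upper n∈ = bound (find (∈-concatMap⁻ (λ a → map (λ b → δ F213 a b) elements) {xs = nonzeroElements} n∈))
      where
      bound : ∀ {n} → (∃ λ a → a ∈ nonzeroElements × n ∈ map (λ b → δ F213 a b) elements) → n ℕ.≤ 3
      bound (a , a∈ , n∈) with ∈-map⁻ (λ b → δ F213 a b) n∈
      ... | b , _ , refl = δ≤3 a (proj₂ (∈-filter⁻ (λ a → ¬? (a ≟ 0#)) {xs = elements} a∈)) b
    lower : 3 ℕ.≤ diffUniformity F213
    lower with good⇒3≤δ x good
    ... | b , 3≤δ = ℕₚ.≤-trans 3≤δ (∈⇒≤maximum (∈-concatMap⁺ (λ a → map (λ b → δ F213 a b) elements)
      (lose (∈-filter⁺ (λ a → ¬? (a ≟ 0#)) (elements-complete 1#) 1≢0) (∈-map⁺ (λ b → δ F213 1# b) (elements-complete b)))))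

-- Parseval's identity and the elliptic sums h(D, λ)

sumℤ : List ℤ → ℤ
sumℤ = foldr ℤ._+_ 0ℤ

0≤i*i : ∀ i → 0ℤ ℤ.≤ i ℤ.* i
0≤i*i (pos n) = ℤₚ.≤-trans (ℤ.+≤+ ℕ.z≤n) (ℤₚ.≤-reflexive (ℤₚ.pos-* n n))
0≤i*i -[1+ n ] = ℤ.+≤+ ℕ.z≤n

module EllipticSums {q : ℕ} (F : FiniteField q) (q≡7 : q ℕ.% 8 ≡ 7) where
  open FiniteField F
  open FieldAlgebra F
  open FieldSums F
  open QuadraticCharacter F
  open Mod8 F q≡7

  ∑-list : ∀ (fs : List (Carrier → ℤ)) → ∑ (λ x → sumℤ (map (λ f → f x) fs)) ≡ sumℤ (map ∑ fs)
  ∑-list [] = ∑-zero λ _ → refl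
  ∑-list (f ∷ fs) = trans (∑-+ f _) (cong (λ z → ∑ f ℤ.+ z) (∑-list fs))

  -- Each l contributes at l and at -l, which differ because l ≠ 0 and 2 ≠ 0; different squares keep
  -- these pairs disjoint. The induction replaces f by 0 on the pair ±l.
  twice-∑-list≤∑ : ∀ (f : Carrier → ℤ) → (∀ x → 0ℤ ℤ.≤ f x) → (∀ x → f (- x) ≡ f x) → ∀ ls → All (_≢ 0#) ls → AllPairs (λ x y → x * x ≢ y * y) ls →
    pos 2 ℤ.* sumℤ (map f ls) ℤ.≤ ∑ f
  twice-∑-list≤∑ f f≥0 even [] _ _ = subst (ℤ._≤ ∑ f) (trans (∑-const 0ℤ) (ℤₚ.*-zeroʳ (pos q))) (∑-mono-≤ f≥0)
  twice-∑-list≤∑ f f≥0 even (l ∷ ls) (l≢0 ∷ ls≢0) (l∉ ∷ distinct) = begin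
    pos 2 ℤ.* (f l ℤ.+ sumℤ (map f ls))   ≡⟨ lem (f l) (sumℤ (map f ls)) ⟩
    pos 2 ℤ.* sumℤ (map f ls) ℤ.+ (f l ℤ.+ f l)   ≡⟨ cong₂ (λ y z → pos 2 ℤ.* y ℤ.+ z) (agree ls l∉) (cong₂ ℤ._+_ (sym (at l)) (sym (trans (at (- l)) (even l)))) ⟩
    pos 2 ℤ.* sumℤ (map f′ ls) ℤ.+ (∑ (g l) ℤ.+ ∑ (g (- l)))       ≤⟨ ℤₚ.+-monoˡ-≤ _ (twice-∑-list≤∑ f′ f′≥0 f′-even ls ls≢0 distinct) ⟩
    ∑ f′ ℤ.+ (∑ (g l) ℤ.+ ∑ (g (- l)))   ≡⟨ cong (λ z → ∑ f′ ℤ.+ z) (sym (∑-+ (g l) (g (- l)))) ⟩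
    ∑ f′ ℤ.+ ∑ (λ x → g l x ℤ.+ g (- l) x)   ≡⟨ sym (∑-+ f′ _) ⟩
    ∑ (λ x → f′ x ℤ.+ (g l x ℤ.+ g (- l) x))   ≡⟨ ∑-cong (λ x → sym (split x)) ⟩
    ∑ f   ∎
    where
    open ℤₚ.≤-Reasoning
    lem : ∀ a b → pos 2 ℤ.* (a ℤ.+ b) ≡ pos 2 ℤ.* b ℤ.+ (a ℤ.+ a)
    lem = solve-∀
    g : Carrier → Carrier → ℤ
    g a x = ind (x ≟ a) ℤ.* f x
    at : ∀ a → ∑ (g a) ≡ f a
    at a = trans (∑-only (g a) a λ x x≢a → trans (cong (λ z → z ℤ.* f x) (ind-no (x ≟ a) x≢a)) (ℤₚ.*-zeroˡ (f x))) (trans (cong (λ z → z ℤ.* f a) (ind-yes (a ≟ a) refl)) (ℤₚ.*-identityˡ (f a)))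
    f′ : Carrier → ℤ
    f′ x with (x * x) ≟ (l * l)
    ... | yes _ = 0ℤ
    ... | no _ = f x
    f′≥0 : ∀ x → 0ℤ ℤ.≤ f′ x
    f′≥0 x with (x * x) ≟ (l * l)
    ... | yes _ = ℤₚ.≤-refl
    ... | no _ = f≥0 x
    f′-even : ∀ x → f′ (- x) ≡ f′ x
    f′-even x with (- x * - x) ≟ (l * l) | (x * x) ≟ (l * l)
    ... | yes _ | yes _ = refl
    ... | no _ | no _ = even x
    ... | yes p | no n = contradiction (trans (solve 1 (λ x → x :* x := :- x :* :- x) refl x) p) n
    ... | no n | yes p = contradiction (trans (solve 1 (λ x → :- x :* :- x := x :* x) refl x) p) n
    f′≡f : ∀ x → l * l ≢ x * x → f x ≡ f′ x
    f′≡f x n with (x * x) ≟ (l * l)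
    ... | yes p = contradiction (sym p) n
    ... | no _ = refl
    agree : ∀ ms → All (λ m → l * l ≢ m * m) ms → sumℤ (map f ms) ≡ sumℤ (map f′ ms)
    agree [] [] = refl
    agree (m ∷ ms) (n ∷ ns) = cong₂ ℤ._+_ (f′≡f m n) (agree ms ns)
    split : ∀ x → f x ≡ f′ x ℤ.+ (g l x ℤ.+ g (- l) x)
    split x with (x * x) ≟ (l * l) | x ≟ l | x ≟ (- l)
    ... | yes _ | yes refl | yes p = contradiction (x≡-x⇒x≡0 x p) l≢0
    ... | yes _ | yes _ | no _ = lem₁ (f x)
      where
      lem₁ : ∀ a → a ≡ 0ℤ ℤ.+ (1ℤ ℤ.* a ℤ.+ 0ℤ ℤ.* a)
      lem₁ = solve-∀
    ... | yes _ | no _ | yes _ = lem₁ (f x)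
      where
      lem₁ : ∀ a → a ≡ 0ℤ ℤ.+ (0ℤ ℤ.* a ℤ.+ 1ℤ ℤ.* a)
      lem₁ = solve-∀
    ... | yes p | no n | no n′ = contradiction (square-roots x l p) λ { (inj₁ e) → n e ; (inj₂ e) → n′ e }
    ... | no n | yes refl | _ = contradiction refl n
    ... | no n | no _ | yes refl = contradiction (solve 1 (λ l → :- l :* :- l := l :* l) refl l) n
    ... | no _ | no _ | no _ = lem₁ (f x)
      where
      lem₁ : ∀ a → a ≡ a ℤ.+ (0ℤ ℤ.* a ℤ.+ 0ℤ ℤ.* a)
      lem₁ = solve-∀

  -- The matrix with entries χ(x - l) is nearly orthogonal: the product of the rows of x and y,
  -- summed over l, is q - 1 for x = y and -1 otherwise. The term -1 throughout produces the square
  -- of ∑ φ.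
  parseval : ∀ (φ : Carrier → ℤ) → ∑ (λ l → ∑ (λ x → χ (x - l) ℤ.* φ x) ℤ.* ∑ (λ x → χ (x - l) ℤ.* φ x)) ℤ.+ ∑ φ ℤ.* ∑ φ ≡ pos q ℤ.* ∑ (λ x → φ x ℤ.* φ x)
  parseval φ = begin
    ∑ (λ l → H l ℤ.* H l) ℤ.+ S ℤ.* S   ≡⟨ cong (λ z → z ℤ.+ S ℤ.* S) expand ⟩
    ∑ (λ x → φ x ℤ.* (pos q ℤ.* φ x ℤ.- S)) ℤ.+ S ℤ.* S   ≡⟨ cong (λ z → z ℤ.+ S ℤ.* S) (trans (∑-cong λ x → lem₁ (φ x) (pos q) S) (trans (∑-+ _ _) (cong₂ ℤ._+_ (∑-*ˡ (pos q) _) (∑-*ʳ (ℤ.- S) φ)))) ⟩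
    pos q ℤ.* ∑ (λ x → φ x ℤ.* φ x) ℤ.+ S ℤ.* ℤ.- S ℤ.+ S ℤ.* S   ≡⟨ lem₂ (pos q ℤ.* ∑ (λ x → φ x ℤ.* φ x)) S ⟩
    pos q ℤ.* ∑ (λ x → φ x ℤ.* φ x)   ∎
    where
    open ≡-Reasoning
    S : ℤ
    S = ∑ φ
    H : Carrier → ℤ
    H l = ∑ (λ x → χ (x - l) ℤ.* φ x)
    lem₁ : ∀ a k s → a ℤ.* (k ℤ.* a ℤ.- s) ≡ k ℤ.* (a ℤ.* a) ℤ.+ a ℤ.* ℤ.- s
    lem₁ = solve-∀
    lem₂ : ∀ a s → a ℤ.+ s ℤ.* ℤ.- s ℤ.+ s ℤ.* s ≡ a
    lem₂ = solve-∀
    lem₃ : ∀ a b c d → a ℤ.* b ℤ.* (c ℤ.* d) ≡ b ℤ.* (d ℤ.* (a ℤ.* c))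
    lem₃ = solve-∀
    flip : ∀ x y l → χ (x - l) ℤ.* χ (y - l) ≡ χ (l - x) ℤ.* χ (l - y)
    flip x y l = trans (sym (χ-* (x - l) (y - l))) (trans (cong χ (solve 3 (λ x y l → (x :- l) :* (y :- l) := (l :- x) :* (l :- y)) refl x y l)) (χ-* (l - x) (l - y)))
    corr : ∀ x y → ∑ (λ l → χ (x - l) ℤ.* χ (y - l)) ≡ pos q ℤ.* ind (y ≟ x) ℤ.- 1ℤ
    corr x y with y ≟ x
    ... | yes refl = trans (trans (∑-cong (flip x x)) (lem₄ (∑ (λ l → χ (l - x) ℤ.* χ (l - x))))) (cong (λ z → z ℤ.- 1ℤ) (trans (∑χ[x-a]² x) (sym (ℤₚ.*-identityʳ (pos q)))))
      where
      lem₄ : ∀ a → a ≡ a ℤ.+ 1ℤ ℤ.- 1ℤ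
      lem₄ = solve-∀
    ... | no y≢x = trans (∑-cong (flip x y)) (trans (∑χ[x-a][x-b] x y (y≢x ∘ sym)) (cong (λ z → z ℤ.- 1ℤ) (sym (ℤₚ.*-zeroʳ (pos q)))))
    inner : ∀ x → ∑ (λ y → φ y ℤ.* (pos q ℤ.* ind (y ≟ x) ℤ.- 1ℤ)) ≡ pos q ℤ.* φ x ℤ.- S
    inner x = begin
      ∑ (λ y → φ y ℤ.* (pos q ℤ.* ind (y ≟ x) ℤ.- 1ℤ))   ≡⟨ ∑-cong (λ y → lem₅ (φ y) (pos q) (ind (y ≟ x))) ⟩
      ∑ (λ y → pos q ℤ.* (ind (y ≟ x) ℤ.* φ y) ℤ.+ ℤ.- φ y)   ≡⟨ ∑-+ _ _ ⟩
      ∑ (λ y → pos q ℤ.* (ind (y ≟ x) ℤ.* φ y)) ℤ.+ ∑ (λ y → ℤ.- φ y)   ≡⟨ cong₂ ℤ._+_ (∑-*ˡ (pos q) _) (∑-neg φ) ⟩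
      pos q ℤ.* ∑ (λ y → ind (y ≟ x) ℤ.* φ y) ℤ.- S   ≡⟨ cong (λ z → pos q ℤ.* z ℤ.- S) (∑-only _ x λ y y≢x → trans (cong (λ z → z ℤ.* φ y) (ind-no (y ≟ x) y≢x)) (ℤₚ.*-zeroˡ (φ y))) ⟩
      pos q ℤ.* (ind (x ≟ x) ℤ.* φ x) ℤ.- S   ≡⟨ cong (λ z → pos q ℤ.* z ℤ.- S) (trans (cong (λ z → z ℤ.* φ x) (ind-yes (x ≟ x) refl)) (ℤₚ.*-identityˡ (φ x))) ⟩
      pos q ℤ.* φ x ℤ.- S   ∎
      where
      lem₅ : ∀ a k i → a ℤ.* (k ℤ.* i ℤ.- 1ℤ) ≡ k ℤ.* (i ℤ.* a) ℤ.+ ℤ.- a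
      lem₅ = solve-∀
    expand : ∑ (λ l → H l ℤ.* H l) ≡ ∑ (λ x → φ x ℤ.* (pos q ℤ.* φ x ℤ.- S))
    expand = begin
      ∑ (λ l → H l ℤ.* H l)   ≡⟨ ∑-cong (λ l → trans (sym (∑-*ʳ (H l) _)) (∑-cong λ x → sym (∑-*ˡ (χ (x - l) ℤ.* φ x) _))) ⟩
      ∑ (λ l → ∑ (λ x → ∑ (λ y → χ (x - l) ℤ.* φ x ℤ.* (χ (y - l) ℤ.* φ y))))   ≡⟨ ∑-swap _ ⟩
      ∑ (λ x → ∑ (λ l → ∑ (λ y → χ (x - l) ℤ.* φ x ℤ.* (χ (y - l) ℤ.* φ y))))   ≡⟨ ∑-cong (λ x → ∑-swap _) ⟩
      ∑ (λ x → ∑ (λ y → ∑ (λ l → χ (x - l) ℤ.* φ x ℤ.* (χ (y - l) ℤ.* φ y))))   ≡⟨ ∑-cong (λ x → trans (∑-cong (λ y → trans (∑-cong (λ l → lem₃ (χ (x - l)) (φ x) (χ (y - l)) (φ y))) (trans (∑-*ˡ (φ x) _) (cong (λ z → φ x ℤ.* z) (trans (∑-*ˡ (φ y) _) (cong (λ z → φ y ℤ.* z) (corr x y))))))) (trans (∑-*ˡ (φ x) _) (cong (λ z → φ x ℤ.* z) (inner x)))) ⟩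
      ∑ (λ x → φ x ℤ.* (pos q ℤ.* φ x ℤ.- S))   ∎

  -- If D ≠ 0 and l² ≠ D, this is minus the trace of Frobenius of the elliptic curve y² = (x - l)(x²
  -- - D), on which (l, 0) is a rational point of order 2.
  h : Carrier → Carrier → ℤ
  h D l = ∑ (λ x → χ ((x - l) * (x * x - D)))

  h-odd : ∀ D l → h D (- l) ≡ ℤ.- h D l
  h-odd D l = trans (∑-negate _) (trans (∑-cong λ x → trans
    (cong χ (solve 3 (λ x l D → (:- x :- :- l) :* (:- x :* :- x :- D) := :- ((x :- l) :* (x :* x :- D))) refl x l D)) (χ-neg _)) (∑-neg _))

  -- Scaling x by u is the quadratic twist by u, so h² depends on (D, l) only up to (u²D, ul).
  h-scale : ∀ u D l → u ≢0 → h (u * u * D) (u * l) ≡ χ u ℤ.* h D l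
  h-scale u D l u≢0 = trans (∑-scale u u≢0 _) (trans (∑-cong λ x → trans
    (cong χ (solve 4 (λ u x l D → (u :* x :- u :* l) :* (u :* x :* (u :* x) :- u :* u :* D) := u :* u :* (u :* ((x :- l) :* (x :* x :- D)))) refl u x l D))
    (trans (χ-square-* u _ u≢0) (χ-* u _))) (∑-*ˡ (χ u) _))

  count-quadratic-roots : ∀ c B → ∑ (λ y → ind ((y * y - c * y + B) ≟ 0#)) ≡ 1ℤ ℤ.+ χ (c * c - ♯ 4 * B)
  count-quadratic-roots c B = sym (begin
    1ℤ ℤ.+ χ (c * c - ♯ 4 * B)   ≡⟨ sym (count-square-roots _) ⟩
    ∑ (λ x → ind ((x * x) ≟ (c * c - ♯ 4 * B)))   ≡⟨ ∑-shift (- c) _ ⟩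
    ∑ (λ x → ind (((x - c) * (x - c)) ≟ (c * c - ♯ 4 * B)))   ≡⟨ ∑-scale (♯ 2) 2≢0 _ ⟩
    ∑ (λ y → ind (((♯ 2 * y - c) * (♯ 2 * y - c)) ≟ (c * c - ♯ 4 * B)))   ≡⟨ ∑-cong (λ y → ind-cong _ _ (to y) (from y)) ⟩
    ∑ (λ y → ind ((y * y - c * y + B) ≟ 0#))   ∎)
    where
    open ≡-Reasoning
    to : ∀ y → (♯ 2 * y - c) * (♯ 2 * y - c) ≡ c * c - ♯ 4 * B → y * y - c * y + B ≡ 0#
    to y e = x*y≡0⇒y≡0 (♯ 2 * ♯ 2) _ (*-≢0 2≢0 2≢0) (via 1# _ _ e
      (solve 3 (λ y c B → κ 2 :* κ 2 :* (y :* y :- c :* y :+ B) :- κ 0 := κ 1 :* ((κ 2 :* y :- c) :* (κ 2 :* y :- c) :- (c :* c :- κ 4 :* B))) refl y c B))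
    from : ∀ y → y * y - c * y + B ≡ 0# → (♯ 2 * y - c) * (♯ 2 * y - c) ≡ c * c - ♯ 4 * B
    from y e = via (♯ 4) _ _ e
      (solve 3 (λ y c B → (κ 2 :* y :- c) :* (κ 2 :* y :- c) :- (c :* c :- κ 4 :* B) := κ 4 :* (y :* y :- c :* y :+ B :- κ 0)) refl y c B)

  -- The two sides count points on 2-isogenous curves; the isogeny is (y, …) ↦ c = y + B/y.
  h-isogeny : ∀ D l → l * l - D ≢0 → h D l ≡ h (l * l - D) (- l)
  h-isogeny D l B≢0 = begin
    h D l   ≡⟨ ∑-shift l _ ⟩
    ∑ (λ y → χ ((y + l - l) * ((y + l) * (y + l) - D)))   ≡⟨ ∑-cong (λ y → cong χ (solve 3 (λ y l D → (y :+ l :- l) :* ((y :+ l) :* (y :+ l) :- D) := y :* (y :* y :+ κ 2 :* l :* y :+ (l :* l :- D))) refl y l D)) ⟩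
    ∑ (λ y → χ (y * (y * y + A * y + B)))   ≡⟨ ∑-cong (λ y → sym (inner y)) ⟩
    ∑ (λ y → ∑ (λ c → ind ((y * y - c * y + B) ≟ 0#) ℤ.* χ (c + A)))        ≡⟨ ∑-swap _ ⟩
    ∑ (λ c → ∑ (λ y → ind ((y * y - c * y + B) ≟ 0#) ℤ.* χ (c + A)))        ≡⟨ ∑-cong (λ c → trans (∑-*ʳ (χ (c + A)) _) (cong (λ z → z ℤ.* χ (c + A)) (count-quadratic-roots c B))) ⟩
    ∑ (λ c → (1ℤ ℤ.+ χ (c * c - ♯ 4 * B)) ℤ.* χ (c + A))   ≡⟨ ∑-cong (λ c → lem (χ (c * c - ♯ 4 * B)) (χ (c + A))) ⟩
    ∑ (λ c → χ (c + A) ℤ.+ χ (c + A) ℤ.* χ (c * c - ♯ 4 * B))   ≡⟨ ∑-+ _ _ ⟩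
    ∑ (λ c → χ (c + A)) ℤ.+ ∑ (λ c → χ (c + A) ℤ.* χ (c * c - ♯ 4 * B))     ≡⟨ cong₂ ℤ._+_ (trans (sym (∑-shift A χ)) ∑χ) (∑-cong λ c → trans (sym (χ-* _ _)) (cong χ (solve 3 (λ c l D → (c :+ κ 2 :* l) :* (c :* c :- κ 4 :* (l :* l :- D)) := (c :- κ 2 :* :- l) :* (c :* c :- κ 2 :* κ 2 :* (l :* l :- D))) refl c l D))) ⟩
    0ℤ ℤ.+ h (♯ 2 * ♯ 2 * B) (♯ 2 * - l)   ≡⟨ ℤₚ.+-identityˡ _ ⟩
    h (♯ 2 * ♯ 2 * B) (♯ 2 * - l)   ≡⟨ h-scale (♯ 2) B (- l) 2≢0 ⟩
    χ (♯ 2) ℤ.* h B (- l)   ≡⟨ cong (λ z → z ℤ.* h B (- l)) χ-2 ⟩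
    1ℤ ℤ.* h B (- l)   ≡⟨ ℤₚ.*-identityˡ _ ⟩
    h B (- l)   ∎
    where
    open ≡-Reasoning
    A B : Carrier
    A = ♯ 2 * l
    B = l * l - D
    lem : ∀ a b → (1ℤ ℤ.+ a) ℤ.* b ≡ b ℤ.+ b ℤ.* a
    lem = solve-∀
    -- For y ≠ 0 only c = y + B/y satisfies the equation, and y²(c + A) = y(y² + Ay + B). For y = 0
    -- there is no such c because B ≠ 0, and the right side is 0.
    inner : ∀ y → ∑ (λ c → ind ((y * y - c * y + B) ≟ 0#) ℤ.* χ (c + A)) ≡ χ (y * (y * y + A * y + B))
    inner y = go (y ≟ 0#)
      where
      go : Dec (y ≡ 0#) → ∑ (λ c → ind ((y * y - c * y + B) ≟ 0#) ℤ.* χ (c + A)) ≡ χ (y * (y * y + A * y + B))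
      go (yes refl) = trans (∑-zero λ c → trans (cong (λ z → z ℤ.* χ (c + A)) (ind-no (_ ≟ 0#) λ e → B≢0 (trans (solve 2 (λ c B → B := κ 0 :* κ 0 :- c :* κ 0 :+ B) refl c B) e))) (ℤₚ.*-zeroˡ (χ (c + A)))) (sym (χ-zero (zeroˡ _)))
      go (no y≢0) = trans
        (∑-only _ c₀ λ c c≢c₀ → trans (cong (λ z → z ℤ.* χ (c + A)) (ind-no (_ ≟ 0#) λ e → c≢c₀ (/-unique′ c e))) (ℤₚ.*-zeroˡ (χ (c + A))))
        (trans (cong (λ z → z ℤ.* χ (c₀ + A)) (ind-yes (_ ≟ 0#) (via (- 1#) _ _ yc₀ (solve 3 (λ y c B → y :* y :- c :* y :+ B :- κ 0 := :- κ 1 :* (y :* c :- (y :* y :+ B))) refl y c₀ B))))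
        (trans (ℤₚ.*-identityˡ _) (trans (sym (χ-square-* y (c₀ + A) y≢0)) (cong χ (via y _ _ yc₀
          (solve 4 (λ y c A B → y :* y :* (c :+ A) :- y :* (y :* y :+ A :* y :+ B) := y :* (y :* c :- (y :* y :+ B))) refl y c₀ A B))))))
        where
        c₀ : Carrier
        c₀ = (y * y + B) * y ⁻¹
        yc₀ : y * c₀ ≡ y * y + B
        yc₀ = trans (solve 3 (λ u v i → u :* (v :* i) := v :* (u :* i)) refl y (y * y + B) (y ⁻¹)) (trans (cong (λ z → (y * y + B) * z) (⁻¹-inverse y y≢0)) (*-identityʳ _))
        /-unique′ : ∀ c → y * y - c * y + B ≡ 0# → c ≡ c₀
        /-unique′ c e = *-cancelˡ y c c₀ y≢0 (trans (via (- 1#) _ _ e (solve 3 (λ y c B → y :* c :- (y :* y :+ B) := :- κ 1 :* (y :* y :- c :* y :+ B :- κ 0)) refl y c B)) (sym yc₀))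

  -- Parseval for φ(x) = χ(x² - D), whose sum is -1; the square of this sum is the 1 on the left.
  h-parseval : ∀ D → D ≢0 → ∑ (λ l → h D l ℤ.* h D l) ℤ.+ 1ℤ ℤ.≤ pos q ℤ.* pos q
  h-parseval D D≢0 = begin
    ∑ (λ l → h D l ℤ.* h D l) ℤ.+ 1ℤ   ≡⟨ cong₂ ℤ._+_ (∑-cong λ l → cong (λ z → z ℤ.* z) (∑-cong λ x → χ-* (x - l) (x * x - D))) (sym (cong (λ z → z ℤ.* z) (∑χ[x²-D] D D≢0))) ⟩
    ∑ (λ l → ∑ (λ x → χ (x - l) ℤ.* φ x) ℤ.* ∑ (λ x → χ (x - l) ℤ.* φ x)) ℤ.+ ∑ φ ℤ.* ∑ φ   ≡⟨ parseval φ ⟩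
    pos q ℤ.* ∑ (λ x → φ x ℤ.* φ x)   ≤⟨ ℤₚ.*-monoˡ-≤-nonNeg (pos q) (ℤₚ.≤-trans (∑-mono-≤ φ²≤1) (ℤₚ.≤-reflexive ∑-1)) ⟩
    pos q ℤ.* pos q   ∎
    where
    open ℤₚ.≤-Reasoning
    φ : Carrier → ℤ
    φ x = χ (x * x - D)
    φ²≤1 : ∀ x → φ x ℤ.* φ x ℤ.≤ 1ℤ
    φ²≤1 x with classify (x * x - D)
    ... | isZero _ e rewrite e = ℤ.+≤+ ℕ.z≤n
    ... | isSq _ _ _ _ e rewrite e = ℤₚ.≤-refl
    ... | isNon _ _ e rewrite e = ℤₚ.≤-refl

  h-list-bound : ∀ D → D ≢0 → ∀ ls → All (_≢ 0#) ls → AllPairs (λ x y → x * x ≢ y * y) ls →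
    pos 2 ℤ.* sumℤ (map (λ l → h D l ℤ.* h D l) ls) ℤ.+ 1ℤ ℤ.≤ pos q ℤ.* pos q
  h-list-bound D D≢0 ls ls≢0 distinct = ℤₚ.≤-trans
    (ℤₚ.+-monoˡ-≤ 1ℤ (twice-∑-list≤∑ (λ l → h D l ℤ.* h D l) (λ l → 0≤i*i (h D l)) (λ l → trans (cong (λ z → z ℤ.* z) (h-odd D l)) (lem (h D l))) ls ls≢0 distinct))
    (h-parseval D D≢0)
    where
    lem : ∀ a → ℤ.- a ℤ.* ℤ.- a ≡ a ℤ.* a
    lem = solve-∀

-- Counting the good elements by character sums

module Counting {q : ℕ} (F : FiniteField q) (q≡7 : q ℕ.% 8 ≡ 7) (3≢0 : Invertible F 3) where
  open FiniteField F
  open FieldAlgebra F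
  open FieldSums F
  open QuadraticCharacter F
  open Mod8 F q≡7
  open EllipticSums F q≡7
  open Differential F q≡7 3≢0 using (Good; χ-scale; χ-4*)

  -- `h₃` is χ(3) h(3, 5/3) with the denominator cleared.
  h₁ h₂ h₃ : ℤ
  h₁ = h (♯ 3) 1#
  h₂ = h (♯ 3) (♯ 2)
  h₃ = ∑ (λ x → χ ((♯ 3 * x - ♯ 5) * (x * x - ♯ 3)))

  private
    -- With s = x + 2 these are x, x + 3, x + 1 and x² + 4x + 1, the four expressions in `Good`.
    a b c d : Carrier → Carrier
    a s = s - ♯ 2
    b s = s - - 1#
    c s = s - 1#
    d s = s * s - ♯ 3

  -- The 2-isogeny leads from D = 1, l = 2 to 2² - 1 = 3.
  h-1-2 : h 1# (♯ 2) ≡ ℤ.- h₂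
  h-1-2 = trans (h-isogeny 1# (♯ 2) (λ e → 3≢0 (trans (solve 0 (κ 3 := κ 2 :* κ 2 :- κ 1) refl) e)))
    (trans (cong (λ z → h z (- ♯ 2)) (solve 0 (κ 2 :* κ 2 :- κ 1 := κ 3) refl)) (h-odd (♯ 3) (♯ 2)))

  ∑bd : ∑ (λ s → χ (b s * d s)) ≡ ℤ.- h₁
  ∑bd = h-odd (♯ 3) 1#

  ∑abc : ∑ (λ s → χ (a s * b s * c s)) ≡ ℤ.- h₂
  ∑abc = trans (∑-cong λ s → cong χ (solve 1 (λ s → (s :- κ 2) :* (s :- :- κ 1) :* (s :- κ 1) := (s :- κ 2) :* (s :* s :- κ 1)) refl s)) h-1-2

  -- Substitute s² = t; then t(t-1)(t-3) is a translate of (x+2)(x²-1).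
  ∑bcd : ∑ (λ s → χ (b s * c s * d s)) ≡ h₂ ℤ.- 1ℤ
  ∑bcd = begin
    ∑ (λ s → χ (b s * c s * d s))   ≡⟨ ∑-cong (λ s → cong χ (solve 1 (λ s → (s :- :- κ 1) :* (s :- κ 1) :* (s :* s :- κ 3) := (s :* s :- κ 1) :* (s :* s :- κ 3)) refl s)) ⟩
    ∑ (λ s → g (s * s))   ≡⟨ ∑-fibre (λ s → s * s) g ⟩
    ∑ (λ t → ∑ (λ s → ind ((s * s) ≟ t)) ℤ.* g t)   ≡⟨ ∑-cong (λ t → trans (cong (λ z → z ℤ.* g t) (count-square-roots t)) (trans (lem (χ t) (g t)) (cong (λ z → g t ℤ.+ z) (sym (χ-* t _))))) ⟩
    ∑ (λ t → g t ℤ.+ χ (t * ((t - 1#) * (t - ♯ 3))))   ≡⟨ ∑-+ _ _ ⟩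
    ∑ g ℤ.+ ∑ (λ t → χ (t * ((t - 1#) * (t - ♯ 3))))   ≡⟨ cong₂ ℤ._+_ (trans (∑-cong λ t → χ-* _ _) (∑χ[x-a][x-b] 1# (♯ 3) 1≢3)) shifted ⟩
    -1ℤ ℤ.+ h₂   ≡⟨ ℤₚ.+-comm -1ℤ h₂ ⟩
    h₂ ℤ.- 1ℤ   ∎
    where
    open ≡-Reasoning
    g : Carrier → ℤ
    g t = χ ((t - 1#) * (t - ♯ 3))
    lem : ∀ a b → (1ℤ ℤ.+ a) ℤ.* b ≡ b ℤ.+ a ℤ.* b
    lem = solve-∀
    1≢3 : 1# ≢ ♯ 3
    1≢3 e = 2≢0 (trans (solve 0 (κ 2 := κ 3 :- κ 1) refl) (trans (cong (λ z → ♯ 3 - z) e) (-‿inverseʳ _)))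
    shifted : ∑ (λ t → χ (t * ((t - 1#) * (t - ♯ 3)))) ≡ h₂
    shifted = trans (∑-shift (♯ 2) _) (trans (∑-cong λ u → cong χ (solve 1 (λ u → (u :+ κ 2) :* ((u :+ κ 2 :- κ 1) :* (u :+ κ 2 :- κ 3)) := (u :- :- κ 2) :* (u :* u :- κ 1)) refl u))
      (trans (h-odd 1# (♯ 2)) (trans (cong ℤ.-_ h-1-2) (ℤₚ.neg-involutive h₂))))

  private
    -- s = 1 + 2/x
    ∑-invert-at-1 : ∀ (g g′ : Carrier → ℤ) → (∀ x y → x ≢0 → x * y ≡ ♯ 2 → g (y + 1#) ≡ g′ x) → ∑ g ℤ.+ g′ 0# ≡ ∑ g′ ℤ.+ g 1#
    ∑-invert-at-1 g g′ k = trans (cong (λ z → z ℤ.+ g′ 0#) (∑-shift 1# g))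
      (trans (∑-inversion (♯ 2) 2≢0 (λ y → g (y + 1#)) g′ k) (cong (λ z → ∑ g′ ℤ.+ g z) (+-identityˡ 1#)))

    ∑-invert-at-neg1 : ∀ (g g′ : Carrier → ℤ) → (∀ x y → x ≢0 → x * y ≡ ♯ 2 → g (y - 1#) ≡ g′ x) → ∑ g ℤ.+ g′ 0# ≡ ∑ g′ ℤ.+ g (- 1#)
    ∑-invert-at-neg1 g g′ k = trans (cong (λ z → z ℤ.+ g′ 0#) (∑-shift (- 1#) g))
      (trans (∑-inversion (♯ 2) 2≢0 (λ y → g (y - 1#)) g′ k) (cong (λ z → ∑ g′ ℤ.+ g z) (+-identityˡ (- 1#))))

    x²≢0 : ∀ {x} → x ≢0 → x * x ≢0
    x²≢0 n = *-≢0 n n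

    -- Rational identities in x and y = 2/x are verified after clearing denominators by an even power of x.
    χ-clear : ∀ z l r → z ≢0 → z * z * l ≡ ♯ 4 * r → χ l ≡ χ r
    χ-clear z l r z≢0 e = trans (sym (χ-square-* z l z≢0)) (trans (cong χ e) (χ-4* r))

  -- s = 1 + 2/x sends the root of `c` to infinity and turns the quartic into a cubic, a translate
  -- of the one in `h₁`. The term 1 is the value χ(4) of the cubic at x = 0, which no s attains.
  ∑acd : ∑ (λ s → χ (a s * c s * d s)) ≡ h₁ ℤ.- 1ℤ
  ∑acd = +ᶻ-cancelʳ 1ℤ _ _ (begin
    ∑ (λ s → χ (a s * c s * d s)) ℤ.+ 1ℤ   ≡⟨ cong (λ z → ∑ (λ s → χ (a s * c s * d s)) ℤ.+ z) (sym (trans (cong χ (solve 0 ((κ 0 :- κ 1 :- κ 1) :* ((κ 0 :- κ 1) :* (κ 0 :- κ 1) :- κ 3) := κ 2 :* κ 2) refl)) (χ-square (♯ 2) 2≢0))) ⟩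
    ∑ (λ s → χ (a s * c s * d s)) ℤ.+ g′ 0#   ≡⟨ ∑-invert-at-1 _ g′ step ⟩
    ∑ g′ ℤ.+ χ (a 1# * c 1# * d 1#)   ≡⟨ cong₂ ℤ._+_ (sym (∑-shift (- 1#) _)) (χ-zero (solve 0 ((κ 1 :- κ 2) :* (κ 1 :- κ 1) :* (κ 1 :* κ 1 :- κ 3) := κ 0) refl)) ⟩
    h₁ ℤ.+ 0ℤ   ≡⟨ lem h₁ ⟩
    h₁ ℤ.- 1ℤ ℤ.+ 1ℤ   ∎)
    where
    open ≡-Reasoning
    lem : ∀ a → a ℤ.+ 0ℤ ≡ a ℤ.- 1ℤ ℤ.+ 1ℤ
    lem = solve-∀
    g′ : Carrier → ℤ
    g′ x = χ ((x - 1# - 1#) * ((x - 1#) * (x - 1#) - ♯ 3))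
    step : ∀ x y → x ≢0 → x * y ≡ ♯ 2 → χ (a (y + 1#) * c (y + 1#) * d (y + 1#)) ≡ g′ x
    step x y x≢0 e = χ-clear (x * x) _ _ (x²≢0 x≢0) (begin
      x * x * (x * x) * (a (y + 1#) * c (y + 1#) * d (y + 1#))   ≡⟨ solve 2 (λ x y → x :* x :* (x :* x) :* ((y :+ κ 1 :- κ 2) :* (y :+ κ 1 :- κ 1) :* ((y :+ κ 1) :* (y :+ κ 1) :- κ 3)) := (x :* y :- x) :* (x :* y) :* ((x :* y) :* (x :* y) :+ κ 2 :* x :* (x :* y) :- κ 2 :* (x :* x))) refl x y ⟩
      (x * y - x) * (x * y) * ((x * y) * (x * y) + ♯ 2 * x * (x * y) - ♯ 2 * (x * x))           ≡⟨ cong (λ z → (z - x) * z * (z * z + ♯ 2 * x * z - ♯ 2 * (x * x))) e ⟩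
      (♯ 2 - x) * ♯ 2 * (♯ 2 * ♯ 2 + ♯ 2 * x * ♯ 2 - ♯ 2 * (x * x))   ≡⟨ solve 1 (λ x → (κ 2 :- x) :* κ 2 :* (κ 2 :* κ 2 :+ κ 2 :* x :* κ 2 :- κ 2 :* (x :* x)) := κ 4 :* ((x :- κ 1 :- κ 1) :* ((x :- κ 1) :* (x :- κ 1) :- κ 3))) refl x ⟩
      ♯ 4 * ((x - 1# - 1#) * ((x - 1#) * (x - 1#) - ♯ 3))   ∎)

  -- As for `∑acd`, but now s = -1 + 2/x sends the root of `b` to infinity.
  ∑abd : ∑ (λ s → χ (a s * b s * d s)) ≡ h₃ ℤ.- 1ℤ
  ∑abd = +ᶻ-cancelʳ 1ℤ _ _ (begin
    ∑ (λ s → χ (a s * b s * d s)) ℤ.+ 1ℤ   ≡⟨ cong (λ z → ∑ (λ s → χ (a s * b s * d s)) ℤ.+ z) (sym (trans (cong χ (solve 0 ((κ 3 :* (κ 0 :+ κ 1) :- κ 5) :* ((κ 0 :+ κ 1) :* (κ 0 :+ κ 1) :- κ 3) := κ 2 :* κ 2) refl)) (χ-square (♯ 2) 2≢0))) ⟩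
    ∑ (λ s → χ (a s * b s * d s)) ℤ.+ g′ 0#   ≡⟨ ∑-invert-at-neg1 _ g′ step ⟩
    ∑ g′ ℤ.+ χ (a (- 1#) * b (- 1#) * d (- 1#))   ≡⟨ cong₂ ℤ._+_ (sym (∑-shift 1# _)) (χ-zero (solve 0 ((:- κ 1 :- κ 2) :* (:- κ 1 :- :- κ 1) :* (:- κ 1 :* :- κ 1 :- κ 3) := κ 0) refl)) ⟩
    h₃ ℤ.+ 0ℤ   ≡⟨ lem h₃ ⟩
    h₃ ℤ.- 1ℤ ℤ.+ 1ℤ   ∎)
    where
    open ≡-Reasoning
    lem : ∀ a → a ℤ.+ 0ℤ ≡ a ℤ.- 1ℤ ℤ.+ 1ℤ
    lem = solve-∀
    g′ : Carrier → ℤ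
    g′ x = χ ((♯ 3 * (x + 1#) - ♯ 5) * ((x + 1#) * (x + 1#) - ♯ 3))
    step : ∀ x y → x ≢0 → x * y ≡ ♯ 2 → χ (a (y - 1#) * b (y - 1#) * d (y - 1#)) ≡ g′ x
    step x y x≢0 e = χ-clear (x * x) _ _ (x²≢0 x≢0) (begin
      x * x * (x * x) * (a (y - 1#) * b (y - 1#) * d (y - 1#))   ≡⟨ solve 2 (λ x y → x :* x :* (x :* x) :* ((y :- κ 1 :- κ 2) :* (y :- κ 1 :- :- κ 1) :* ((y :- κ 1) :* (y :- κ 1) :- κ 3)) := (x :* y :- κ 3 :* x) :* (x :* y) :* ((x :* y) :* (x :* y) :- κ 2 :* x :* (x :* y) :- κ 2 :* (x :* x))) refl x y ⟩
      (x * y - ♯ 3 * x) * (x * y) * ((x * y) * (x * y) - ♯ 2 * x * (x * y) - ♯ 2 * (x * x))     ≡⟨ cong (λ z → (z - ♯ 3 * x) * z * (z * z - ♯ 2 * x * z - ♯ 2 * (x * x))) e ⟩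
      (♯ 2 - ♯ 3 * x) * ♯ 2 * (♯ 2 * ♯ 2 - ♯ 2 * x * ♯ 2 - ♯ 2 * (x * x))   ≡⟨ solve 1 (λ x → (κ 2 :- κ 3 :* x) :* κ 2 :* (κ 2 :* κ 2 :- κ 2 :* x :* κ 2 :- κ 2 :* (x :* x)) := κ 4 :* ((κ 3 :* (x :+ κ 1) :- κ 5) :* ((x :+ κ 1) :* (x :+ κ 1) :- κ 3))) refl x ⟩
      ♯ 4 * ((♯ 3 * (x + 1#) - ♯ 5) * ((x + 1#) * (x + 1#) - ♯ 3))   ∎)

  -- The genus 2 sum is its own negative under s = 1 + 2/(1 - y).
  ∑abcd : ∑ (λ s → χ (a s * b s * c s * d s)) ≡ 0ℤ
  ∑abcd = z≡-z⇒z≡0 _ (begin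
    S   ≡⟨ lem S ⟩
    S ℤ.+ 0ℤ   ≡⟨ cong (λ z → S ℤ.+ z) (sym (χ-zero (solve 0 (κ 2 :* ((κ 0 :- κ 1 :- κ 1) :* (κ 0 :- κ 1 :+ κ 1) :* (κ 0 :- κ 1 :+ κ 2) :* ((κ 0 :- κ 1) :* (κ 0 :- κ 1) :- κ 3)) := κ 0) refl))) ⟩
    S ℤ.+ g′ 0#   ≡⟨ ∑-invert-at-1 _ g′ step ⟩
    ∑ g′ ℤ.+ χ (a 1# * b 1# * c 1# * d 1#)   ≡⟨ cong₂ ℤ._+_ (sym (∑-shift (- 1#) _)) (χ-zero (solve 0 ((κ 1 :- κ 2) :* (κ 1 :- :- κ 1) :* (κ 1 :- κ 1) :* (κ 1 :* κ 1 :- κ 3) := κ 0) refl)) ⟩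
    ∑ (λ y → χ (♯ 2 * ((y - 1#) * (y + 1#) * (y + ♯ 2) * (y * y - ♯ 3)))) ℤ.+ 0ℤ   ≡⟨ ℤₚ.+-identityʳ _ ⟩
    ∑ (λ y → χ (♯ 2 * ((y - 1#) * (y + 1#) * (y + ♯ 2) * (y * y - ♯ 3))))          ≡⟨ ∑-negate _ ⟩
    ∑ (λ y → χ (♯ 2 * ((- y - 1#) * (- y + 1#) * (- y + ♯ 2) * (- y * - y - ♯ 3)))) ≡⟨ ∑-cong (λ y → trans (χ-scale (♯ 2) _ χ-2) (trans (cong χ (solve 1 (λ y → (:- y :- κ 1) :* (:- y :+ κ 1) :* (:- y :+ κ 2) :* (:- y :* :- y :- κ 3) := :- ((y :- κ 2) :* (y :- :- κ 1) :* (y :- κ 1) :* (y :* y :- κ 3))) refl y)) (χ-neg _))) ⟩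
    ∑ (λ y → ℤ.- χ (a y * b y * c y * d y))   ≡⟨ ∑-neg _ ⟩
    ℤ.- S   ∎)
    where
    open ≡-Reasoning
    S : ℤ
    S = ∑ (λ s → χ (a s * b s * c s * d s))
    lem : ∀ a → a ≡ a ℤ.+ 0ℤ
    lem = solve-∀
    z≡-z⇒z≡0 : ∀ z → z ≡ ℤ.- z → z ≡ 0ℤ
    z≡-z⇒z≡0 (pos zero) _ = refl
    g′ : Carrier → ℤ
    g′ x = χ (♯ 2 * ((x - 1# - 1#) * (x - 1# + 1#) * (x - 1# + ♯ 2) * ((x - 1#) * (x - 1#) - ♯ 3)))
    step : ∀ x y → x ≢0 → x * y ≡ ♯ 2 → χ (a (y + 1#) * b (y + 1#) * c (y + 1#) * d (y + 1#)) ≡ g′ x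
    step x y x≢0 e = χ-clear (x * x * x) _ _ (*-≢0 (x²≢0 x≢0) x≢0) (begin
      x * x * x * (x * x * x) * (a (y + 1#) * b (y + 1#) * c (y + 1#) * d (y + 1#))   ≡⟨ solve 2 (λ x y → x :* x :* x :* (x :* x :* x) :* ((y :+ κ 1 :- κ 2) :* (y :+ κ 1 :- :- κ 1) :* (y :+ κ 1 :- κ 1) :* ((y :+ κ 1) :* (y :+ κ 1) :- κ 3)) := x :* ((x :* y :- x) :* (x :* y :+ κ 2 :* x) :* (x :* y) :* ((x :* y) :* (x :* y) :+ κ 2 :* x :* (x :* y) :- κ 2 :* (x :* x)))) refl x y ⟩
      x * ((x * y - x) * (x * y + ♯ 2 * x) * (x * y) * ((x * y) * (x * y) + ♯ 2 * x * (x * y) - ♯ 2 * (x * x))) ≡⟨ cong (λ z → x * ((z - x) * (z + ♯ 2 * x) * z * (z * z + ♯ 2 * x * z - ♯ 2 * (x * x)))) e ⟩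
      x * ((♯ 2 - x) * (♯ 2 + ♯ 2 * x) * ♯ 2 * (♯ 2 * ♯ 2 + ♯ 2 * x * ♯ 2 - ♯ 2 * (x * x)))   ≡⟨ solve 1 (λ x → x :* ((κ 2 :- x) :* (κ 2 :+ κ 2 :* x) :* κ 2 :* (κ 2 :* κ 2 :+ κ 2 :* x :* κ 2 :- κ 2 :* (x :* x))) := κ 4 :* (κ 2 :* ((x :- κ 1 :- κ 1) :* (x :- κ 1 :+ κ 1) :* (x :- κ 1 :+ κ 2) :* ((x :- κ 1) :* (x :- κ 1) :- κ 3)))) refl x ⟩
      ♯ 4 * (♯ 2 * ((x - 1# - 1#) * (x - 1# + 1#) * (x - 1# + ♯ 2) * ((x - 1#) * (x - 1#) - ♯ 3)))        ∎)

  -- When all four expressions are nonzero, this is 16 if s - 2 is good and 0 otherwise.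
  weight : Carrier → ℤ
  weight s = (1ℤ ℤ.- χ (a s)) ℤ.* (1ℤ ℤ.- χ (b s)) ℤ.* (1ℤ ℤ.+ χ (c s)) ℤ.* (1ℤ ℤ.- χ (d s))

  ∑weight : ∑ weight ≡ pos q ℤ.+ 1ℤ ℤ.- (h₁ ℤ.- h₂ ℤ.+ h₃)
  ∑weight = begin
    ∑ weight   ≡⟨ ∑-cong (λ s → expand (χ (a s)) (χ (b s)) (χ (c s)) (χ (d s))) ⟩
    ∑ (λ s → sumℤ (map (λ f → f s) monomials))   ≡⟨ ∑-list monomials ⟩
    sumℤ (map ∑ monomials)   ≡⟨ values ⟩
    pos q ℤ.+ (0ℤ ℤ.+ (0ℤ ℤ.+ (0ℤ ℤ.+ (1ℤ ℤ.+ (-1ℤ ℤ.+ (1ℤ ℤ.+ (1ℤ ℤ.+ (h₂ ℤ.+ (ℤ.- h₁ ℤ.+ (ℤ.- h₁ ℤ.+ (ℤ.- h₂ ℤ.+ (ℤ.- (h₃ ℤ.- 1ℤ) ℤ.+ ((h₁ ℤ.- 1ℤ) ℤ.+ ((h₂ ℤ.- 1ℤ) ℤ.+ (0ℤ ℤ.+ 0ℤ)))))))))))))))  ≡⟨ lem (pos q) h₁ h₂ h₃ ⟩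
    pos q ℤ.+ 1ℤ ℤ.- (h₁ ℤ.- h₂ ℤ.+ h₃)   ∎
    where
    open ≡-Reasoning
    A B C D : Carrier → ℤ
    A s = χ (a s)
    B s = χ (b s)
    C s = χ (c s)
    D s = χ (d s)
    monomials : List (Carrier → ℤ)
    monomials = (λ _ → 1ℤ) ∷ (λ s → ℤ.- A s) ∷ (λ s → ℤ.- B s) ∷ C ∷ (λ s → ℤ.- D s)
      ∷ (λ s → A s ℤ.* B s) ∷ (λ s → ℤ.- (A s ℤ.* C s)) ∷ (λ s → ℤ.- (B s ℤ.* C s))
      ∷ (λ s → A s ℤ.* D s) ∷ (λ s → B s ℤ.* D s) ∷ (λ s → ℤ.- (C s ℤ.* D s))
      ∷ (λ s → A s ℤ.* B s ℤ.* C s) ∷ (λ s → ℤ.- (A s ℤ.* B s ℤ.* D s)) ∷ (λ s → A s ℤ.* C s ℤ.* D s) ∷ (λ s → B s ℤ.* C s ℤ.* D s)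
      ∷ (λ s → ℤ.- (A s ℤ.* B s ℤ.* C s ℤ.* D s)) ∷ []
    expand : ∀ x y z w → (1ℤ ℤ.- x) ℤ.* (1ℤ ℤ.- y) ℤ.* (1ℤ ℤ.+ z) ℤ.* (1ℤ ℤ.- w) ≡
      1ℤ ℤ.+ (ℤ.- x ℤ.+ (ℤ.- y ℤ.+ (z ℤ.+ (ℤ.- w ℤ.+ (x ℤ.* y ℤ.+ (ℤ.- (x ℤ.* z) ℤ.+ (ℤ.- (y ℤ.* z) ℤ.+ (x ℤ.* w ℤ.+ (y ℤ.* w ℤ.+ (ℤ.- (z ℤ.* w) ℤ.+ (x ℤ.* y ℤ.* z ℤ.+ (ℤ.- (x ℤ.* y ℤ.* w) ℤ.+ (x ℤ.* z ℤ.* w ℤ.+ (y ℤ.* z ℤ.* w ℤ.+ (ℤ.- (x ℤ.* y ℤ.* z ℤ.* w) ℤ.+ 0ℤ)))))))))))))))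
    expand = solve-∀
    lem : ∀ n x y z → n ℤ.+ (0ℤ ℤ.+ (0ℤ ℤ.+ (0ℤ ℤ.+ (1ℤ ℤ.+ (-1ℤ ℤ.+ (1ℤ ℤ.+ (1ℤ ℤ.+ (y ℤ.+ (ℤ.- x ℤ.+ (ℤ.- x ℤ.+ (ℤ.- y ℤ.+ (ℤ.- (z ℤ.- 1ℤ) ℤ.+ ((x ℤ.- 1ℤ) ℤ.+ ((y ℤ.- 1ℤ) ℤ.+ (0ℤ ℤ.+ 0ℤ))))))))))))))) ≡ n ℤ.+ 1ℤ ℤ.- (x ℤ.- y ℤ.+ z)
    lem = solve-∀
    mul₂ : ∀ (f g : Carrier → Carrier) → ∑ (λ s → χ (f s) ℤ.* χ (g s)) ≡ ∑ (λ s → χ (f s * g s))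
    mul₂ f g = ∑-cong λ s → sym (χ-* _ _)
    mul₃ : ∀ (f g k : Carrier → Carrier) → ∑ (λ s → χ (f s) ℤ.* χ (g s) ℤ.* χ (k s)) ≡ ∑ (λ s → χ (f s * g s * k s))
    mul₃ f g k = ∑-cong λ s → trans (cong (λ z → z ℤ.* χ (k s)) (sym (χ-* (f s) (g s)))) (sym (χ-* _ _))
    mul₄ : ∀ (f g k l : Carrier → Carrier) → ∑ (λ s → χ (f s) ℤ.* χ (g s) ℤ.* χ (k s) ℤ.* χ (l s)) ≡ ∑ (λ s → χ (f s * g s * k s * l s))
    mul₄ f g k l = ∑-cong λ s → trans (cong (λ z → z ℤ.* χ (l s)) (trans (cong (λ z → z ℤ.* χ (k s)) (sym (χ-* (f s) (g s)))) (sym (χ-* _ _)))) (sym (χ-* _ _))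
    neg : ∀ {f z} → ∑ f ≡ z → ∑ (λ s → ℤ.- f s) ≡ ℤ.- z
    neg {f} e = trans (∑-neg f) (cong ℤ.-_ e)
    2≢-1 : ♯ 2 ≢ - 1#
    2≢-1 e = 3≢0 (trans (solve 0 (κ 3 := κ 2 :- :- κ 1) refl) (trans (cong (λ z → z - - 1#) e) (-‿inverseʳ _)))
    2≢1 : ♯ 2 ≢ 1#
    2≢1 e = 1≢0 (trans (solve 0 (κ 1 := κ 2 :- κ 1) refl) (trans (cong (λ z → z - 1#) e) (-‿inverseʳ _)))
    -1≢1 : - 1# ≢ 1#
    -1≢1 e = 1≢0 (x≡-x⇒x≡0 1# (sym e))
    values : sumℤ (map ∑ monomials) ≡ pos q ℤ.+ (0ℤ ℤ.+ (0ℤ ℤ.+ (0ℤ ℤ.+ (1ℤ ℤ.+ (-1ℤ ℤ.+ (1ℤ ℤ.+ (1ℤ ℤ.+ (h₂ ℤ.+ (ℤ.- h₁ ℤ.+ (ℤ.- h₁ ℤ.+ (ℤ.- h₂ ℤ.+ (ℤ.- (h₃ ℤ.- 1ℤ) ℤ.+ ((h₁ ℤ.- 1ℤ) ℤ.+ ((h₂ ℤ.- 1ℤ) ℤ.+ (0ℤ ℤ.+ 0ℤ)))))))))))))))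
    values = cong₂ ℤ._+_ ∑-1 (cong₂ ℤ._+_ (neg (∑χ-shift (♯ 2))) (cong₂ ℤ._+_ (neg (∑χ-shift (- 1#))) (cong₂ ℤ._+_ (∑χ-shift 1#) (cong₂ ℤ._+_ (neg (∑χ[x²-D] (♯ 3) 3≢0))
      (cong₂ ℤ._+_ (∑χ[x-a][x-b] (♯ 2) (- 1#) 2≢-1) (cong₂ ℤ._+_ (neg (∑χ[x-a][x-b] (♯ 2) 1# 2≢1)) (cong₂ ℤ._+_ (neg (∑χ[x-a][x-b] (- 1#) 1# -1≢1))
      (cong₂ ℤ._+_ (mul₂ a d) (cong₂ ℤ._+_ (trans (mul₂ b d) ∑bd) (cong₂ ℤ._+_ (neg (mul₂ c d))
      (cong₂ ℤ._+_ (trans (mul₃ a b c) ∑abc) (cong₂ ℤ._+_ (neg (trans (mul₃ a b d) ∑abd)) (cong₂ ℤ._+_ (trans (mul₃ a c d) ∑acd) (cong₂ ℤ._+_ (trans (mul₃ b c d) ∑bcd)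
      (cong₂ ℤ._+_ (neg (trans (mul₄ a b c d) ∑abcd)) refl)))))))))))))))

  module _ (none : ∀ x → ¬ Good x) where

    -- Zeros of the four expressions cause no error. At s = 2 one has d = 1, at s = -1 one has c =
    -- -2, at s = 1 one has b = 2, and each of these annihilates another factor. If s² = 3, then bc
    -- = 2 is a square, so b cannot be a non-square while c is a square.
    weight≡0 : ∀ s → weight s ≡ 0ℤ
    weight≡0 s = go (classify (a s)) (classify (b s)) (classify (c s)) (classify (d s))
      where
      A B C D : ℤ
      A = χ (a s)
      B = χ (b s)
      C = χ (c s)
      D = χ (d s)
      vanish : ∀ {x y z w} → A ≡ x → B ≡ y → C ≡ z → D ≡ w → (1ℤ ℤ.- x) ℤ.* (1ℤ ℤ.- y) ℤ.* (1ℤ ℤ.+ z) ℤ.* (1ℤ ℤ.- w) ≡ 0ℤ → weight s ≡ 0ℤ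
      vanish refl refl refl refl e = e
      A1 : ∀ y z w → (1ℤ ℤ.- 1ℤ) ℤ.* (1ℤ ℤ.- y) ℤ.* (1ℤ ℤ.+ z) ℤ.* (1ℤ ℤ.- w) ≡ 0ℤ
      A1 = solve-∀
      B1 : ∀ x z w → (1ℤ ℤ.- x) ℤ.* (1ℤ ℤ.- 1ℤ) ℤ.* (1ℤ ℤ.+ z) ℤ.* (1ℤ ℤ.- w) ≡ 0ℤ
      B1 = solve-∀
      C-1 : ∀ x y w → (1ℤ ℤ.- x) ℤ.* (1ℤ ℤ.- y) ℤ.* (1ℤ ℤ.+ -1ℤ) ℤ.* (1ℤ ℤ.- w) ≡ 0ℤ
      C-1 = solve-∀
      D1 : ∀ x y z → (1ℤ ℤ.- x) ℤ.* (1ℤ ℤ.- y) ℤ.* (1ℤ ℤ.+ z) ℤ.* (1ℤ ℤ.- 1ℤ) ≡ 0ℤ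
      D1 = solve-∀
      go : Class (a s) → Class (b s) → Class (c s) → Class (d s) → weight s ≡ 0ℤ
      go (isSq _ _ _ _ e) _ _ _ = vanish e refl refl refl (A1 B C D)
      go _ (isSq _ _ _ _ e) _ _ = vanish refl e refl refl (B1 A C D)
      go _ _ (isNon _ _ e) _ = vanish refl refl e refl (C-1 A B D)
      go _ _ _ (isSq _ _ _ _ e) = vanish refl refl refl e (D1 A B C)
      go (isZero e _) _ _ _ = vanish refl refl refl
        (trans (cong χ (via (s + ♯ 2) (d s) 1# e (solve 1 (λ s → s :* s :- κ 3 :- κ 1 := (s :+ κ 2) :* (s :- κ 2 :- κ 0)) refl s))) χ-1) (D1 A B C)
      go _ (isZero e _) _ _ = vanish refl refl
        (trans (cong χ (via 1# (c s) (- ♯ 2) e (solve 1 (λ s → s :- κ 1 :- :- κ 2 := κ 1 :* (s :- :- κ 1 :- κ 0)) refl s))) (trans (χ-neg _) (cong ℤ.-_ χ-2))) refl (C-1 A B D)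
      go _ _ (isZero e _) _ = vanish refl
        (trans (cong χ (via 1# (b s) (♯ 2) e (solve 1 (λ s → s :- :- κ 1 :- κ 2 := κ 1 :* (s :- κ 1 :- κ 0)) refl s))) χ-2) refl refl (B1 A C D)
      go _ (isNon _ _ eb) (isSq _ _ _ _ ec) (isZero e _) = contradiction (trans (sym (trans (cong χ (via 1# (b s * c s) (♯ 2) e
        (solve 1 (λ s → (s :- :- κ 1) :* (s :- κ 1) :- κ 2 := κ 1 :* (s :* s :- κ 3 :- κ 0)) refl s))) χ-2)) (trans (χ-* _ _) (cong₂ ℤ._*_ eb ec))) λ ()
      go (isNon _ _ ea) (isNon _ _ eb) (isSq _ _ _ _ ec) (isNon _ _ ed) = contradiction
        ( ea
        , trans (cong χ (solve 1 (λ s → s :- κ 2 :+ κ 1 := s :- κ 1) refl s)) ec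
        , trans (cong χ (solve 1 (λ s → s :- κ 2 :+ κ 3 := s :- :- κ 1) refl s)) eb
        , trans (cong χ (solve 1 (λ s → (s :- κ 2) :* (s :- κ 2) :+ κ 4 :* (s :- κ 2) :+ κ 1 := s :* s :- κ 3) refl s)) ed)
        (none (s - ♯ 2))

    no-good⇒h-relation : h₁ ℤ.- h₂ ℤ.+ h₃ ≡ pos q ℤ.+ 1ℤ
    no-good⇒h-relation = sym (ℤₚ.i-j≡0⇒i≡j _ _ (trans (sym ∑weight) (∑-zero weight≡0)))

    -- Cauchy-Schwarz, made explicit: the weighted sum of squares exceeds (h₁ - h₂ + h₃)² = (q + 1)²
    -- by (h₃ - h₁ + h₂)² + 2(h₁ + h₂)².
    h-relation⇒⊥ : pos 4 ℤ.* (h₁ ℤ.* h₁) ℤ.+ pos 4 ℤ.* (h₂ ℤ.* h₂) ℤ.+ pos 2 ℤ.* (h₃ ℤ.* h₃) ℤ.+ 1ℤ ℤ.≤ pos q ℤ.* pos q → ⊥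
    h-relation⇒⊥ bound = ℤₚ.<⇒≱ (begin-strict
      pos q ℤ.* pos q   ≡⟨ sym (ℤₚ.pos-* q q) ⟩
      pos (q ℕ.* q)   <⟨ ℤ.+<+ (ℕₚ.*-mono-< (ℕₚ.n<1+n q) (ℕₚ.n<1+n q)) ⟩
      pos (suc q ℕ.* suc q)   ≡⟨ trans (ℤₚ.pos-* (suc q) (suc q)) (cong (λ z → z ℤ.* z) (ℤₚ.+-comm 1ℤ (pos q))) ⟩
      (pos q ℤ.+ 1ℤ) ℤ.* (pos q ℤ.+ 1ℤ)   ≡⟨ cong (λ z → z ℤ.* z) (sym no-good⇒h-relation) ⟩
      (h₁ ℤ.- h₂ ℤ.+ h₃) ℤ.* (h₁ ℤ.- h₂ ℤ.+ h₃)   ≡⟨ sym (ℤₚ.+-identityʳ _) ⟩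
      (h₁ ℤ.- h₂ ℤ.+ h₃) ℤ.* (h₁ ℤ.- h₂ ℤ.+ h₃) ℤ.+ 0ℤ   ≤⟨ ℤₚ.+-monoʳ-≤ ((h₁ ℤ.- h₂ ℤ.+ h₃) ℤ.* (h₁ ℤ.- h₂ ℤ.+ h₃)) (ℤₚ.+-mono-≤ (0≤i*i (h₃ ℤ.- h₁ ℤ.+ h₂)) (ℤₚ.+-mono-≤ (0≤i*i (h₁ ℤ.+ h₂)) (0≤i*i (h₁ ℤ.+ h₂)))) ⟩
      (h₁ ℤ.- h₂ ℤ.+ h₃) ℤ.* (h₁ ℤ.- h₂ ℤ.+ h₃) ℤ.+ ((h₃ ℤ.- h₁ ℤ.+ h₂) ℤ.* (h₃ ℤ.- h₁ ℤ.+ h₂) ℤ.+ ((h₁ ℤ.+ h₂) ℤ.* (h₁ ℤ.+ h₂) ℤ.+ (h₁ ℤ.+ h₂) ℤ.* (h₁ ℤ.+ h₂)))  ≡⟨ lem h₁ h₂ h₃ ⟩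
      pos 4 ℤ.* (h₁ ℤ.* h₁) ℤ.+ pos 4 ℤ.* (h₂ ℤ.* h₂) ℤ.+ pos 2 ℤ.* (h₃ ℤ.* h₃)   ≤⟨ ℤₚ.i≤i+j _ 1ℤ ⟩
      pos 4 ℤ.* (h₁ ℤ.* h₁) ℤ.+ pos 4 ℤ.* (h₂ ℤ.* h₂) ℤ.+ pos 2 ℤ.* (h₃ ℤ.* h₃) ℤ.+ 1ℤ   ∎) bound
      where
      open ℤₚ.≤-Reasoning
      lem : ∀ x y z → (x ℤ.- y ℤ.+ z) ℤ.* (x ℤ.- y ℤ.+ z) ℤ.+ ((z ℤ.- x ℤ.+ y) ℤ.* (z ℤ.- x ℤ.+ y) ℤ.+ ((x ℤ.+ y) ℤ.* (x ℤ.+ y) ℤ.+ (x ℤ.+ y) ℤ.* (x ℤ.+ y)))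
        ≡ pos 4 ℤ.* (x ℤ.* x) ℤ.+ pos 4 ℤ.* (y ℤ.* y) ℤ.+ pos 2 ℤ.* (z ℤ.* z)
      lem = solve-∀

-- Products and differences of numerals

module Numerals {q : ℕ} (F : FiniteField q) where
  open FiniteField F
  open FieldAlgebra F
  open QuadraticCharacter F

  ♯-* : ∀ m n → ♯ (m ℕ.* n) ≡ ♯ m * ♯ n
  ♯-* m n = trans (cong ι (ℤₚ.pos-* m n)) (ι-* (pos m) (pos n))

  ♯*-≢0 : ∀ m n → ♯ m ≢0 → ♯ n ≢0 → ♯ (m ℕ.* n) ≢0
  ♯*-≢0 m n m≢0 n≢0 e = *-≢0 m≢0 n≢0 (trans (sym (♯-* m n)) e)

  ι-≢ : ∀ i j → ι (i ℤ.- j) ≢0 → ι i ≢ ι j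
  ι-≢ i j n e = n (trans (ι-+ i (ℤ.- j)) (trans (cong (λ z → ι i + z) (ι-neg j)) (trans (cong (λ z → z - ι j) e) (-‿inverseʳ _))))

-- Characteristic different from 7: five values of λ for one D

module Generic {q : ℕ} (F : FiniteField q) (q≡7 : q ℕ.% 8 ≡ 7)
  (3≢0 : Invertible F 3) (5≢0 : Invertible F 5) (7≢0 : Invertible F 7) (11≢0 : Invertible F 11) (13≢0 : Invertible F 13)
  (37≢0 : Invertible F 37) (59≢0 : Invertible F 59) (83≢0 : Invertible F 83) (227≢0 : Invertible F 227) where
  open FiniteField F
  open FieldAlgebra F
  open FieldSums F
  open QuadraticCharacter F
  open Mod8 F q≡7
  open EllipticSums F q≡7
  open Differential F q≡7 3≢0 using (Good; χ-scale; 4≢0)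
  open Counting F q≡7 3≢0
  open Numerals F

  private
    9≢0 : ♯ 9 ≢0
    9≢0 = ♯*-≢0 3 3 3≢0 3≢0
    8≢0 : ♯ 8 ≢0
    8≢0 = ♯*-≢0 2 4 2≢0 4≢0
    16≢0 : ♯ 16 ≢0
    16≢0 = ♯*-≢0 4 4 4≢0 4≢0
    27≢0 : ♯ 27 ≢0
    27≢0 = ♯*-≢0 3 9 3≢0 9≢0
    6≢0 : ♯ 6 ≢0
    6≢0 = ♯*-≢0 2 3 2≢0 3≢0
    12≢0 : ♯ 12 ≢0
    12≢0 = ♯*-≢0 4 3 4≢0 3≢0
    18≢0 : ♯ 18 ≢0
    18≢0 = ♯*-≢0 2 9 2≢0 9≢0
    72≢0 : ♯ 72 ≢0
    72≢0 = ♯*-≢0 8 9 8≢0 9≢0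
    81≢0 : ♯ 81 ≢0
    81≢0 = ♯*-≢0 9 9 9≢0 9≢0

  square-of-multiple : ∀ {u x y} → u ≢0 → x ≡ χ u ℤ.* y → x ℤ.* x ≡ y ℤ.* y
  square-of-multiple {u} {y = y} u≢0 refl = trans (lem (χ u) y) (trans (cong (λ z → z ℤ.* (y ℤ.* y)) (χ² u≢0)) (ℤₚ.*-identityˡ _))
    where
    lem : ∀ a b → a ℤ.* b ℤ.* (a ℤ.* b) ≡ a ℤ.* a ℤ.* (b ℤ.* b)
    lem = solve-∀

  square-of-neg : ∀ {x y} → x ≡ ℤ.- y → x ℤ.* x ≡ y ℤ.* y
  square-of-neg {y = y} refl = lem y
    where
    lem : ∀ a → ℤ.- a ℤ.* ℤ.- a ≡ a ℤ.* a
    lem = solve-∀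

  h-cong : ∀ {D D′ l l′} → D ≡ D′ → l ≡ l′ → h D l ≡ h D′ l′
  h-cong refl refl = refl

  square : ℤ → ℤ
  square z = z ℤ.* z

  module _ (none : ∀ x → ¬ Good x) where

    -- h₁² occurs at l₃ and l₅, h₂² at l₁ and l₄, h₃² at l₂. Counting ±l, the multiplicities are 4,
    -- 4 and 2.
    conclude : ∀ D → D ≢0 → ∀ l₁ l₂ l₃ l₄ l₅ → All (_≢ 0#) (l₁ ∷ l₂ ∷ l₃ ∷ l₄ ∷ l₅ ∷ []) → AllPairs (λ x y → x * x ≢ y * y) (l₁ ∷ l₂ ∷ l₃ ∷ l₄ ∷ l₅ ∷ []) →
      square (h D l₁) ≡ square h₂ → square (h D l₂) ≡ square h₃ → square (h D l₃) ≡ square h₁ → square (h D l₄) ≡ square h₂ → square (h D l₅) ≡ square h₁ → ⊥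
    conclude D D≢0 l₁ l₂ l₃ l₄ l₅ nonzero distinct e₁ e₂ e₃ e₄ e₅ = h-relation⇒⊥ none (ℤₚ.≤-trans (ℤₚ.≤-reflexive (begin
      pos 4 ℤ.* square h₁ ℤ.+ pos 4 ℤ.* square h₂ ℤ.+ pos 2 ℤ.* square h₃ ℤ.+ 1ℤ   ≡⟨ lem (square h₁) (square h₂) (square h₃) ⟩
      pos 2 ℤ.* (square h₂ ℤ.+ (square h₃ ℤ.+ (square h₁ ℤ.+ (square h₂ ℤ.+ (square h₁ ℤ.+ 0ℤ))))) ℤ.+ 1ℤ   ≡⟨ cong (λ z → pos 2 ℤ.* z ℤ.+ 1ℤ) (sym (cong₂ ℤ._+_ e₁ (cong₂ ℤ._+_ e₂ (cong₂ ℤ._+_ e₃ (cong₂ ℤ._+_ e₄ (cong₂ ℤ._+_ e₅ refl)))))) ⟩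
      pos 2 ℤ.* sumℤ (map (λ l → h D l ℤ.* h D l) (l₁ ∷ l₂ ∷ l₃ ∷ l₄ ∷ l₅ ∷ [])) ℤ.+ 1ℤ   ∎))
      (h-list-bound D D≢0 _ nonzero distinct))
      where
      open ≡-Reasoning
      lem : ∀ a b c → pos 4 ℤ.* a ℤ.+ pos 4 ℤ.* b ℤ.+ pos 2 ℤ.* c ℤ.+ 1ℤ ≡ pos 2 ℤ.* (b ℤ.+ (c ℤ.+ (a ℤ.+ (b ℤ.+ (a ℤ.+ 0ℤ))))) ℤ.+ 1ℤ
      lem = solve-∀

    -- If 3 is a non-square, then -6 = z² is a square. Scaling by 12 takes D = 3 to 432 and 2, 5/3,
    -- 1 to 24, 20, 12. Scaling by 3z and 6z takes -8 and -2 to 432 as well, and h(-8,1), h(-2,1)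
    -- are ±h₂, ±h₁ by isogenies.
    χ3≢-1 : χ (♯ 3) ≢ -1ℤ
    χ3≢-1 χ3≡-1 with χ≡1⇒square { - ♯ 6} (trans (χ-neg _) (cong ℤ.-_ (trans (cong χ (♯-* 2 3)) (trans (χ-* _ _) (cong₂ ℤ._*_ χ-2 χ3≡-1)))))
    ... | z , z≢0 , zz = conclude (♯ 432) (♯*-≢0 16 27 16≢0 27≢0) (♯ 24) (♯ 20) (♯ 12) (♯ 3 * z) (♯ 6 * z)
      (♯*-≢0 8 3 8≢0 3≢0 ∷ ♯*-≢0 4 5 4≢0 5≢0 ∷ 12≢0 ∷ *-≢0 3≢0 z≢0 ∷ *-≢0 6≢0 z≢0 ∷ [])
      -- The squares of the five values are 576, 400, 144, -54, -216. Every difference is given in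
      -- factorised form; this is the source of the primes 5, 7, 11 and 227.
      ( (differ 576 400 s₁ s₂ (♯*-≢0 16 11 16≢0 11≢0) ∷ differ 576 144 s₁ s₃ (♯*-≢0 16 27 16≢0 27≢0) ∷ differ⁻ 576 54 s₁ s₄ (♯*-≢0 18 35 18≢0 35≢0) ∷ differ⁻ 576 216 s₁ s₅ (♯*-≢0 72 11 72≢0 11≢0) ∷ [])
      ∷ (differ 400 144 s₂ s₃ (♯*-≢0 16 16 16≢0 16≢0) ∷ differ⁻ 400 54 s₂ s₄ (♯*-≢0 2 227 2≢0 227≢0) ∷ differ⁻ 400 216 s₂ s₅ (♯*-≢0 8 77 8≢0 77≢0) ∷ [])
      ∷ (differ⁻ 144 54 s₃ s₄ (♯*-≢0 18 11 18≢0 11≢0) ∷ differ⁻ 144 216 s₃ s₅ (♯*-≢0 72 5 72≢0 5≢0) ∷ [])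
      ∷ (differ⁻⁻ 54 216 s₄ s₅ (♯*-≢0 2 81 2≢0 81≢0) ∷ [])
      ∷ [] ∷ [])
      (square-of-multiple 12≢0 (trans (h-cong (solve 0 (κ 432 := κ 12 :* κ 12 :* κ 3) refl) (solve 0 (κ 24 := κ 12 :* κ 2) refl)) (h-scale (♯ 12) (♯ 3) (♯ 2) 12≢0)))
      (cong square (trans (∑-scale (♯ 12) 12≢0 _) (∑-cong λ x → trans (cong χ (solve 1 (λ x → (κ 12 :* x :- κ 20) :* (κ 12 :* x :* (κ 12 :* x) :- κ 432) := κ 24 :* κ 24 :* ((κ 3 :* x :- κ 5) :* (x :* x :- κ 3))) refl x)) (χ-square-* (♯ 24) _ (♯*-≢0 8 3 8≢0 3≢0)))))
      (square-of-multiple 12≢0 (trans (h-cong (solve 0 (κ 432 := κ 12 :* κ 12 :* κ 3) refl) (solve 0 (κ 12 := κ 12 :* κ 1) refl)) (h-scale (♯ 12) (♯ 3) 1# 12≢0)))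
      (trans (square-of-multiple (*-≢0 3≢0 z≢0) (trans (h-cong (via (♯ 72) _ _ zz (solve 1 (λ z → κ 432 :- κ 3 :* z :* (κ 3 :* z) :* :- κ 8 := κ 72 :* (z :* z :- :- κ 6)) refl z)) (sym (*-identityʳ _))) (h-scale (♯ 3 * z) (- ♯ 8) 1# (*-≢0 3≢0 z≢0)))) (cong square h[-8,1]))
      (trans (square-of-multiple (*-≢0 6≢0 z≢0) (trans (h-cong (via (♯ 72) _ _ zz (solve 1 (λ z → κ 432 :- κ 6 :* z :* (κ 6 :* z) :* :- κ 2 := κ 72 :* (z :* z :- :- κ 6)) refl z)) (sym (*-identityʳ _))) (h-scale (♯ 6 * z) (- ♯ 2) 1# (*-≢0 6≢0 z≢0)))) (square-of-neg h[-2,1]))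
      where
      35≢0 : ♯ 35 ≢0
      35≢0 = ♯*-≢0 5 7 5≢0 7≢0
      77≢0 : ♯ 77 ≢0
      77≢0 = ♯*-≢0 7 11 7≢0 11≢0
      s₁ : ♯ 24 * ♯ 24 ≡ ♯ 576
      s₁ = sym (♯-* 24 24)
      s₂ : ♯ 20 * ♯ 20 ≡ ♯ 400
      s₂ = sym (♯-* 20 20)
      s₃ : ♯ 12 * ♯ 12 ≡ ♯ 144
      s₃ = sym (♯-* 12 12)
      s₄ : ♯ 3 * z * (♯ 3 * z) ≡ - ♯ 54
      s₄ = via (♯ 9) _ _ zz (solve 1 (λ z → κ 3 :* z :* (κ 3 :* z) :- :- κ 54 := κ 9 :* (z :* z :- :- κ 6)) refl z)
      s₅ : ♯ 6 * z * (♯ 6 * z) ≡ - ♯ 216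
      s₅ = via (♯ 36) _ _ zz (solve 1 (λ z → κ 6 :* z :* (κ 6 :* z) :- :- κ 216 := κ 36 :* (z :* z :- :- κ 6)) refl z)
      differ : ∀ m n {x y} → x ≡ ♯ m → y ≡ ♯ n → ι (pos m ℤ.- pos n) ≢0 → x ≢ y
      differ m n e e′ k p = ι-≢ (pos m) (pos n) k (trans (sym e) (trans p e′))
      differ⁻ : ∀ m n {x y} → x ≡ ♯ m → y ≡ - ♯ n → ι (pos m ℤ.- (ℤ.- pos n)) ≢0 → x ≢ y
      differ⁻ m n e e′ k p = ι-≢ (pos m) (ℤ.- pos n) k (trans (sym e) (trans p (trans e′ (sym (ι-neg (pos n))))))
      differ⁻⁻ : ∀ m n {x y} → x ≡ - ♯ m → y ≡ - ♯ n → ι ((ℤ.- pos m) ℤ.- (ℤ.- pos n)) ≢0 → x ≢ y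
      differ⁻⁻ m n e e′ k p = ι-≢ (ℤ.- pos m) (ℤ.- pos n) k (trans (trans (ι-neg (pos m)) (sym e)) (trans p (trans e′ (sym (ι-neg (pos n))))))
      h[-2,1] : h (- ♯ 2) 1# ≡ ℤ.- h₁
      h[-2,1] = trans (h-isogeny (- ♯ 2) 1# (λ e → 3≢0 (trans (solve 0 (κ 3 := κ 1 :* κ 1 :- :- κ 2) refl) e)))
        (trans (h-cong (solve 0 (κ 1 :* κ 1 :- :- κ 2 := κ 3) refl) refl) (h-odd (♯ 3) 1#))
      -- x = 2y - 1 carries the roots 2, 1, -1 to 3, 1, -3: the distinguished point of order 2
      -- changes from 3 to 1.
      h[9,1] : h (♯ 9) 1# ≡ h 1# (♯ 2)
      h[9,1] = trans (∑-shift (- 1#) _) (trans (∑-scale (♯ 2) 2≢0 _) (∑-cong λ y → trans (cong χ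
        (solve 1 (λ y → (κ 2 :* y :- κ 1 :- κ 1) :* ((κ 2 :* y :- κ 1) :* (κ 2 :* y :- κ 1) :- κ 9) := κ 2 :* κ 2 :* (κ 2 :* ((y :- κ 2) :* (y :* y :- κ 1)))) refl y))
        (trans (χ-square-* (♯ 2) _ 2≢0) (χ-scale (♯ 2) _ χ-2))))
      h[-8,1] : h (- ♯ 8) 1# ≡ h₂
      h[-8,1] = trans (h-isogeny (- ♯ 8) 1# (λ e → 9≢0 (trans (solve 0 (κ 9 := κ 1 :* κ 1 :- :- κ 8) refl) e)))
        (trans (h-cong (solve 0 (κ 1 :* κ 1 :- :- κ 8 := κ 9) refl) refl) (trans (h-odd (♯ 9) 1#) (trans (cong ℤ.-_ (trans h[9,1] h-1-2)) (ℤₚ.neg-involutive h₂))))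

    -- Scaling by 3 takes D = 3 to 27 and 2, 5/3, 1 to 6, 5, 3. Since 27 = (3r)², scaling h(1,2) by
    -- 3r gives λ = 6r, a second value for h₂. As x² - 3 splits, another root can be distinguished,
    -- and λ = 15r - 18 is a second value for h₁. The last hypothesis says that (15r - 18)² = 999 -
    -- 540r differs from 5².
    χ3≢1′ : ∀ r → r ≢0 → r * r ≡ ♯ 3 → ♯ 974 - ♯ 540 * r ≢0 → ⊥
    χ3≢1′ r r≢0 rr 974≢540r = conclude (♯ 27) 27≢0 (♯ 6) (♯ 5) (♯ 3) (♯ 6 * r) (♯ 15 * r - ♯ 18)
      (6≢0 ∷ 5≢0 ∷ 3≢0 ∷ *-≢0 6≢0 r≢0 ∷ l≢0 ∷ [])
      ( (differ 36 25 s₁ s₂ 11≢0 ∷ differ 36 9 s₁ s₃ 27≢0 ∷ (differ 108 36 s₄ s₁ 72≢0 ∘ sym) ∷ (differʳ 36 963 refl (♯*-≢0 81 649 81≢0 649≢0) s₁ ∘ sym) ∷ [])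
      ∷ (differ 25 9 s₂ s₃ 16≢0 ∷ (differ 108 25 s₄ s₂ 83≢0 ∘ sym) ∷ (λ e → 974≢540r (via (- 1#) _ _ (trans (sym s₂) (trans e s₅)) (solve 1 (λ r → κ 974 :- κ 540 :* r :- κ 0 := :- κ 1 :* (κ 25 :- (κ 999 :- κ 540 :* r))) refl r))) ∷ [])
      ∷ ((differ 108 9 s₄ s₃ (♯*-≢0 9 11 9≢0 11≢0) ∘ sym) ∷ (differʳ 9 990 refl (♯*-≢0 8100 13 8100≢0 13≢0) s₃ ∘ sym) ∷ [])
      ∷ ((differʳ 108 891 refl (♯≢0⇒neg 80919 (♯*-≢0 2187 37 2187≢0 37≢0)) s₄ ∘ sym) ∷ [])
      ∷ [] ∷ [])
      (square-of-multiple 3≢0 (trans (h-cong (solve 0 (κ 27 := κ 3 :* κ 3 :* κ 3) refl) (solve 0 (κ 6 := κ 3 :* κ 2) refl)) (h-scale (♯ 3) (♯ 3) (♯ 2) 3≢0)))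
      (cong square (trans (∑-scale (♯ 3) 3≢0 _) (∑-cong λ x → trans (cong χ (solve 1 (λ x → (κ 3 :* x :- κ 5) :* (κ 3 :* x :* (κ 3 :* x) :- κ 27) := κ 3 :* κ 3 :* ((κ 3 :* x :- κ 5) :* (x :* x :- κ 3))) refl x)) (χ-square-* (♯ 3) _ 3≢0))))
      (square-of-multiple 3≢0 (trans (h-cong (solve 0 (κ 27 := κ 3 :* κ 3 :* κ 3) refl) (solve 0 (κ 3 := κ 3 :* κ 1) refl)) (h-scale (♯ 3) (♯ 3) 1# 3≢0)))
      (trans (square-of-multiple (*-≢0 3≢0 r≢0) (trans (h-cong (via (- ♯ 9) _ _ rr (solve 1 (λ r → κ 27 :- κ 3 :* r :* (κ 3 :* r) :* κ 1 := :- κ 9 :* (r :* r :- κ 3)) refl r)) (solve 1 (λ r → κ 6 :* r := κ 3 :* r :* κ 2) refl r)) (h-scale (♯ 3 * r) 1# (♯ 2) (*-≢0 3≢0 r≢0)))) (square-of-neg h-1-2))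
      (square-of-multiple u≢0 third-root)
      where
      649≢0 : ♯ 649 ≢0
      649≢0 = ♯*-≢0 11 59 11≢0 59≢0
      8100≢0 : ♯ 8100 ≢0
      8100≢0 = ♯*-≢0 324 25 (♯*-≢0 4 81 4≢0 81≢0) (♯*-≢0 5 5 5≢0 5≢0)
      2187≢0 : ♯ 2187 ≢0
      2187≢0 = ♯*-≢0 27 81 27≢0 81≢0
      ♯≢0⇒neg : ∀ n → ♯ n ≢0 → ι (ℤ.- pos n) ≢0
      ♯≢0⇒neg n n≢0 e = neg-≢0 n≢0 (trans (sym (ι-neg (pos n))) e)
      s₁ : ♯ 6 * ♯ 6 ≡ ♯ 36
      s₁ = sym (♯-* 6 6)
      s₂ : ♯ 5 * ♯ 5 ≡ ♯ 25
      s₂ = sym (♯-* 5 5)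
      s₃ : ♯ 3 * ♯ 3 ≡ ♯ 9
      s₃ = sym (♯-* 3 3)
      s₄ : ♯ 6 * r * (♯ 6 * r) ≡ ♯ 108
      s₄ = via (♯ 36) _ _ rr (solve 1 (λ r → κ 6 :* r :* (κ 6 :* r) :- κ 108 := κ 36 :* (r :* r :- κ 3)) refl r)
      s₅ : (♯ 15 * r - ♯ 18) * (♯ 15 * r - ♯ 18) ≡ ♯ 999 - ♯ 540 * r
      s₅ = via (♯ 225) _ _ rr (solve 1 (λ r → (κ 15 :* r :- κ 18) :* (κ 15 :* r :- κ 18) :- (κ 999 :- κ 540 :* r) := κ 225 :* (r :* r :- κ 3)) refl r)
      differ : ∀ m n {x y} → x ≡ ♯ m → y ≡ ♯ n → ι (pos m ℤ.- pos n) ≢0 → x ≢ y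
      differ m n e e′ k p = ι-≢ (pos m) (pos n) k (trans (sym e) (trans p e′))
      -- An equation k = 540r is tested by its norm: it implies k² = 540² · 3 = 874800. The
      -- resulting integers bring in the primes 13, 37 and 59.
      norm : ∀ k → ♯ k ≡ ♯ 540 * r → ι (pos k ℤ.* pos k ℤ.- pos 874800) ≡ 0#
      norm k e = trans (ι-+ (pos k ℤ.* pos k) (ℤ.- pos 874800)) (trans (cong₂ _+_ (ι-* (pos k) (pos k)) (ι-neg (pos 874800)))
        (trans (cong (λ z → z * z - ♯ 874800) e) (via (♯ 291600) _ _ rr (solve 1 (λ r → κ 540 :* r :* (κ 540 :* r) :- κ 874800 :- κ 0 := κ 291600 :* (r :* r :- κ 3)) refl r))))
      differʳ : ∀ m k {y} → m ℕ.+ k ≡ 999 → ι (pos k ℤ.* pos k ℤ.- pos 874800) ≢0 → y ≡ ♯ m → (♯ 15 * r - ♯ 18) * (♯ 15 * r - ♯ 18) ≢ y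
      differʳ m k {y} m+k n e p = n (norm k (x-y≡0⇒x≡y _ _ (begin
        ♯ k - ♯ 540 * r   ≡⟨ solve 3 (λ m k s → k :- s := m :+ k :- s :- m) refl (♯ m) (♯ k) (♯ 540 * r) ⟩
        ♯ m + ♯ k - ♯ 540 * r - ♯ m   ≡⟨ cong (λ z → z - ♯ 540 * r - ♯ m) (trans (sym (ι-+ (pos m) (pos k))) (cong ♯_ m+k)) ⟩
        ♯ 999 - ♯ 540 * r - ♯ m   ≡⟨ cong (λ z → z - ♯ m) (trans (sym s₅) (trans p e)) ⟩
        ♯ m - ♯ m   ≡⟨ -‿inverseʳ _ ⟩
        0#   ∎)))
        where open ≡-Reasoning
      l≢0 : ♯ 15 * r - ♯ 18 ≢0
      l≢0 e = ♯*-≢0 27 13 27≢0 13≢0 (begin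
        ♯ 351   ≡⟨ via (- ♯ 225) _ _ rr (solve 1 (λ r → κ 351 :- (κ 15 :* r :- κ 18) :* (κ 15 :* r :+ κ 18) := :- κ 225 :* (r :* r :- κ 3)) refl r) ⟩
        (♯ 15 * r - ♯ 18) * (♯ 15 * r + ♯ 18)         ≡⟨ cong (λ z → z * (♯ 15 * r + ♯ 18)) e ⟩
        0# * (♯ 15 * r + ♯ 18)   ≡⟨ zeroˡ _ ⟩
        0#   ∎)
        where open ≡-Reasoning
      u : Carrier
      u = ♯ 9 - ♯ 3 * r
      u≢0 : u ≢0
      u≢0 e = ♯*-≢0 2 27 2≢0 27≢0 (begin
        ♯ 54   ≡⟨ via (♯ 9) _ _ rr (solve 1 (λ r → κ 54 :- (κ 9 :- κ 3 :* r) :* (κ 9 :+ κ 3 :* r) := κ 9 :* (r :* r :- κ 3)) refl r) ⟩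
        u * (♯ 9 + ♯ 3 * r)   ≡⟨ cong (λ z → z * (♯ 9 + ♯ 3 * r)) e ⟩
        0# * (♯ 9 + ♯ 3 * r)   ≡⟨ zeroˡ _ ⟩
        0#   ∎)
        where open ≡-Reasoning
      -- x ↦ (9 - 3r) x + (6r - 9) maps the roots r, 1, -r to 15r - 18, 3r, -3r.
      third-root : h (♯ 27) (♯ 15 * r - ♯ 18) ≡ χ u ℤ.* h₁
      third-root = trans (∑-shift (♯ 6 * r - ♯ 9) _) (trans (∑-scale u u≢0 _) (trans (∑-cong λ x → trans (cong χ (identity x)) (trans (χ-square-* u _ u≢0) (χ-* u _))) (∑-*ˡ (χ u) _)))
        where
        identity : ∀ x → (u * x + (♯ 6 * r - ♯ 9) - (♯ 15 * r - ♯ 18)) * ((u * x + (♯ 6 * r - ♯ 9)) * (u * x + (♯ 6 * r - ♯ 9)) - ♯ 27) ≡ u * u * (u * ((x - 1#) * (x * x - ♯ 3)))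
        identity x = begin
          (y - (♯ 15 * r - ♯ 18)) * (y * y - ♯ 27)   ≡⟨ cong₂ _*_ f₁ (trans f₂ (cong₂ _*_ f₃ f₄)) ⟩
          u * (x - r) * (u * (x - 1#) * (u * (x + r)))   ≡⟨ solve 3 (λ u x r → u :* (x :- r) :* (u :* (x :- κ 1) :* (u :* (x :+ r))) := u :* u :* (u :* ((x :- κ 1) :* (x :* x :- r :* r)))) refl u x r ⟩
          u * u * (u * ((x - 1#) * (x * x - r * r)))   ≡⟨ cong (λ z → u * u * (u * ((x - 1#) * (x * x - z)))) rr ⟩
          u * u * (u * ((x - 1#) * (x * x - ♯ 3)))   ∎
          where
          open ≡-Reasoning
          y : Carrier
          y = u * x + (♯ 6 * r - ♯ 9)
          f₁ : y - (♯ 15 * r - ♯ 18) ≡ u * (x - r)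
          f₁ = via (- ♯ 3) _ _ rr (solve 2 (λ x r → (κ 9 :- κ 3 :* r) :* x :+ (κ 6 :* r :- κ 9) :- (κ 15 :* r :- κ 18) :- (κ 9 :- κ 3 :* r) :* (x :- r) := :- κ 3 :* (r :* r :- κ 3)) refl x r)
          f₂ : y * y - ♯ 27 ≡ (y - ♯ 3 * r) * (y + ♯ 3 * r)
          f₂ = via (♯ 9) _ _ rr (solve 2 (λ y r → y :* y :- κ 27 :- (y :- κ 3 :* r) :* (y :+ κ 3 :* r) := κ 9 :* (r :* r :- κ 3)) refl y r)
          f₃ : y - ♯ 3 * r ≡ u * (x - 1#)
          f₃ = solve 2 (λ x r → (κ 9 :- κ 3 :* r) :* x :+ (κ 6 :* r :- κ 9) :- κ 3 :* r := (κ 9 :- κ 3 :* r) :* (x :- κ 1)) refl x r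
          f₄ : y + ♯ 3 * r ≡ u * (x + r)
          f₄ = via (♯ 3) _ _ rr (solve 2 (λ x r → (κ 9 :- κ 3 :* r) :* x :+ (κ 6 :* r :- κ 9) :+ κ 3 :* r :- (κ 9 :- κ 3 :* r) :* (x :+ r) := κ 3 :* (r :* r :- κ 3)) refl x r)

    -- In characteristic 23 one of the two square roots of 3 satisfies 540 r = 974, so the other one has to be chosen.
    χ3≢1 : χ (♯ 3) ≢ 1ℤ
    χ3≢1 χ3 with χ≡1⇒square χ3
    ... | r , r≢0 , rr with (♯ 974 - ♯ 540 * r) ≟ 0#
    ...   | no n = χ3≢1′ r r≢0 rr n
    ...   | yes e = χ3≢1′ (- r) (neg-≢0 r≢0) (trans (solve 1 (λ r → :- r :* :- r := r :* r) refl r) rr) λ e′ →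
      *-≢0 (♯*-≢0 8 135 8≢0 (♯*-≢0 27 5 27≢0 5≢0)) r≢0 (trans (solve 1 (λ r → κ 1080 :* r := (κ 974 :- κ 540 :* :- r) :- (κ 974 :- κ 540 :* r)) refl r) (trans (cong₂ _-_ e′ e) (-‿inverseʳ 0#)))

    contradiction-generic : ⊥
    contradiction-generic with classify (♯ 3)
    ... | isZero e _ = 3≢0 e
    ... | isSq _ _ _ _ e = χ3≢1 e
    ... | isNon _ _ e = χ3≢-1 e

-- Sign vectors over 𝔽₇: a finite verification

sgn : Bool → ℤ
sgn true = 1ℤ
sgn false = -1ℤ

infixl 7 _⊛_
_⊛_ : Bool → Bool → Bool
true ⊛ b = b
false ⊛ b = not b

sgn-⊛ : ∀ a b → sgn (a ⊛ b) ≡ sgn a ℤ.* sgn b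
sgn-⊛ true true = refl
sgn-⊛ true false = refl
sgn-⊛ false true = refl
sgn-⊛ false false = refl

-- Indices past the end return the last entry. This default is harmless: the indices used are
-- residues mod 7 in vectors of length 7.
at : ∀ {n} → Vec Bool (suc n) → ℕ → Bool
at (b ∷ _) zero = b
at (b ∷ []) (suc _) = b
at (_ ∷ bs@(_ ∷ _)) (suc i) = at bs i

∀vec? : ∀ n {P : Vec Bool n → Set} → (∀ v → Dec (P v)) → Dec (∀ v → P v)
∀vec? zero P? = map′ (λ { p [] → p }) (λ p → p []) (P? [])
∀vec? (suc n) P? = map′ (λ { (p , q) (true ∷ v) → p v ; (p , q) (false ∷ v) → q v }) (λ p → (λ v → p (true ∷ v)) , (λ v → p (false ∷ v)))
  (∀vec? n (λ v → P? (true ∷ v)) ×-dec ∀vec? n (λ v → P? (false ∷ v)))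

-- Among the 128 sign vectors, exactly 16 are zeros of this form: those that look as if s were infinitely close to
-- ∞ or to a point j of 𝔽₇, that is, constant ones and those with wᵢ = χ(j - i) for all i ≠ j.
excess : Vec ℤ 7 → ℤ
excess (w₀ ∷ w₁ ∷ w₂ ∷ w₃ ∷ w₄ ∷ w₅ ∷ w₆ ∷ []) =
  pos 6 ℤ.*
    (w₁ ℤ.* w₂ ℤ.* w₄ ℤ.+ (w₂ ℤ.* w₃ ℤ.* w₅ ℤ.+ (w₃ ℤ.* w₄ ℤ.* w₆ ℤ.+ (w₄ ℤ.* w₅ ℤ.* w₀ ℤ.+ (w₅ ℤ.* w₆ ℤ.* w₁ ℤ.+ (w₆ ℤ.* w₀ ℤ.* w₂ ℤ.+ (w₀ ℤ.* w₁ ℤ.* w₃ ℤ.+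
    (ℤ.- (w₃ ℤ.* w₅ ℤ.* w₆) ℤ.+ (ℤ.- (w₄ ℤ.* w₆ ℤ.* w₀) ℤ.+ (ℤ.- (w₅ ℤ.* w₀ ℤ.* w₁) ℤ.+ (ℤ.- (w₆ ℤ.* w₁ ℤ.* w₂) ℤ.+ (ℤ.- (w₀ ℤ.* w₂ ℤ.* w₃) ℤ.+ (ℤ.- (w₁ ℤ.* w₃ ℤ.* w₄) ℤ.+ (ℤ.- (w₂ ℤ.* w₄ ℤ.* w₅) ℤ.+ 0ℤ))))))))))))))
  ℤ.+ (ℤ.- ((w₀ ℤ.+ (w₁ ℤ.+ (w₂ ℤ.+ (w₃ ℤ.+ (w₄ ℤ.+ (w₅ ℤ.+ (w₆ ℤ.+ 0ℤ))))))) ℤ.* (w₀ ℤ.+ (w₁ ℤ.+ (w₂ ℤ.+ (w₃ ℤ.+ (w₄ ℤ.+ (w₅ ℤ.+ (w₆ ℤ.+ 0ℤ)))))))) ℤ.+ pos 49)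

residue₇ : ℕ → Bool
residue₇ 1 = true
residue₇ 2 = true
residue₇ 4 = true
residue₇ _ = false

legendre₇ : ℕ → ℤ
legendre₇ zero = 0ℤ
legendre₇ n@(suc _) = sgn (residue₇ n)

-- The solution j of u j + t + i = 0 in 𝔽₇, by u⁻¹ = u⁵.
root₇ : ℕ → ℕ → ℕ → ℕ
root₇ u t i = (6 ℕ.* (t ℕ.+ i) ℕ.* (u ℕ.^ 5)) ℕ.% 7

-- The sign of χ(us + t + i), given the signs of the χ(s - j).
signAt : Vec Bool 7 → ℕ → ℕ → ℕ → Bool
signAt v u t i = residue₇ (u ℕ.% 7) ⊛ at v (root₇ u t i)

-- Here w i stands for the sign of χ(y + i). Either pattern gives two points X/Y, with X and Y
-- linear in y, that both satisfy the linear conditions of `Good`, while their values of X² + 4XY +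
-- Y² are negatives of each other mod 7. One of these values is then a non-square.
PatternI PatternII : (ℕ → Bool) → Set
PatternI w = w 0 ≡ false × w 1 ≡ true × w 3 ≡ false × w 2 ≡ w 6 × w 4 ≡ not (w 6) × w 5 ≡ not (w 6)
PatternII w = w 1 ≡ true × w 3 ≡ true × w 4 ≡ false × w 2 ≡ w 0 × w 5 ≡ w 0 × w 6 ≡ w 0

patternI? : ∀ w → Dec (PatternI w)
patternI? w = w 0 Boolₚ.≟ false ×-dec w 1 Boolₚ.≟ true ×-dec w 3 Boolₚ.≟ false ×-dec w 2 Boolₚ.≟ w 6 ×-dec w 4 Boolₚ.≟ not (w 6) ×-dec w 5 Boolₚ.≟ not (w 6)

patternII? : ∀ w → Dec (PatternII w)
patternII? w = w 1 Boolₚ.≟ true ×-dec w 3 Boolₚ.≟ true ×-dec w 4 Boolₚ.≟ false ×-dec w 2 Boolₚ.≟ w 0 ×-dec w 5 Boolₚ.≟ w 0 ×-dec w 6 Boolₚ.≟ w 0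

-- As 6 = -1 mod 7, the congruence says u⁶ = 1, that is, u ≠ 0 in 𝔽₇. In this form it carries over
-- to the field as a polynomial identity that makes u⁵ the inverse of u.
Affine : Vec Bool 7 → ℕ × ℕ → Set
Affine v (u , t) = (6 ℕ.* u ℕ.^ 6 ℕ.+ 1) ℕ.% 7 ≡ 0 × (PatternI (signAt v u t) ⊎ PatternII (signAt v u t))

affine? : ∀ v ut → Dec (Affine v ut)
affine? v (u , t) = ((6 ℕ.* u ℕ.^ 6 ℕ.+ 1) ℕ.% 7 ℕ.≟ 0) ×-dec (patternI? (signAt v u t) ⊎-dec patternII? (signAt v u t))

abstract
  -- Exhaustive check of the 128 sign vectors: whenever `excess` is nonzero, some substitution y =
  -- us + t over 𝔽₇ makes the signs follow a pattern.
  excess-or-pattern : ∀ v → excess (Vec.map sgn v) ≡ 0ℤ ⊎ Any (Affine v) (cartesianProduct (upTo 7) (upTo 7))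
  excess-or-pattern = from-yes (∀vec? 7 λ v → (excess (Vec.map sgn v) ℤ.≟ 0ℤ) ⊎-dec any? (affine? v) (cartesianProduct (upTo 7) (upTo 7)))

-- Characteristic 7: the sum of χ(s³ - 1) estimated from both sides

module Characteristic7 {q : ℕ} (F : FiniteField q) (q≡7 : q ℕ.% 8 ≡ 7)
  (7≡0 : FieldAlgebra.♯_ F 7 ≡ FiniteField.0# F) (3≢0 : Invertible F 3) where
  open FiniteField F
  open FieldAlgebra F
  open FieldSums F
  open QuadraticCharacter F
  open Mod8 F q≡7
  open EllipticSums F q≡7
  open Differential F q≡7 3≢0 using (Good; χ-scale; 4≢0; χ-4*; ¬Non-square)
  open Numerals F

  mod7 : ∀ k l r → l - r ≡ k * ♯ 7 → l ≡ r
  mod7 k l r e = x-y≡0⇒x≡y l r (trans e (trans (cong (λ z → k * z) 7≡0) (zeroʳ k)))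

  ♯-% : ∀ n → ♯ n ≡ ♯ (n ℕ.% 7)
  ♯-% n = begin
    ♯ n   ≡⟨ cong ♯_ (ℕ-DivMod.m≡m%n+[m/n]*n n 7) ⟩
    ♯ (n ℕ.% 7 ℕ.+ n ℕ./ 7 ℕ.* 7)   ≡⟨ ι-+ (pos (n ℕ.% 7)) (pos (n ℕ./ 7 ℕ.* 7)) ⟩
    ♯ (n ℕ.% 7) + ♯ (n ℕ./ 7 ℕ.* 7)   ≡⟨ cong (λ z → ♯ (n ℕ.% 7) + z) (trans (♯-* (n ℕ./ 7) 7) (trans (cong (λ z → ♯ (n ℕ./ 7) * z) 7≡0) (zeroʳ _))) ⟩
    ♯ (n ℕ.% 7) + 0#   ≡⟨ +-identityʳ _ ⟩
    ♯ (n ℕ.% 7)   ∎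
    where open ≡-Reasoning

  private
    χ-3 : χ (♯ 3) ≡ -1ℤ
    χ-3 = trans (cong χ (mod7 1# (♯ 3) (- (♯ 2 * ♯ 2)) (solve 0 (κ 3 :- :- (κ 2 :* κ 2) := κ 1 :* κ 7) refl))) (trans (χ-neg _) (cong ℤ.-_ (χ-square (♯ 2) 2≢0)))

  χ-♯<7 : ∀ n → n ℕ.< 7 → χ (♯ n) ≡ legendre₇ n
  χ-♯<7 0 _ = χ-0
  χ-♯<7 1 _ = χ-1
  χ-♯<7 2 _ = χ-2
  χ-♯<7 3 _ = χ-3
  χ-♯<7 4 _ = trans (cong χ (♯-* 2 2)) (χ-square (♯ 2) 2≢0)
  χ-♯<7 5 _ = trans (cong χ (mod7 1# (♯ 5) (- ♯ 2) (solve 0 (κ 5 :- :- κ 2 := κ 1 :* κ 7) refl))) (trans (χ-neg _) (cong ℤ.-_ χ-2))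
  χ-♯<7 6 _ = trans (cong χ (mod7 1# (♯ 6) (- 1#) (solve 0 (κ 6 :- :- κ 1 := κ 1 :* κ 7) refl))) χ-neg1
  χ-♯<7 (suc (suc (suc (suc (suc (suc (suc n))))))) lt = contradiction lt (ℕₚ.≤⇒≯ (ℕₚ.m≤m+n 7 n))

  χ-♯ : ∀ n → χ (♯ n) ≡ legendre₇ (n ℕ.% 7)
  χ-♯ n = trans (cong χ (♯-% n)) (χ-♯<7 (n ℕ.% 7) (ℕ-DivMod.m%n<n n 7))

  -- Adding 7 changes nothing in the field and keeps the subtraction of natural numbers from
  -- truncating.
  χ[♯i-♯j] : ∀ i j → j ℕ.≤ 7 ℕ.+ i → χ (♯ i - ♯ j) ≡ legendre₇ ((7 ℕ.+ i ℕ.∸ j) ℕ.% 7)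
  χ[♯i-♯j] i j j≤ = trans (cong χ (begin
    ♯ i - ♯ j   ≡⟨ mod7 (- 1#) _ _ (solve 2 (λ i j → i :- j :- (κ 7 :+ i :- j) := :- κ 1 :* κ 7) refl (♯ i) (♯ j)) ⟩
    ♯ 7 + ♯ i - ♯ j   ≡⟨ cong (λ z → z - ♯ j) (sym (ι-+ (pos 7) (pos i))) ⟩
    ♯ (7 ℕ.+ i) - ♯ j   ≡⟨ cong (λ z → ♯ z - ♯ j) (sym (ℕₚ.m∸n+n≡m j≤)) ⟩
    ♯ (7 ℕ.+ i ℕ.∸ j ℕ.+ j) - ♯ j   ≡⟨ cong (λ z → z - ♯ j) (ι-+ (pos (7 ℕ.+ i ℕ.∸ j)) (pos j)) ⟩
    ♯ (7 ℕ.+ i ℕ.∸ j) + ♯ j - ♯ j   ≡⟨ solve 2 (λ x y → x :+ y :- y := x) refl (♯ (7 ℕ.+ i ℕ.∸ j)) (♯ j) ⟩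
    ♯ (7 ℕ.+ i ℕ.∸ j)   ∎)) (χ-♯ (7 ℕ.+ i ℕ.∸ j))
    where open ≡-Reasoning

  signs : Carrier → Vec ℤ 7
  signs s = χ (s - 0#) ∷ χ (s - 1#) ∷ χ (s - ♯ 2) ∷ χ (s - ♯ 3) ∷ χ (s - ♯ 4) ∷ χ (s - ♯ 5) ∷ χ (s - ♯ 6) ∷ []

  prime-field : List Carrier
  prime-field = 0# ∷ 1# ∷ ♯ 2 ∷ ♯ 3 ∷ ♯ 4 ∷ ♯ 5 ∷ ♯ 6 ∷ []

  private
    -- On 𝔽₇ itself one entry is 0, so these are not sign vectors, and the value is 1 instead of 0.
    -- These seven points are the error term of the final estimate.
    excess-prime : ∀ i → i ℕ.< 7 → excess (signs (♯ i)) ≡ 1ℤ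
    excess-prime i i<7 = trans (cong excess (row (d 0) (d 1) (d 2) (d 3) (d 4) (d 5) (d 6))) (table i i<7)
      where
      row : ∀ {a b c d e f g a′ b′ c′ d′ e′ f′ g′ : ℤ} → a ≡ a′ → b ≡ b′ → c ≡ c′ → d ≡ d′ → e ≡ e′ → f ≡ f′ → g ≡ g′ →
        a ∷ b ∷ c ∷ d ∷ e ∷ f ∷ g ∷ [] ≡ a′ ∷ b′ ∷ c′ ∷ d′ ∷ e′ ∷ f′ ∷ g′ ∷ []
      row refl refl refl refl refl refl refl = refl
      d : ∀ j {j≤7 : Dec.True (j ℕ.≤? 7)} → χ (♯ i - ♯ j) ≡ legendre₇ ((7 ℕ.+ i ℕ.∸ j) ℕ.% 7)
      d j {j≤7} = χ[♯i-♯j] i j (ℕₚ.≤-trans (Dec.toWitness j≤7) (ℕₚ.m≤m+n 7 i))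
      l : ℕ → ℕ → ℤ
      l i j = legendre₇ ((7 ℕ.+ i ℕ.∸ j) ℕ.% 7)
      table : ∀ i → i ℕ.< 7 → excess (l i 0 ∷ l i 1 ∷ l i 2 ∷ l i 3 ∷ l i 4 ∷ l i 5 ∷ l i 6 ∷ []) ≡ 1ℤ
      table 0 _ = refl
      table 1 _ = refl
      table 2 _ = refl
      table 3 _ = refl
      table 4 _ = refl
      table 5 _ = refl
      table 6 _ = refl
      table (suc (suc (suc (suc (suc (suc (suc n))))))) lt = contradiction lt (ℕₚ.≤⇒≯ (ℕₚ.m≤m+n 7 n))

  linear-sum : List Carrier → Carrier → ℤ
  linear-sum as s = sumℤ (map (λ a → χ (s - a)) as)

  ∑-χ*linear-sum : ∀ b as → All (b ≢_) as → ∑ (λ s → χ (s - b) ℤ.* linear-sum as s) ≡ ℤ.- pos (length as)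
  ∑-χ*linear-sum b [] [] = ∑-zero λ s → ℤₚ.*-zeroʳ (χ (s - b))
  ∑-χ*linear-sum b (a ∷ as) (b≢a ∷ b∉as) = begin
    ∑ (λ s → χ (s - b) ℤ.* (χ (s - a) ℤ.+ linear-sum as s))   ≡⟨ ∑-cong (λ s → ℤₚ.*-distribˡ-+ (χ (s - b)) _ _) ⟩
    ∑ (λ s → χ (s - b) ℤ.* χ (s - a) ℤ.+ χ (s - b) ℤ.* linear-sum as s)   ≡⟨ ∑-+ _ _ ⟩
    ∑ (λ s → χ (s - b) ℤ.* χ (s - a)) ℤ.+ ∑ (λ s → χ (s - b) ℤ.* linear-sum as s)         ≡⟨ cong₂ ℤ._+_ (∑χ[x-a][x-b] b a b≢a) (∑-χ*linear-sum b as b∉as) ⟩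
    -1ℤ ℤ.+ ℤ.- pos (length as)   ≡⟨ sym (ℤₚ.neg-distrib-+ 1ℤ (pos (length as))) ⟩
    ℤ.- pos (suc (length as))   ∎
    where open ≡-Reasoning

  -- With n points, n diagonal terms of q - 1 and n(n - 1) mixed terms of -1.
  ∑-linear-sum² : ∀ as → AllPairs _≢_ as → ∑ (λ s → linear-sum as s ℤ.* linear-sum as s) ≡ pos (length as) ℤ.* (pos q ℤ.- pos (length as))
  ∑-linear-sum² [] [] = ∑-zero λ _ → refl
  ∑-linear-sum² (a ∷ as) (a∉as ∷ distinct) = begin
    ∑ (λ s → (v s ℤ.+ S s) ℤ.* (v s ℤ.+ S s))   ≡⟨ ∑-cong (λ s → lem₁ (v s) (S s)) ⟩
    ∑ (λ s → v s ℤ.* v s ℤ.+ (pos 2 ℤ.* (v s ℤ.* S s) ℤ.+ S s ℤ.* S s))   ≡⟨ trans (∑-+ _ _) (cong (λ z → ∑ (λ s → v s ℤ.* v s) ℤ.+ z) (trans (∑-+ _ _) (cong₂ ℤ._+_ (trans (∑-*ˡ (pos 2) _) (cong (λ z → pos 2 ℤ.* z) (∑-χ*linear-sum a as a∉as))) (∑-linear-sum² as distinct)))) ⟩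
    V ℤ.+ (pos 2 ℤ.* ℤ.- n ℤ.+ n ℤ.* (pos q ℤ.- n))   ≡⟨ cong (λ z → V ℤ.+ (pos 2 ℤ.* ℤ.- n ℤ.+ n ℤ.* (z ℤ.- n))) (sym (∑χ[x-a]² a)) ⟩
    V ℤ.+ (pos 2 ℤ.* ℤ.- n ℤ.+ n ℤ.* (V ℤ.+ 1ℤ ℤ.- n))   ≡⟨ lem₂ V n ⟩
    (1ℤ ℤ.+ n) ℤ.* (V ℤ.+ 1ℤ ℤ.- (1ℤ ℤ.+ n))   ≡⟨ cong (λ z → (1ℤ ℤ.+ n) ℤ.* (z ℤ.- (1ℤ ℤ.+ n))) (∑χ[x-a]² a) ⟩
    pos (suc (length as)) ℤ.* (pos q ℤ.- pos (suc (length as)))   ∎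
    where
    open ≡-Reasoning
    v S : Carrier → ℤ
    v s = χ (s - a)
    S = linear-sum as
    n V : ℤ
    n = pos (length as)
    V = ∑ (λ s → v s ℤ.* v s)
    lem₁ : ∀ x y → (x ℤ.+ y) ℤ.* (x ℤ.+ y) ≡ x ℤ.* x ℤ.+ (pos 2 ℤ.* (x ℤ.* y) ℤ.+ y ℤ.* y)
    lem₁ = solve-∀
    lem₂ : ∀ V n → V ℤ.+ (pos 2 ℤ.* ℤ.- n ℤ.+ n ℤ.* (V ℤ.+ 1ℤ ℤ.- n)) ≡ (1ℤ ℤ.+ n) ℤ.* (V ℤ.+ 1ℤ ℤ.- (1ℤ ℤ.+ n))
    lem₂ = solve-∀

  near : Carrier → Carrier → ℤ
  near a s = ind (s ≟ a)

  ∑near-≥0 : ∀ s as → 0ℤ ℤ.≤ sumℤ (map (λ a → near a s) as)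
  ∑near-≥0 s [] = ℤₚ.≤-refl
  ∑near-≥0 s (a ∷ as) with s ≟ a
  ... | yes _ = ℤₚ.+-mono-≤ (ℤ.+≤+ ℕ.z≤n) (∑near-≥0 s as)
  ... | no _ = ℤₚ.+-mono-≤ (ℤ.+≤+ ℕ.z≤n) (∑near-≥0 s as)

  ∑near-≥1 : ∀ s as → s ∈ as → 1ℤ ℤ.≤ sumℤ (map (λ a → near a s) as)
  ∑near-≥1 s (a ∷ as) s∈as with s ≟ a | s∈as
  ... | yes _ | _ = ℤₚ.+-mono-≤ (ℤₚ.≤-refl {1ℤ}) (∑near-≥0 s as)
  ... | no n | here e = contradiction e n
  ... | no n | there p = ℤₚ.+-mono-≤ (ℤₚ.≤-refl {0ℤ}) (∑near-≥1 s as p)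

  cube : Carrier → Carrier
  cube x = x * x * x

  cube-roots : Carrier → ℤ
  cube-roots c = ∑ (λ x → ind (cube x ≟ c))

  -- x³ - a³ = (x - a)(x - 2a)(x - 4a) in characteristic 7.
  cube-roots≤3 : ∀ c → cube-roots c ℤ.≤ pos 3
  cube-roots≤3 c with Finₚ.any? (λ i → cube (elem i) ≟ c)
  ... | no ¬root = ℤₚ.≤-trans (ℤₚ.≤-reflexive (∑-zero λ x → ind-no (cube x ≟ c) λ e → ¬root (index x , trans (cong cube (elem-index x)) e))) (ℤ.+≤+ ℕ.z≤n)
  ... | yes (i , refl) = ℤₚ.≤-trans (∑-mono-≤ bound) (ℤₚ.≤-reflexive (trans (∑-list (near a ∷ near (♯ 2 * a) ∷ near (♯ 4 * a) ∷ [])) (cong₂ ℤ._+_ (one a) (cong₂ ℤ._+_ (one (♯ 2 * a)) (cong₂ ℤ._+_ (one (♯ 4 * a)) refl)))))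
    where
    a : Carrier
    a = elem i
    one : ∀ b → ∑ (near b) ≡ 1ℤ
    one b = trans (∑-only _ b λ x x≢b → ind-no (x ≟ b) x≢b) (ind-yes (b ≟ b) refl)
    roots : ∀ x → cube x ≡ cube a → x ≢ a → x ≢ ♯ 2 * a → x ≢ ♯ 4 * a → ⊥
    roots x e n₁ n₂ n₄ = n₄ (x-y≡0⇒x≡y _ _ (x*y≡0⇒y≡0 ((x - a) * (x - ♯ 2 * a)) _ (*-≢0 (n₁ ∘ x-y≡0⇒x≡y x a) (n₂ ∘ x-y≡0⇒x≡y x (♯ 2 * a)))
      (trans (mod7 (♯ 2 * (x * a * a) - x * x * a - a * a * a) _ (cube x - cube a) (solve 2 (λ x a → (x :- a) :* (x :- κ 2 :* a) :* (x :- κ 4 :* a) :- (x :* x :* x :- a :* a :* a) := (κ 2 :* (x :* a :* a) :- x :* x :* a :- a :* a :* a) :* κ 7) refl x a))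
        (trans (cong (λ z → z - cube a) e) (-‿inverseʳ _)))))
    bound : ∀ x → ind (cube x ≟ cube a) ℤ.≤ sumℤ (map (λ b → near b x) (a ∷ ♯ 2 * a ∷ ♯ 4 * a ∷ []))
    bound x with cube x ≟ cube a | any? (x ≟_) (a ∷ ♯ 2 * a ∷ ♯ 4 * a ∷ [])
    ... | no _ | _ = ∑near-≥0 x (a ∷ ♯ 2 * a ∷ ♯ 4 * a ∷ [])
    ... | yes _ | yes x∈ = ∑near-≥1 x (a ∷ ♯ 2 * a ∷ ♯ 4 * a ∷ []) x∈
    ... | yes e | no x∉ = contradiction (roots x e (x∉ ∘ here) (x∉ ∘ there ∘ here) (x∉ ∘ there ∘ there ∘ here)) λ ()

  cubic-sum : Carrier → ℤ
  cubic-sum c = ∑ (λ x → χ (cube x - c))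

  private
    N H : Carrier → ℤ
    N = cube-roots
    H = cubic-sum

  -- Parseval for φ = `cube-roots`: its sum is q, and the sum of its squares is the sum of
  -- `cube-roots` (x³) over x, hence at most 3q. So the total is at most q · 3q - q².
  ∑-cubic-sum² : ∑ (λ c → cubic-sum c ℤ.* cubic-sum c) ℤ.≤ pos 2 ℤ.* (pos q ℤ.* pos q)
  ∑-cubic-sum² = begin
    ∑ (λ c → H c ℤ.* H c)   ≡⟨ lem₁ (∑ (λ c → H c ℤ.* H c)) (pos q ℤ.* pos q) ⟩
    ∑ (λ c → H c ℤ.* H c) ℤ.+ pos q ℤ.* pos q ℤ.- pos q ℤ.* pos q         ≡⟨ cong (λ z → z ℤ.- pos q ℤ.* pos q) plancherel ⟩
    pos q ℤ.* ∑ (λ c → N c ℤ.* N c) ℤ.- pos q ℤ.* pos q   ≤⟨ ℤₚ.+-monoˡ-≤ (ℤ.- (pos q ℤ.* pos q)) (ℤₚ.*-monoˡ-≤-nonNeg (pos q) ∑N²) ⟩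
    pos q ℤ.* (pos q ℤ.* pos 3) ℤ.- pos q ℤ.* pos q   ≡⟨ lem₂ (pos q) ⟩
    pos 2 ℤ.* (pos q ℤ.* pos q)   ∎
    where
    open ℤₚ.≤-Reasoning
    lem₁ : ∀ a b → a ≡ a ℤ.+ b ℤ.- b
    lem₁ = solve-∀
    lem₂ : ∀ a → a ℤ.* (a ℤ.* pos 3) ℤ.- a ℤ.* a ≡ pos 2 ℤ.* (a ℤ.* a)
    lem₂ = solve-∀
    ∑N : ∑ N ≡ pos q
    ∑N = trans (∑-cong λ c → sym (ℤₚ.*-identityʳ (N c))) (trans (sym (∑-fibre cube (λ _ → 1ℤ))) ∑-1)
    ∑N² : ∑ (λ c → N c ℤ.* N c) ℤ.≤ pos q ℤ.* pos 3
    ∑N² = ℤₚ.≤-trans (ℤₚ.≤-reflexive (sym (∑-fibre cube N))) (ℤₚ.≤-trans (∑-mono-≤ λ x → cube-roots≤3 (cube x)) (ℤₚ.≤-reflexive (∑-const (pos 3))))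
    as-convolution : ∀ c → H c ≡ ∑ (λ y → χ (y - c) ℤ.* N y)
    as-convolution c = trans (∑-fibre cube (λ y → χ (y - c))) (∑-cong λ y → ℤₚ.*-comm (N y) _)
    plancherel : ∑ (λ c → H c ℤ.* H c) ℤ.+ pos q ℤ.* pos q ≡ pos q ℤ.* ∑ (λ c → N c ℤ.* N c)
    plancherel = trans (cong₂ ℤ._+_ (∑-cong λ c → cong (λ z → z ℤ.* z) (as-convolution c)) (sym (cong (λ z → z ℤ.* z) ∑N))) (parseval N)

  cubic-sum-twist : ∀ u → u ≢0 → cubic-sum (cube u) ℤ.* cubic-sum (cube u) ≡ cubic-sum 1# ℤ.* cubic-sum 1#
  cubic-sum-twist u u≢0 = trans (cong (λ z → z ℤ.* z) twist) (trans (lem (χ u) (H 1#)) (trans (cong (λ z → z ℤ.* (H 1# ℤ.* H 1#)) (χ² u≢0)) (ℤₚ.*-identityˡ _)))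
    where
    lem : ∀ a b → a ℤ.* b ℤ.* (a ℤ.* b) ≡ a ℤ.* a ℤ.* (b ℤ.* b)
    lem = solve-∀
    twist : H (cube u) ≡ χ u ℤ.* H 1#
    twist = trans (∑-scale u u≢0 _) (trans (∑-cong λ x → trans (cong χ (solve 2 (λ u x → u :* x :* (u :* x) :* (u :* x) :- u :* u :* u := u :* u :* (u :* (x :* x :* x :- κ 1))) refl u x)) (trans (χ-square-* u _ u≢0) (χ-* u _))) (∑-*ˡ (χ u) _))

  -- For u ≠ 0 the curve for c = u³ is a twist of the one for c = 1, so its sum has the same square
  -- K. Each c is hit by at most three u, which gives (q - 1)K ≤ 3 · 2q².
  cubic-sum-bound : pos q ℤ.* (cubic-sum 1# ℤ.* cubic-sum 1#) ℤ.≤ pos 6 ℤ.* (pos q ℤ.* pos q) ℤ.+ cubic-sum 1# ℤ.* cubic-sum 1#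
  cubic-sum-bound = begin
    pos q ℤ.* K   ≡⟨ sym (trans (cong₂ ℤ._+_ (∑-const K) refl) (ℤₚ.+-identityʳ _)) ⟩
    ∑ (λ _ → K) ℤ.+ 0ℤ   ≤⟨ ℤₚ.+-monoʳ-≤ (∑ (λ _ → K)) (0≤i*i (H (cube 0#))) ⟩
    ∑ (λ _ → K) ℤ.+ H (cube 0#) ℤ.* H (cube 0#)   ≡⟨ ∑-except (λ _ → K) (λ u → H (cube u) ℤ.* H (cube u)) 0# (λ u u≢0 → sym (cubic-sum-twist u u≢0)) ⟩
    ∑ (λ u → H (cube u) ℤ.* H (cube u)) ℤ.+ K   ≡⟨ cong (λ z → z ℤ.+ K) (∑-fibre cube (λ c → H c ℤ.* H c)) ⟩
    ∑ (λ c → N c ℤ.* (H c ℤ.* H c)) ℤ.+ K   ≤⟨ ℤₚ.+-monoˡ-≤ K (∑-mono-≤ λ c → ℤₚ.*-monoʳ-≤-nonNeg (H c ℤ.* H c) ⦃ ℤ.nonNegative (0≤i*i (H c)) ⦄ (cube-roots≤3 c)) ⟩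
    ∑ (λ c → pos 3 ℤ.* (H c ℤ.* H c)) ℤ.+ K   ≡⟨ cong (λ z → z ℤ.+ K) (∑-*ˡ (pos 3) _) ⟩
    pos 3 ℤ.* ∑ (λ c → H c ℤ.* H c) ℤ.+ K   ≤⟨ ℤₚ.+-monoˡ-≤ K (ℤₚ.*-monoˡ-≤-nonNeg (pos 3) ∑-cubic-sum²) ⟩
    pos 3 ℤ.* (pos 2 ℤ.* (pos q ℤ.* pos q)) ℤ.+ K   ≡⟨ cong (λ z → z ℤ.+ K) (lem (pos q ℤ.* pos q)) ⟩
    pos 6 ℤ.* (pos q ℤ.* pos q) ℤ.+ K   ∎
    where
    open ℤₚ.≤-Reasoning
    K : ℤ
    K = H 1# ℤ.* H 1#
    lem : ∀ a → pos 3 ℤ.* (pos 2 ℤ.* a) ≡ pos 6 ℤ.* a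
    lem = solve-∀

  triple : ℕ → ℕ → ℕ → Carrier → ℤ
  triple i j k s = χ (s - ♯ i) ℤ.* χ (s - ♯ j) ℤ.* χ (s - ♯ k)

  ∑-triple : ∀ t i j k → ∑ (triple i j k) ≡ ∑ (triple ((i ℕ.+ t) ℕ.% 7) ((j ℕ.+ t) ℕ.% 7) ((k ℕ.+ t) ℕ.% 7))
  ∑-triple t i j k = sym (trans (∑-shift (♯ t) _) (∑-cong λ s → cong₂ ℤ._*_ (cong₂ ℤ._*_ (cong χ (move s i)) (cong χ (move s j))) (cong χ (move s k))))
    where
    move : ∀ s i → s + ♯ t - ♯ ((i ℕ.+ t) ℕ.% 7) ≡ s - ♯ i
    move s i = trans (cong (λ z → s + ♯ t - z) (trans (sym (♯-% (i ℕ.+ t))) (ι-+ (pos i) (pos t)))) (solve 3 (λ s t i → s :+ t :- (i :+ t) := s :- i) refl s (♯ t) (♯ i))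

  private
    triple-χ : ∀ i j k s → triple i j k s ≡ χ ((s - ♯ i) * (s - ♯ j) * (s - ♯ k))
    triple-χ i j k s = trans (cong (λ z → z ℤ.* χ (s - ♯ k)) (sym (χ-* (s - ♯ i) (s - ♯ j)))) (sym (χ-* _ _))

  -- 1, 2, 4 are the cube roots of unity in 𝔽₇.
  ∑-triple-124 : ∑ (triple 1 2 4) ≡ cubic-sum 1#
  ∑-triple-124 = ∑-cong λ s → trans (triple-χ 1 2 4 s) (cong χ (mod7 (♯ 2 * s - s * s - 1#) _ _
    (solve 1 (λ s → (s :- κ 1) :* (s :- κ 2) :* (s :- κ 4) :- (s :* s :* s :- κ 1) := (κ 2 :* s :- s :* s :- κ 1) :* κ 7) refl s)))

  -- 3, 5, 6 are the cube roots of -1; s ↦ -s reduces to s³ - 1 at the cost of the sign χ(-1).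
  ∑-triple-356 : ∑ (triple 3 5 6) ≡ ℤ.- cubic-sum 1#
  ∑-triple-356 = trans (∑-negate _) (trans (∑-cong λ s → trans (triple-χ 3 5 6 (- s)) (trans (cong χ (mod7 (- (♯ 2 * (s * s) + ♯ 9 * s + ♯ 13)) _ (- (cube s - 1#))
    (solve 1 (λ s → (:- s :- κ 3) :* (:- s :- κ 5) :* (:- s :- κ 6) :- :- (s :* s :* s :- κ 1) := :- (κ 2 :* (s :* s) :+ κ 9 :* s :+ κ 13) :* κ 7) refl s))) (χ-neg _))) (∑-neg _))

  -- The fourteen cubic terms are the translates of (s-1)(s-2)(s-4) and, with minus sign, of
  -- (s-3)(s-5)(s-6), so each has the sum of χ(s³ - 1). Hence 84 = 6 · 14, while the squared linear
  -- form and the constant give -7(q - 7) + 49q.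
  ∑-excess : ∑ (λ s → excess (signs s)) ≡ pos 84 ℤ.* cubic-sum 1# ℤ.+ pos 42 ℤ.* pos q ℤ.+ pos 49
  ∑-excess = begin
    ∑ (λ s → excess (signs s))   ≡⟨ ∑-+ _ _ ⟩
    ∑ (λ s → pos 6 ℤ.* sumℤ (map (λ f → f s) triples)) ℤ.+ ∑ (λ s → ℤ.- (X s ℤ.* X s) ℤ.+ pos 49)  ≡⟨ cong₂ ℤ._+_ (trans (∑-*ˡ (pos 6) _) (cong (λ z → pos 6 ℤ.* z) (trans (∑-list triples) values))) (trans (∑-+ _ _) (cong₂ ℤ._+_ (trans (∑-neg _) (cong ℤ.-_ (∑-linear-sum² prime-field distinct))) (∑-const (pos 49)))) ⟩
    pos 6 ℤ.* (k ℤ.+ (k ℤ.+ (k ℤ.+ (k ℤ.+ (k ℤ.+ (k ℤ.+ (k ℤ.+ (k ℤ.+ (k ℤ.+ (k ℤ.+ (k ℤ.+ (k ℤ.+ (k ℤ.+ (k ℤ.+ 0ℤ)))))))))))))) ℤ.+ (ℤ.- (pos 7 ℤ.* (pos q ℤ.- pos 7)) ℤ.+ pos q ℤ.* pos 49)  ≡⟨ lem k (pos q) ⟩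
    pos 84 ℤ.* k ℤ.+ pos 42 ℤ.* pos q ℤ.+ pos 49   ∎
    where
    open ≡-Reasoning
    k : ℤ
    k = cubic-sum 1#
    X : Carrier → ℤ
    X = linear-sum prime-field
    triples : List (Carrier → ℤ)
    triples = triple 1 2 4 ∷ triple 2 3 5 ∷ triple 3 4 6 ∷ triple 4 5 0 ∷ triple 5 6 1 ∷ triple 6 0 2 ∷ triple 0 1 3
      ∷ (λ s → ℤ.- triple 3 5 6 s) ∷ (λ s → ℤ.- triple 4 6 0 s) ∷ (λ s → ℤ.- triple 5 0 1 s) ∷ (λ s → ℤ.- triple 6 1 2 s) ∷ (λ s → ℤ.- triple 0 2 3 s) ∷ (λ s → ℤ.- triple 1 3 4 s) ∷ (λ s → ℤ.- triple 2 4 5 s) ∷ []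
    plus : ∀ t → ∑ (triple ((1 ℕ.+ t) ℕ.% 7) ((2 ℕ.+ t) ℕ.% 7) ((4 ℕ.+ t) ℕ.% 7)) ≡ k
    plus t = trans (sym (∑-triple t 1 2 4)) ∑-triple-124
    minus : ∀ t → ∑ (λ s → ℤ.- triple ((3 ℕ.+ t) ℕ.% 7) ((5 ℕ.+ t) ℕ.% 7) ((6 ℕ.+ t) ℕ.% 7) s) ≡ k
    minus t = trans (∑-neg _) (trans (cong ℤ.-_ (trans (sym (∑-triple t 3 5 6)) ∑-triple-356)) (ℤₚ.neg-involutive k))
    values : sumℤ (map ∑ triples) ≡ k ℤ.+ (k ℤ.+ (k ℤ.+ (k ℤ.+ (k ℤ.+ (k ℤ.+ (k ℤ.+ (k ℤ.+ (k ℤ.+ (k ℤ.+ (k ℤ.+ (k ℤ.+ (k ℤ.+ (k ℤ.+ 0ℤ)))))))))))))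
    values = cong₂ ℤ._+_ (plus 0) (cong₂ ℤ._+_ (plus 1) (cong₂ ℤ._+_ (plus 2) (cong₂ ℤ._+_ (plus 3) (cong₂ ℤ._+_ (plus 4) (cong₂ ℤ._+_ (plus 5) (cong₂ ℤ._+_ (plus 6)
      (cong₂ ℤ._+_ (minus 0) (cong₂ ℤ._+_ (minus 1) (cong₂ ℤ._+_ (minus 2) (cong₂ ℤ._+_ (minus 3) (cong₂ ℤ._+_ (minus 4) (cong₂ ℤ._+_ (minus 5) (cong₂ ℤ._+_ (minus 6) refl)))))))))))))
    n₁ : ♯ 1 ≢0
    n₁ = 1≢0
    n₅ : ♯ 5 ≢0
    n₅ = χ≢0⇒≢0 λ e → contradiction (trans (sym (χ-♯ 5)) e) λ ()
    n₆ : ♯ 6 ≢0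
    n₆ = χ≢0⇒≢0 λ e → contradiction (trans (sym (χ-♯ 6)) e) λ ()
    d : ∀ i j → ι (pos j ℤ.- pos i) ≢0 → ♯ i ≢ ♯ j
    d i j n = ι-≢ (pos j) (pos i) n ∘ sym
    distinct : AllPairs _≢_ prime-field
    distinct = (d 0 1 n₁ ∷ d 0 2 2≢0 ∷ d 0 3 3≢0 ∷ d 0 4 4≢0 ∷ d 0 5 n₅ ∷ d 0 6 n₆ ∷ [])
      ∷ (d 1 2 n₁ ∷ d 1 3 2≢0 ∷ d 1 4 3≢0 ∷ d 1 5 4≢0 ∷ d 1 6 n₅ ∷ [])
      ∷ (d 2 3 n₁ ∷ d 2 4 2≢0 ∷ d 2 5 3≢0 ∷ d 2 6 4≢0 ∷ [])
      ∷ (d 3 4 n₁ ∷ d 3 5 2≢0 ∷ d 3 6 3≢0 ∷ [])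
      ∷ (d 4 5 n₁ ∷ d 4 6 2≢0 ∷ [])
      ∷ (d 5 6 n₁ ∷ [])
      ∷ [] ∷ []
    lem : ∀ k q → pos 6 ℤ.* (k ℤ.+ (k ℤ.+ (k ℤ.+ (k ℤ.+ (k ℤ.+ (k ℤ.+ (k ℤ.+ (k ℤ.+ (k ℤ.+ (k ℤ.+ (k ℤ.+ (k ℤ.+ (k ℤ.+ (k ℤ.+ 0ℤ)))))))))))))) ℤ.+ (ℤ.- (pos 7 ℤ.* (q ℤ.- pos 7)) ℤ.+ q ℤ.* pos 49) ≡ pos 84 ℤ.* k ℤ.+ pos 42 ℤ.* q ℤ.+ pos 49
    lem = solve-∀

  module _ (none : ∀ x → ¬ Good x) where

    private
      nonzero : ∀ {a b} → a ℤ.* b ≢ 0ℤ → b ≢ 0ℤ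
      nonzero {a} n refl = n (ℤₚ.*-zeroʳ a)

    -- The good pattern in homogeneous coordinates x = X/Y; x² + 4x + 1 = (x+2)² - 3 has no zero as 3 is not a square.
    no-good-homogeneous : ∀ X Y → χ X ℤ.* χ Y ≡ -1ℤ → χ (X + Y) ℤ.* χ Y ≡ 1ℤ → χ (X + ♯ 3 * Y) ℤ.* χ Y ≡ -1ℤ → χ (X * X + ♯ 4 * (X * Y) + Y * Y) ≡ 1ℤ
    no-good-homogeneous X Y e₀ e₁ e₃ = go (classify Q)
      where
      Q x : Carrier
      Q = X * X + ♯ 4 * (X * Y) + Y * Y
      Y≢0 : Y ≢0
      Y≢0 = χ≢0⇒≢0 (nonzero {χ X} λ e → contradiction (trans (sym e₀) e) λ ())
      x = X * Y ⁻¹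
      xY : x * Y ≡ X
      xY = trans (solve 3 (λ x y i → x :* i :* y := x :* (y :* i)) refl X Y (Y ⁻¹)) (trans (cong (λ z → X * z) (⁻¹-inverse Y Y≢0)) (*-identityʳ X))
      divide : ∀ w W → w * Y ≡ W → χ w ≡ χ W ℤ.* χ Y
      divide w W refl = sym (trans (sym (χ-* (w * Y) Y)) (trans (cong χ (solve 2 (λ w Y → w :* Y :* Y := Y :* Y :* w) refl w Y)) (χ-square-* Y w Y≢0)))
      f : Carrier
      f = x * x + ♯ 4 * x + 1#
      YYf : Y * Y * f ≡ Q
      YYf = trans (solve 2 (λ x y → y :* y :* (x :* x :+ κ 4 :* x :+ κ 1) := x :* y :* (x :* y) :+ κ 4 :* (x :* y :* y) :+ y :* y) refl x Y) (cong (λ z → z * z + ♯ 4 * (z * Y) + Y * Y) xY)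
      go : Class Q → χ Q ≡ 1ℤ
      go (isSq _ _ _ _ e) = e
      go (isZero e _) = contradiction χ-3 λ χ3 → ¬Non-square (x + ♯ 2) (trans (cong χ (sym (via (- 1#) (♯ 3) _ (x*y≡0⇒y≡0 (Y * Y) f (*-≢0 Y≢0 Y≢0) (trans YYf e))
        (solve 1 (λ x → κ 3 :- (x :+ κ 2) :* (x :+ κ 2) := :- κ 1 :* (x :* x :+ κ 4 :* x :+ κ 1 :- κ 0)) refl x)))) χ3)
      go (isNon _ _ e) = contradiction
        ( trans (divide x X xY) e₀
        , trans (divide (x + 1#) (X + Y) (trans (solve 2 (λ x y → (x :+ κ 1) :* y := x :* y :+ y) refl x Y) (cong (λ z → z + Y) xY))) e₁
        , trans (divide (x + ♯ 3) (X + ♯ 3 * Y) (trans (solve 2 (λ x y → (x :+ κ 3) :* y := x :* y :+ κ 3 :* y) refl x Y) (cong (λ z → z + ♯ 3 * Y) xY))) e₃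
        , trans (sym (χ-square-* Y f Y≢0)) (trans (cong χ YYf) e))
        (none x)

    module _ (y : Carrier) (w : ℕ → Bool) (w-sign : ∀ i → χ (y + ♯ i) ≡ sgn (w i)) where

      private
        sign : ∀ i {b} → w i ≡ b → χ (y + ♯ i) ≡ sgn b
        sign i e = trans (w-sign i) (cong sgn e)

        sgn² : ∀ b → sgn b ℤ.* sgn b ≡ 1ℤ
        sgn² true = refl
        sgn² false = refl

        sgn-not : ∀ b → sgn (not b) ℤ.* sgn b ≡ -1ℤ
        sgn-not true = refl
        sgn-not false = refl

      -- The two points are y and (y + 5)/(y + 6). Mod 7 the linear expressions of the second one
      -- are multiples of y + 5, y + 2 and y + 4, so their signs can be read off from w.
      ¬patternI : ¬ PatternI w
      ¬patternI (e₀ , e₁ , e₃ , e₂ , e₄ , e₅) = contradiction (trans (sym Q₁) (trans (cong χ opposite) (trans (χ-neg _) (cong ℤ.-_ Q₂)))) λ ()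
        where
        times1 : ∀ {z} x → χ x ≡ z → χ x ℤ.* χ 1# ≡ z
        times1 x e = trans (cong₂ ℤ._*_ e χ-1) (ℤₚ.*-identityʳ _)
        Q₁ : χ (y * y + ♯ 4 * (y * 1#) + 1# * 1#) ≡ 1ℤ
        Q₁ = no-good-homogeneous y 1#
          (times1 y (trans (cong χ (sym (+-identityʳ y))) (sign 0 e₀)))
          (times1 (y + 1#) (sign 1 e₁))
          (times1 (y + ♯ 3 * 1#) (trans (cong χ (cong (λ z → y + z) (*-identityʳ _))) (sign 3 e₃)))
        Q₂ : χ ((y + ♯ 5) * (y + ♯ 5) + ♯ 4 * ((y + ♯ 5) * (y + ♯ 6)) + (y + ♯ 6) * (y + ♯ 6)) ≡ 1ℤ
        Q₂ = no-good-homogeneous (y + ♯ 5) (y + ♯ 6)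
          (trans (cong₂ ℤ._*_ (sign 5 e₅) (w-sign 6)) (sgn-not (w 6)))
          (trans (cong₂ ℤ._*_ (trans (cong χ (mod7 1# _ (♯ 2 * (y + ♯ 2)) (solve 1 (λ y → y :+ κ 5 :+ (y :+ κ 6) :- κ 2 :* (y :+ κ 2) := κ 1 :* κ 7) refl y))) (trans (χ-scale (♯ 2) _ χ-2) (sign 2 e₂))) (w-sign 6)) (sgn² (w 6)))
          (trans (cong₂ ℤ._*_ (trans (cong χ (mod7 1# _ (♯ 4 * (y + ♯ 4)) (solve 1 (λ y → y :+ κ 5 :+ κ 3 :* (y :+ κ 6) :- κ 4 :* (y :+ κ 4) := κ 1 :* κ 7) refl y))) (trans (χ-4* _) (sign 4 e₄))) (w-sign 6)) (sgn-not (w 6)))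
        opposite : y * y + ♯ 4 * (y * 1#) + 1# * 1# ≡ - ((y + ♯ 5) * (y + ♯ 5) + ♯ 4 * ((y + ♯ 5) * (y + ♯ 6)) + (y + ♯ 6) * (y + ♯ 6))
        opposite = mod7 (y * y + ♯ 10 * y + ♯ 26) _ _ (solve 1 (λ y → y :* y :+ κ 4 :* (y :* κ 1) :+ κ 1 :* κ 1 :- :- ((y :+ κ 5) :* (y :+ κ 5) :+ κ 4 :* ((y :+ κ 5) :* (y :+ κ 6)) :+ (y :+ κ 6) :* (y :+ κ 6)) := (y :* y :+ κ 10 :* y :+ κ 26) :* κ 7) refl y)

      -- The two points are 3(y + 5)/y and (y + 1)/(2(y + 4)). Mod 7 the numerator of the second
      -- plus three times its denominator is the constant 4, so no sign of w enters there.
      ¬patternII : ¬ PatternII w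
      ¬patternII (e₁ , e₃ , e₄ , e₂ , e₅ , e₆) = contradiction (trans (sym Q₁) (trans (cong χ opposite) (trans (χ-neg _) (cong ℤ.-_ Q₂)))) λ ()
        where
        χy : χ y ≡ sgn (w 0)
        χy = trans (cong χ (sym (+-identityʳ y))) (w-sign 0)
        scaled : ∀ {k a b} c i → χ c ≡ k → w i ≡ a → k ℤ.* sgn a ≡ b → χ (c * (y + ♯ i)) ≡ b
        scaled c i e e′ e″ = trans (χ-* c _) (trans (cong₂ ℤ._*_ e (sign i e′)) e″)
        χ-6 : χ (♯ 6) ≡ -1ℤ
        χ-6 = χ-♯ 6
        Q₁ : χ (♯ 3 * (y + ♯ 5) * (♯ 3 * (y + ♯ 5)) + ♯ 4 * (♯ 3 * (y + ♯ 5) * y) + y * y) ≡ 1ℤ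
        Q₁ = no-good-homogeneous (♯ 3 * (y + ♯ 5)) y
          (trans (cong₂ ℤ._*_ (scaled (♯ 3) 5 χ-3 e₅ refl) χy) (lem (sgn (w 0)) (sgn² (w 0))))
          (trans (cong₂ ℤ._*_ (trans (cong χ (mod7 1# _ (♯ 4 * (y + ♯ 2)) (solve 1 (λ y → κ 3 :* (y :+ κ 5) :+ y :- κ 4 :* (y :+ κ 2) := κ 1 :* κ 7) refl y))) (trans (χ-4* _) (sign 2 e₂))) χy) (sgn² (w 0)))
          (trans (cong₂ ℤ._*_ (trans (cong χ (mod7 (- ♯ 3) _ (♯ 6 * (y + ♯ 6)) (solve 1 (λ y → κ 3 :* (y :+ κ 5) :+ κ 3 :* y :- κ 6 :* (y :+ κ 6) := :- κ 3 :* κ 7) refl y))) (scaled (♯ 6) 6 χ-6 e₆ refl)) χy) (lem (sgn (w 0)) (sgn² (w 0))))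
          where
          lem′ : ∀ a → -1ℤ ℤ.* a ℤ.* a ≡ ℤ.- (a ℤ.* a)
          lem′ = solve-∀
          lem : ∀ a → a ℤ.* a ≡ 1ℤ → -1ℤ ℤ.* a ℤ.* a ≡ -1ℤ
          lem a e = trans (lem′ a) (cong ℤ.-_ e)
        χY₂ : χ (♯ 2 * (y + ♯ 4)) ≡ -1ℤ
        χY₂ = scaled (♯ 2) 4 χ-2 e₄ refl
        Q₂ : χ ((y + 1#) * (y + 1#) + ♯ 4 * ((y + 1#) * (♯ 2 * (y + ♯ 4))) + ♯ 2 * (y + ♯ 4) * (♯ 2 * (y + ♯ 4))) ≡ 1ℤ
        Q₂ = no-good-homogeneous (y + 1#) (♯ 2 * (y + ♯ 4))
          (cong₂ ℤ._*_ (sign 1 e₁) χY₂)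
          (cong₂ ℤ._*_ (trans (cong χ (solve 1 (λ y → y :+ κ 1 :+ κ 2 :* (y :+ κ 4) := κ 3 :* (y :+ κ 3)) refl y)) (scaled (♯ 3) 3 χ-3 e₃ refl)) χY₂)
          (cong₂ ℤ._*_ (trans (cong χ (mod7 (y + ♯ 3) _ (♯ 4) (solve 1 (λ y → y :+ κ 1 :+ κ 3 :* (κ 2 :* (y :+ κ 4)) :- κ 4 := (y :+ κ 3) :* κ 7) refl y))) (χ-♯ 4)) χY₂)
        opposite : ♯ 3 * (y + ♯ 5) * (♯ 3 * (y + ♯ 5)) + ♯ 4 * (♯ 3 * (y + ♯ 5) * y) + y * y ≡ - ((y + 1#) * (y + 1#) + ♯ 4 * ((y + 1#) * (♯ 2 * (y + ♯ 4))) + ♯ 2 * (y + ♯ 4) * (♯ 2 * (y + ♯ 4)))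
        opposite = mod7 (♯ 5 * (y * y) + ♯ 32 * y + ♯ 46) _ _ (solve 1 (λ y → κ 3 :* (y :+ κ 5) :* (κ 3 :* (y :+ κ 5)) :+ κ 4 :* (κ 3 :* (y :+ κ 5) :* y) :+ y :* y :- :- ((y :+ κ 1) :* (y :+ κ 1) :+ κ 4 :* ((y :+ κ 1) :* (κ 2 :* (y :+ κ 4))) :+ κ 2 :* (y :+ κ 4) :* (κ 2 :* (y :+ κ 4))) := (κ 5 :* (y :* y) :+ κ 32 :* y :+ κ 46) :* κ 7) refl y)

    private
      bit : ∀ x → x ≢0 → Σ Bool λ b → χ x ≡ sgn b
      bit x x≢0 with classify x
      ... | isZero e _ = contradiction e x≢0
      ... | isSq _ _ _ _ e = true , e
      ... | isNon _ _ e = false , e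

    -- Outside 𝔽₇ all seven signs are ±1, and the absence of good elements forbids both patterns at
    -- every y = us + t, so the first alternative of `excess-or-pattern` remains.
    excess≡0 : ∀ s → All (λ a → s - a ≢0) prime-field → excess (signs s) ≡ 0ℤ
    excess≡0 s (n₀ ∷ n₁ ∷ n₂ ∷ n₃ ∷ n₄ ∷ n₅ ∷ n₆ ∷ []) with bit _ n₀ | bit _ n₁ | bit _ n₂ | bit _ n₃ | bit _ n₄ | bit _ n₅ | bit _ n₆
    ... | b₀ , e₀ | b₁ , e₁ | b₂ , e₂ | b₃ , e₃ | b₄ , e₄ | b₅ , e₅ | b₆ , e₆ = go (excess-or-pattern v)
      where
      v : Vec Bool 7
      v = b₀ ∷ b₁ ∷ b₂ ∷ b₃ ∷ b₄ ∷ b₅ ∷ b₆ ∷ []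
      signs≡ : signs s ≡ Vec.map sgn v
      signs≡ = cong₂ _∷_ e₀ (cong₂ _∷_ e₁ (cong₂ _∷_ e₂ (cong₂ _∷_ e₃ (cong₂ _∷_ e₄ (cong₂ _∷_ e₅ (cong₂ _∷_ e₆ refl))))))
      lookup : ∀ j → j ℕ.< 7 → χ (s - ♯ j) ≡ sgn (at v j)
      lookup 0 _ = e₀
      lookup 1 _ = e₁
      lookup 2 _ = e₂
      lookup 3 _ = e₃
      lookup 4 _ = e₄
      lookup 5 _ = e₅
      lookup 6 _ = e₆
      lookup (suc (suc (suc (suc (suc (suc (suc n))))))) lt = contradiction lt (ℕₚ.≤⇒≯ (ℕₚ.m≤m+n 7 n))
      unit : ∀ u → (6 ℕ.* u ℕ.^ 6 ℕ.+ 1) ℕ.% 7 ≡ 0 → ♯ 6 * (♯ u * ♯ (u ℕ.^ 5)) + 1# ≡ 0#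
      unit u e = begin
        ♯ 6 * (♯ u * ♯ (u ℕ.^ 5)) + 1#        ≡⟨ cong (λ z → ♯ 6 * z + 1#) (sym (♯-* u (u ℕ.^ 5))) ⟩
        ♯ 6 * ♯ (u ℕ.^ 6) + 1#   ≡⟨ cong (λ z → z + 1#) (sym (♯-* 6 (u ℕ.^ 6))) ⟩
        ♯ (6 ℕ.* u ℕ.^ 6) + 1#   ≡⟨ sym (ι-+ (pos (6 ℕ.* u ℕ.^ 6)) (pos 1)) ⟩
        ♯ (6 ℕ.* u ℕ.^ 6 ℕ.+ 1)   ≡⟨ ♯-% (6 ℕ.* u ℕ.^ 6 ℕ.+ 1) ⟩
        ♯ ((6 ℕ.* u ℕ.^ 6 ℕ.+ 1) ℕ.% 7)       ≡⟨ cong ♯_ e ⟩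
        0#   ∎
        where open ≡-Reasoning
      χ-unit : ∀ u → (6 ℕ.* u ℕ.^ 6 ℕ.+ 1) ℕ.% 7 ≡ 0 → χ (♯ u) ≡ sgn (residue₇ (u ℕ.% 7))
      χ-unit u e = trans (χ-♯ u) (nonzero₇ (u ℕ.% 7) λ z → 1≢0 (trans (sym (trans (cong (λ z → ♯ 6 * (z * ♯ (u ℕ.^ 5)) + 1#) (trans (♯-% u) (cong ♯_ z)))
          (solve 1 (λ x → κ 6 :* (κ 0 :* x) :+ κ 1 := κ 1) refl (♯ (u ℕ.^ 5))))) (unit u e)))
        where
        nonzero₇ : ∀ n → n ≢ 0 → legendre₇ n ≡ sgn (residue₇ n)
        nonzero₇ zero n≢0 = contradiction refl n≢0
        nonzero₇ (suc n) _ = refl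
      affine-sign : ∀ u t → (6 ℕ.* u ℕ.^ 6 ℕ.+ 1) ℕ.% 7 ≡ 0 → ∀ i → χ (♯ u * s + ♯ t + ♯ i) ≡ sgn (signAt v u t i)
      affine-sign u t e i = begin
        χ (♯ u * s + ♯ t + ♯ i)   ≡⟨ cong χ (via (♯ t + ♯ i) _ (♯ u * (s - ♯ j)) (unit u e) (trans (cong (λ z → ♯ u * s + ♯ t + ♯ i - ♯ u * (s - z)) ♯j)
                                                                  (solve 5 (λ u s t i v → u :* s :+ t :+ i :- u :* (s :- κ 6 :* (t :+ i) :* v) := (t :+ i) :* (κ 6 :* (u :* v) :+ κ 1 :- κ 0)) refl (♯ u) s (♯ t) (♯ i) (♯ (u ℕ.^ 5))))) ⟩
        χ (♯ u * (s - ♯ j))   ≡⟨ χ-* (♯ u) _ ⟩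
        χ (♯ u) ℤ.* χ (s - ♯ j)   ≡⟨ cong₂ ℤ._*_ (χ-unit u e) (lookup j (ℕ-DivMod.m%n<n (6 ℕ.* (t ℕ.+ i) ℕ.* (u ℕ.^ 5)) 7)) ⟩
        sgn (residue₇ (u ℕ.% 7)) ℤ.* sgn (at v j)   ≡⟨ sym (sgn-⊛ (residue₇ (u ℕ.% 7)) (at v j)) ⟩
        sgn (signAt v u t i)   ∎
        where
        open ≡-Reasoning
        j : ℕ
        j = root₇ u t i
        ♯j : ♯ j ≡ ♯ 6 * (♯ t + ♯ i) * ♯ (u ℕ.^ 5)
        ♯j = trans (sym (♯-% (6 ℕ.* (t ℕ.+ i) ℕ.* (u ℕ.^ 5)))) (trans (♯-* (6 ℕ.* (t ℕ.+ i)) (u ℕ.^ 5)) (cong (λ z → z * ♯ (u ℕ.^ 5)) (trans (♯-* 6 (t ℕ.+ i)) (cong (λ z → ♯ 6 * z) (ι-+ (pos t) (pos i))))))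
      go : excess (Vec.map sgn v) ≡ 0ℤ ⊎ Any (Affine v) (cartesianProduct (upTo 7) (upTo 7)) → excess (signs s) ≡ 0ℤ
      go (inj₁ e) = trans (cong excess signs≡) e
      go (inj₂ some) with satisfied some
      ... | (u , t) , e , inj₁ p = contradiction p (¬patternI (♯ u * s + ♯ t) (signAt v u t) (affine-sign u t e))
      ... | (u , t) , e , inj₂ p = contradiction p (¬patternII (♯ u * s + ♯ t) (signAt v u t) (affine-sign u t e))

    excess≤ : ∀ s → excess (signs s) ℤ.≤ sumℤ (map (λ a → near a s) prime-field)
    excess≤ s with any? (s ≟_) prime-field
    ... | yes s∈ = ℤₚ.≤-trans (ℤₚ.≤-reflexive (at-prime (∈-map⁻ ♯_ {xs = upTo 7} s∈))) (∑near-≥1 s prime-field s∈)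
      where
      at-prime : (∃ λ i → i ∈ upTo 7 × s ≡ ♯ i) → excess (signs s) ≡ 1ℤ
      at-prime (i , i∈ , refl) = excess-prime i (∈-upTo⁻ i∈)
    ... | no s∉ = ℤₚ.≤-trans (ℤₚ.≤-reflexive (excess≡0 s (All.map (λ n e → n (x-y≡0⇒x≡y _ _ e)) (¬Any⇒All¬ prime-field s∉)))) (∑near-≥0 s prime-field)

    -- `excess` is at most 1 on the seven points of 𝔽₇ and 0 elsewhere, so 84k + 42q + 49 ≤ 7, where
    -- k is the sum of χ(s³ - 1).
    cubic-sum-large : pos q ℤ.+ 1ℤ ℤ.≤ ℤ.- (pos 2 ℤ.* cubic-sum 1#)
    cubic-sum-large = ℤₚ.*-cancelˡ-≤-pos _ _ (pos 42) (ℤₚ.0≤i-j⇒j≤i (begin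
      0ℤ   ≤⟨ ℤₚ.i≤j⇒0≤j-i (∑-mono-≤ excess≤) ⟩
      ∑ (λ s → sumℤ (map (λ f → f s) (map near prime-field))) ℤ.- ∑ (λ s → excess (signs s))      ≡⟨ cong₂ ℤ._-_ (trans (∑-list (map near prime-field)) sevens) ∑-excess ⟩
      pos 7 ℤ.- (pos 84 ℤ.* k ℤ.+ pos 42 ℤ.* pos q ℤ.+ pos 49)   ≡⟨ lem k (pos q) ⟩
      pos 42 ℤ.* ℤ.- (pos 2 ℤ.* k) ℤ.- pos 42 ℤ.* (pos q ℤ.+ 1ℤ)   ∎))
      where
      open ℤₚ.≤-Reasoning
      k : ℤ
      k = cubic-sum 1#
      lem : ∀ k q → pos 7 ℤ.- (pos 84 ℤ.* k ℤ.+ pos 42 ℤ.* q ℤ.+ pos 49) ≡ pos 42 ℤ.* ℤ.- (pos 2 ℤ.* k) ℤ.- pos 42 ℤ.* (q ℤ.+ 1ℤ)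
      lem = solve-∀
      one : ∀ a → ∑ (near a) ≡ 1ℤ
      one a = trans (∑-only _ a λ x x≢a → ind-no (x ≟ a) x≢a) (ind-yes (a ≟ a) refl)
      sevens : sumℤ (map ∑ (map near prime-field)) ≡ pos 7
      sevens = cong₂ ℤ._+_ (one 0#) (cong₂ ℤ._+_ (one 1#) (cong₂ ℤ._+_ (one (♯ 2)) (cong₂ ℤ._+_ (one (♯ 3)) (cong₂ ℤ._+_ (one (♯ 4)) (cong₂ ℤ._+_ (one (♯ 5)) (cong₂ ℤ._+_ (one (♯ 6)) refl))))))

    -- (q + 1)² ≤ 4k² and (q - 1)k² ≤ 6q² give (q - 1)(q + 1)² ≤ 24q², which fails as soon as q - 1
    -- ≥ 24.
    contradiction-7 : 25 ℕ.≤ q → ⊥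
    contradiction-7 25≤q = ℤₚ.<⇒≱ (begin-strict
      pos 24 ℤ.* (pos q ℤ.* pos q)   ≡⟨ sym (trans (ℤₚ.pos-* 24 (q ℕ.* q)) (cong (λ z → pos 24 ℤ.* z) (ℤₚ.pos-* q q))) ⟩
      pos (24 ℕ.* (q ℕ.* q))   <⟨ ℤ.+<+ (ℕₚ.*-monoʳ-< 24 (ℕₚ.*-mono-< (ℕₚ.n<1+n q) (ℕₚ.n<1+n q))) ⟩
      pos (24 ℕ.* (suc q ℕ.* suc q))   ≤⟨ ℤ.+≤+ (ℕₚ.*-monoˡ-≤ (suc q ℕ.* suc q) 24≤q∸1) ⟩
      pos ((q ℕ.∸ 1) ℕ.* (suc q ℕ.* suc q))   ≡⟨ trans (ℤₚ.pos-* (q ℕ.∸ 1) (suc q ℕ.* suc q)) (cong (λ z → P ℤ.* z) (trans (ℤₚ.pos-* (suc q) (suc q)) (cong (λ z → z ℤ.* z) (ℤₚ.+-comm 1ℤ (pos q))))) ⟩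
      P ℤ.* ((pos q ℤ.+ 1ℤ) ℤ.* (pos q ℤ.+ 1ℤ))   ≤⟨ ℤₚ.*-monoˡ-≤-nonNeg P (square-mono cubic-sum-large) ⟩
      P ℤ.* (ℤ.- (pos 2 ℤ.* k) ℤ.* ℤ.- (pos 2 ℤ.* k))   ∎) (begin
      P ℤ.* (ℤ.- (pos 2 ℤ.* k) ℤ.* ℤ.- (pos 2 ℤ.* k))   ≡⟨ lem₁ P k ⟩
      pos 4 ℤ.* ((P ℤ.+ 1ℤ) ℤ.* (k ℤ.* k) ℤ.- k ℤ.* k)   ≡⟨ cong (λ z → pos 4 ℤ.* (z ℤ.* (k ℤ.* k) ℤ.- k ℤ.* k)) P+1 ⟩
      pos 4 ℤ.* (pos q ℤ.* (k ℤ.* k) ℤ.- k ℤ.* k)   ≤⟨ ℤₚ.*-monoˡ-≤-nonNeg (pos 4) (ℤₚ.+-monoˡ-≤ (ℤ.- (k ℤ.* k)) cubic-sum-bound) ⟩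
      pos 4 ℤ.* (pos 6 ℤ.* (pos q ℤ.* pos q) ℤ.+ k ℤ.* k ℤ.- k ℤ.* k) ≡⟨ lem₂ (pos q ℤ.* pos q) (k ℤ.* k) ⟩
      pos 24 ℤ.* (pos q ℤ.* pos q)   ∎)
      where
      open ℤₚ.≤-Reasoning
      k P : ℤ
      k = cubic-sum 1#
      P = pos (q ℕ.∸ 1)
      24≤q∸1 : 24 ℕ.≤ q ℕ.∸ 1
      24≤q∸1 = ℕₚ.∸-monoˡ-≤ 1 25≤q
      P+1 : P ℤ.+ 1ℤ ≡ pos q
      P+1 = cong pos (ℕₚ.m∸n+n≡m (ℕₚ.≤-trans (ℕ.s≤s ℕ.z≤n) 25≤q))
      square-mono : ∀ {n z} → pos n ℤ.+ 1ℤ ℤ.≤ z → (pos n ℤ.+ 1ℤ) ℤ.* (pos n ℤ.+ 1ℤ) ℤ.≤ z ℤ.* z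
      square-mono {n} {z} le = ℤₚ.≤-trans (ℤₚ.*-monoˡ-≤-nonNeg (pos n ℤ.+ 1ℤ) le) (ℤₚ.*-monoʳ-≤-nonNeg z ⦃ ℤ.nonNegative (ℤₚ.≤-trans (ℤ.+≤+ ℕ.z≤n) le) ⦄ le)
      lem₁ : ∀ p k → p ℤ.* (ℤ.- (pos 2 ℤ.* k) ℤ.* ℤ.- (pos 2 ℤ.* k)) ≡ pos 4 ℤ.* ((p ℤ.+ 1ℤ) ℤ.* (k ℤ.* k) ℤ.- k ℤ.* k)
      lem₁ = solve-∀
      lem₂ : ∀ a b → pos 4 ℤ.* (pos 6 ℤ.* a ℤ.+ b ℤ.- b) ≡ pos 24 ℤ.* a
      lem₂ = solve-∀

-- The characteristic of the field, and the theorem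

odd-power-mod-8 : ∀ m → (m ℕ.* m) ℕ.% 8 ≡ 1 → ∀ k → (m ℕ.^ k) ℕ.% 8 ≡ 1 ⊎ (m ℕ.^ k) ℕ.% 8 ≡ m ℕ.% 8
odd-power-mod-8 m m² zero = inj₁ refl
odd-power-mod-8 m m² (suc k) with odd-power-mod-8 m m² k
... | inj₁ e = inj₂ (trans (ℕ-DivMod.%-distribˡ-* m (m ℕ.^ k) 8) (trans (cong (λ z → (m ℕ.% 8 ℕ.* z) ℕ.% 8) e) (trans (cong (ℕ._% 8) (ℕₚ.*-identityʳ (m ℕ.% 8))) (ℕ-DivMod.m%n%n≡m%n m 8))))
... | inj₂ e = inj₁ (trans (ℕ-DivMod.%-distribˡ-* m (m ℕ.^ k) 8) (trans (cong (λ z → (m ℕ.% 8 ℕ.* z) ℕ.% 8) e) (trans (sym (ℕ-DivMod.%-distribˡ-* m m 8)) m²)))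

distinct-primes-coprime : ∀ {p ℓ} → Prime p → Prime ℓ → p ≢ ℓ → Coprime p ℓ
distinct-primes-coprime {p} {ℓ} p-prime ℓ-prime p≢ℓ with ℕₚ.<-cmp p ℓ
... | tri< p<ℓ _ _ = Coprimality.sym (prime⇒coprime ℓ-prime {{prime⇒nonZero p-prime}} p<ℓ)
... | tri≈ _ p≡ℓ _ = contradiction p≡ℓ p≢ℓ
... | tri> _ _ ℓ<p = prime⇒coprime p-prime {{prime⇒nonZero ℓ-prime}} ℓ<p

module Characteristic {q : ℕ} (F : FiniteField q) where
  open FiniteField F
  open FieldAlgebra F
  open FieldSums F
  open QuadraticCharacter F
  open Numerals F

  private
    module Additive = MonoidSum (CommutativeRing.+-commutativeMonoid commutativeRing)

  -- Translation by 1 permutes the field, so adding 1 to every element does not change the sum of all elements.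
  ♯q≡0 : ♯ q ≡ 0#
  ♯q≡0 = begin
    ♯ q   ≡⟨ solve 2 (λ n s → n := s :+ n :- s) refl (♯ q) (Additive.sum elem) ⟩
    Additive.sum elem + ♯ q - Additive.sum elem  ≡⟨ cong (λ z → z - Additive.sum elem) (sym (trans permuted shifted)) ⟩
    Additive.sum elem - Additive.sum elem        ≡⟨ -‿inverseʳ _ ⟩
    0#   ∎
    where
    open ≡-Reasoning
    sum-ones : ∀ n → Additive.sum {n} (λ _ → 1#) ≡ ♯ n
    sum-ones zero = refl
    sum-ones (suc n) = trans (cong (λ z → 1# + z) (sum-ones n)) (sym (ι-+ (pos 1) (pos n)))
    permuted : Additive.sum elem ≡ Additive.sum (λ i → elem i + 1#)
    permuted = trans (Additive.sum-permute elem (permutation (λ i → index (elem i + 1#)) (λ i → index (elem i - 1#))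
      (λ i → trans (cong (λ z → index (z + 1#)) (elem-index _)) (trans (cong index (solve 1 (λ x → x :- κ 1 :+ κ 1 := x) refl (elem i))) (index-elem i)))
      (λ i → trans (cong (λ z → index (z - 1#)) (elem-index _)) (trans (cong index (solve 1 (λ x → x :+ κ 1 :- κ 1 := x) refl (elem i))) (index-elem i)))))
      (Additive.sum-cong-≗ λ i → elem-index (elem i + 1#))
    shifted : Additive.sum (λ i → elem i + 1#) ≡ Additive.sum elem + ♯ q
    shifted = trans (Additive.∑-distrib-+ elem (λ _ → 1#)) (cong (λ z → Additive.sum elem + z) (sum-ones q))

  ♯[p^k]≡0⇒♯p≡0 : ∀ p k → ♯ (p ℕ.^ k) ≡ 0# → ♯ p ≡ 0#
  ♯[p^k]≡0⇒♯p≡0 p zero e = contradiction e 1≢0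
  ♯[p^k]≡0⇒♯p≡0 p (suc k) e with (♯ p) ≟ 0#
  ... | yes p≡0 = p≡0
  ... | no p≢0 = ♯[p^k]≡0⇒♯p≡0 p k (x*y≡0⇒y≡0 (♯ p) _ p≢0 (trans (sym (♯-* p (p ℕ.^ k))) e))

  bézout⇒1≡0 : ∀ x y m n → ♯ m ≡ 0# → ♯ n ≡ 0# → 1 ℕ.+ x ℕ.* m ≡ y ℕ.* n → 1# ≡ 0#
  bézout⇒1≡0 x y m n m≡0 n≡0 eq = begin
    1#   ≡⟨ sym (trans (cong (λ z → 1# + z) (trans (♯-* x m) (trans (cong (λ z → ♯ x * z) m≡0) (zeroʳ _)))) (+-identityʳ 1#)) ⟩
    1# + ♯ (x ℕ.* m)          ≡⟨ sym (ι-+ (pos 1) (pos (x ℕ.* m))) ⟩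
    ♯ (1 ℕ.+ x ℕ.* m)         ≡⟨ cong ♯_ eq ⟩
    ♯ (y ℕ.* n)   ≡⟨ trans (♯-* y n) (trans (cong (λ z → ♯ y * z) n≡0) (zeroʳ _)) ⟩
    0#   ∎
    where open ≡-Reasoning

  coprime⇒≢0 : ∀ m n → Coprime m n → ♯ m ≡ 0# → ♯ n ≢0
  coprime⇒≢0 m n coprime m≡0 n≡0 with coprime-Bézout coprime
  ... | Bézout.+- x y eq = 1≢0 (bézout⇒1≡0 y x n m n≡0 m≡0 eq)
  ... | Bézout.-+ x y eq = 1≢0 (bézout⇒1≡0 x y m n m≡0 n≡0 eq)

theorem5 : (q : ℕ) (F : FiniteField q) →
    (Σ ℕ λ p → Σ ℕ λ k → Prime p × ¬ (p ≡ 2) × q ≡ p ^ k) →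
    q % 8 ≡ 7 → 7 < q →
    FiniteField.diffUniformity F (FiniteField.F213 F) ≡ 3
theorem5 q F (p , k , p-prime , _ , q≡p^k) q≡7 7<q = go (Finₚ.any? λ i → good? (elem i))
  where
  open FiniteField F
  open FieldAlgebra F
  open FieldSums F
  open Characteristic F

  p≡0 : ♯ p ≡ 0#
  p≡0 = ♯[p^k]≡0⇒♯p≡0 p k (trans (cong ♯_ (sym q≡p^k)) ♯q≡0)

  prime≢0 : ∀ ℓ → Prime ℓ → p ≢ ℓ → ♯ ℓ ≢ 0#
  prime≢0 ℓ ℓ-prime p≢ℓ = coprime⇒≢0 p ℓ (distinct-primes-coprime p-prime ℓ-prime p≢ℓ) p≡0

  -- The first hypothesis holds for odd ℓ. The powers of ℓ are then 1 or ℓ mod 8, so none is 7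
  -- unless ℓ itself is.
  p≢ : ∀ ℓ → (ℓ ℕ.* ℓ) ℕ.% 8 ≡ 1 → ℓ ℕ.% 8 ≢ 7 → p ≢ ℓ
  p≢ ℓ ℓ² ℓ≢7 refl with odd-power-mod-8 ℓ ℓ² k
  ... | inj₁ e = contradiction (trans (sym q≡7) (trans (cong (ℕ._% 8) q≡p^k) e)) λ ()
  ... | inj₂ e = ℓ≢7 (trans (sym e) (trans (cong (ℕ._% 8) (sym q≡p^k)) q≡7))

  3≢0 : ♯ 3 ≢ 0#
  3≢0 = prime≢0 3 (from-yes (prime? 3)) (p≢ 3 refl λ ())

  open Differential F q≡7 3≢0 using (Good; good?; good⇒diffUniformity≡3)

  impossible : (∀ x → ¬ Good x) → ⊥
  impossible none with p ℕ.≟ 7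
  ... | no p≢7 = Generic.contradiction-generic F q≡7 3≢0
      (prime≢0 5 (from-yes (prime? 5)) (p≢ 5 refl λ ()))
      (prime≢0 7 (from-yes (prime? 7)) p≢7)
      (prime≢0 11 (from-yes (prime? 11)) (p≢ 11 refl λ ()))
      (prime≢0 13 (from-yes (prime? 13)) (p≢ 13 refl λ ()))
      (prime≢0 37 (from-yes (prime? 37)) (p≢ 37 refl λ ()))
      (prime≢0 59 (from-yes (prime? 59)) (p≢ 59 refl λ ()))
      (prime≢0 83 (from-yes (prime? 83)) (p≢ 83 refl λ ()))
      (prime≢0 227 (from-yes (prime? 227)) (p≢ 227 refl λ ()))
      none
  ... | yes refl = Characteristic7.contradiction-7 F q≡7 p≡0 3≢0 none (25≤q k q≡p^k)
    where
    -- q > 7 rules out the exponents 0 and 1, so q is at least 49.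
    25≤q : ∀ k → q ≡ 7 ℕ.^ k → 25 ℕ.≤ q
    25≤q 0 e = contradiction (subst (7 ℕ.<_) e 7<q) λ { (ℕ.s≤s ()) }
    25≤q 1 e = contradiction (subst (7 ℕ.<_) e 7<q) (ℕₚ.<-irrefl refl)
    25≤q (suc (suc k)) e = ℕₚ.≤-trans (ℕₚ.≤-trans (ℕₚ.m≤m+n 25 24) (ℕₚ.^-monoʳ-≤ 7 (ℕₚ.m≤m+n 2 k))) (ℕₚ.≤-reflexive (sym e))

  go : Dec (∃ λ i → Good (elem i)) → diffUniformity F213 ≡ 3
  go (yes (i , good)) = good⇒diffUniformity≡3 (elem i) good
  go (no ¬good) = contradiction (impossible λ x good → ¬good (index x , subst Good (sym (elem-index x)) good)) λ ()
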